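{- Let $v\in S_{p+1}$ be indecomposable of length $n-1$. For $m=0,\dots,n-p-1$ let $v^{[m]}=1^m\times v\times 1^{n-p-1-m}\in S_n$, and for $j\ge0$ let $\nu_v(j)=\mathfrak{S}_{1^j\times v}(1,q,q^2,\dots)$. Then, as formal power series in $t$, $$\sum_{j\ge0}\nu_v(j)\,t^j=\frac{\sum_{m=0}^{n-p-1}a_{v^{[m]}}(q)\,t^m}{(t;q)_n}.$$
   Context: $\mathbf{k}$ is a field of characteristic zero and $q\in\mathbf{k}$ is not a nontrivial root of unity; $(t;q)_n=\prod_{i=1}^n(1-tq^{i-1})$. $1^m$ denotes the identity of $S_m$; for $u\in S_a$, $v\in S_b$, $u\times v\in S_{a+b}$ is $(u\times v)(i)=u(i)$ for $i\le a$, $a+v(i-a)$ for $i>a$. A permutation is indecomposable if it cannot be written as $u\times v$ with both factors in symmetric groups $S_m$, $m\ge1$. Schubert polynomials $\mathfrak{S}_w$ (defined for $w\in S_\infty$): $\mathfrak{S}_{w_0}=x_1^{n-1}\cdots x_{n-1}$, $\mathfrak{S}_{ws_i}=\partial_i\mathfrak{S}_w$ when $w(i)>w(i+1)$. For $w\in S_n$ of length $n-1$, $a_w(q):=\langle\mathfrak{S}_w\rangle_n^q$, with $\langle f\rangle_n^q:=\partial_{w_0}\big(f\prod_{1\le i,\ i+2\le j\le n}(qx_i-x_j)\big)$ and $\partial_{w_0}g=\big(\sum_{\sigma\in S_n}\mathrm{sgn}(\sigma)g(x_{\sigma(1)},\dots,x_{\sigma(n)})\big)/\prod_{i<j}(x_i-x_j)$.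 -}

module Defs where

open import Level using (_⊔_)
open import Algebra.Bundles using (CommutativeRing)
open import Data.Nat as ℕ using (ℕ; zero; suc; _+_; _∸_; _<ᵇ_; _<_; _<?_)
import Data.Nat.Properties as ℕₚ
open import Data.Bool using (Bool; true; false; if_then_else_)
open import Data.List using (List; []; _∷_; map; concatMap; foldr; upTo; reverse; filter; length)
open import Data.Product using (_×_; _,_; Σ; ∃; ∃-syntax)
open import Data.Maybe using (Maybe; just; nothing)
open import Data.Fin using (Fin; toℕ; fromℕ<)
open import Data.Fin.Permutation using (Permutation′; _⟨$⟩ʳ_)
open import Relation.Nullary using (¬_; yes; no)
open import Relation.Binary.PropositionalEquality using (_≡_)
open import Function using (id; _∘_)

-- Permutations, viewed as functions ℕ → ℕ (0-indexed), fixing k ≥ N.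

toFun : ∀ {N} → Permutation′ N → ℕ → ℕ
toFun {N} π k with k <? N
... | yes k<N = toℕ (π ⟨$⟩ʳ fromℕ< k<N)
... | no _    = k

prodFun : ℕ → (ℕ → ℕ) → (ℕ → ℕ) → ℕ → ℕ
prodFun a u w k = if k <ᵇ a then u k else a + w (k ∸ a)

len : ℕ → (ℕ → ℕ) → ℕ
len N w = length (concatMap (λ i → filter (λ j → w j <? w i)
                     (map (λ d → suc i + d) (upTo (N ∸ suc i)))) (upTo N))

Indecomposable : ∀ {N} → Permutation′ N → Set
Indecomposable {N} v =
  ¬ (∃[ a ] ∃[ b ] ((suc a + suc b ≡ N) ×
       Σ (Permutation′ (suc a)) λ u → Σ (Permutation′ (suc b)) λ w →
         (∀ k → k < N → toFun v k ≡ prodFun (suc a) (toFun u) (toFun w) k)))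

sFun : ℕ → ℕ → ℕ
sFun i k with k ℕ.≟ i | k ℕ.≟ suc i
... | yes _ | _     = suc i
... | no _  | yes _ = i
... | no _  | no _  = k

ascent : ℕ → (ℕ → ℕ) → Maybe ℕ
ascent N w = go (upTo (N ∸ 1))
  where
  go : List ℕ → Maybe ℕ
  go [] = nothing
  go (i ∷ is) = if w i <ᵇ w (suc i) then just i else go is

-- Polynomials in x_0, x_1, ... (x_{k} here is x_{k+1} of the paper)
-- over a commutative ring, as lists of terms (coefficient, exponent list).

module _ {c ℓ} (R : CommutativeRing c ℓ) where
  open CommutativeRing R renaming (_+_ to _⊕_; _*_ to _⊛_)

  pow : Carrier → ℕ → Carrier
  pow x zero = 1#
  pow x (suc n) = x ⊛ pow x n

  embedℕ : ℕ → Carrier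
  embedℕ zero = 0#
  embedℕ (suc n) = 1# ⊕ embedℕ n

  IsField : Set (c ⊔ ℓ)
  IsField = (¬ (1# ≈ 0#)) × (∀ x → ¬ (x ≈ 0#) → ∃[ y ] (x ⊛ y ≈ 1#))

  CharZero : Set ℓ
  CharZero = ∀ k → ¬ (embedℕ (suc k) ≈ 0#)

  NotNontrivialRootOfUnity : Carrier → Set ℓ
  NotNontrivialRootOfUnity q = ∀ k → pow q (suc k) ≈ 1# → q ≈ 1#

  Poly : Set c
  Poly = List (Carrier × List ℕ)

  getE : List ℕ → ℕ → ℕ
  getE [] _ = 0
  getE (e ∷ es) zero = e
  getE (e ∷ es) (suc i) = getE es i

  setE : List ℕ → ℕ → ℕ → List ℕ
  setE [] zero v = v ∷ []
  setE [] (suc i) v = 0 ∷ setE [] i v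
  setE (e ∷ es) zero v = v ∷ es
  setE (e ∷ es) (suc i) v = e ∷ setE es i v

  addE : List ℕ → List ℕ → List ℕ
  addE [] bs = bs
  addE (a ∷ as) [] = a ∷ as
  addE (a ∷ as) (b ∷ bs) = (a + b) ∷ addE as bs

  mulP : Poly → Poly → Poly
  mulP p r = concatMap (λ { (x , a) → map (λ { (y , b) → (x ⊛ y , addE a b) }) r }) p

  oneP : Poly
  oneP = (1# , []) ∷ []

  prodP : List Poly → Poly
  prodP = foldr mulP oneP

  -- divided difference ∂_i on a monomial:
  -- (x_i^A x_{i+1}^B - x_i^B x_{i+1}^A)/(x_i - x_{i+1})
  dTerm : ℕ → Carrier × List ℕ → Poly
  dTerm i (x , a) =
    let A = getE a i ; B = getE a (suc i) in
    if B <ᵇ A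
      then map (λ k → (x , setE (setE a i (A ∸ 1 ∸ k)) (suc i) (B + k))) (upTo (A ∸ B))
      else (if A <ᵇ B
        then map (λ k → (- x , setE (setE a i (B ∸ 1 ∸ k)) (suc i) (A + k))) (upTo (B ∸ A))
        else [])

  ∂ : ℕ → Poly → Poly
  ∂ i = concatMap (dTerm i)

  applyWord : List ℕ → Poly → Poly
  applyWord [] f = f
  applyWord (i ∷ w) f = ∂ i (applyWord w f)

  -- ∂_{w0} for S_n via the reduced word s_1 (s_2 s_1) (s_3 s_2 s_1) ... of w0
  ∂w0 : ℕ → Poly → Poly
  ∂w0 n = applyWord (concatMap (λ r → reverse (upTo (suc r))) (upTo (n ∸ 1)))

  evalE : (ℕ → Carrier) → ℕ → List ℕ → Carrier
  evalE f i [] = 1#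
  evalE f i (e ∷ es) = pow (f i) e ⊛ evalE f (suc i) es

  evalP : (ℕ → Carrier) → Poly → Carrier
  evalP f = foldr (λ { (x , a) s → x ⊛ evalE f 0 a ⊕ s }) 0#

  -- Schubert polynomial of w ∈ S_N : 𝔖_{w0} = x^δ, 𝔖_w = ∂_i 𝔖_{w s_i} at an ascent i
  xδ : ℕ → Poly
  xδ N = (1# , map (λ k → N ∸ 1 ∸ k) (upTo N)) ∷ []

  schubF : ℕ → ℕ → (ℕ → ℕ) → Poly
  schubF N zero w = xδ N
  schubF N (suc fuel) w with ascent N w
  ... | nothing = xδ N
  ... | just i  = ∂ i (schubF N fuel (w ∘ sFun i))

  schub : ℕ → (ℕ → ℕ) → Poly
  schub N w = schubF N (N ℕ.* N) w

  -- ⟨f⟩_n^q = ∂_{w0}( f ∏_{i+2 ≤ j} (q x_i - x_j) ), a constant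
  linP : Carrier → ℕ → ℕ → Poly
  linP q i j = (q , setE [] i 1) ∷ (- 1# , setE [] j 1) ∷ []

  bracket : Carrier → ℕ → Poly → Poly
  bracket q n f = ∂w0 n (mulP f (prodP
    (concatMap (λ i → map (λ k → linP q i (i + 2 + k)) (upTo (n ∸ (i + 2)))) (upTo n))))

  aCoeff : Carrier → ℕ → (ℕ → ℕ) → Carrier
  aCoeff q N w = evalP (λ _ → 0#) (bracket q N (schub N w))

  PS : Set c
  PS = ℕ → Carrier

  sumL : List Carrier → Carrier
  sumL = foldr _⊕_ 0#

  _⋆_ : PS → PS → PS
  (f ⋆ g) j = sumL (map (λ i → f i ⊛ g (j ∸ i)) (upTo (suc j)))

  oneS : PS
  oneS zero = 1#
  oneS (suc _) = 0#

  geomS : Carrier → PS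
  geomS r k = pow r k

  invPoch : Carrier → ℕ → PS
  invPoch q n = foldr _⋆_ oneS (map (λ i → geomS (pow q i)) (upTo n))

  ν : Carrier → (p : ℕ) → Permutation′ (suc p) → PS
  ν q p v j = evalP (λ i → pow q i) (schub (j + suc p) (prodFun j id (toFun v)))

  vShift : (p : ℕ) → Permutation′ (suc p) → ℕ → ℕ → ℕ
  vShift p v m = prodFun (m + suc p) (prodFun m id (toFun v)) id

  numer : Carrier → ℕ → (p : ℕ) → Permutation′ (suc p) → PS
  numer q n p v m = if m <ᵇ (n ∸ p) then aCoeff q n (vShift p v m) else 0#

{-# OPTIONS --safe #-}
module Submission where

-- Write λ_N(f) = ⟨f⟩_N^q = ∂_{w₀}(f Π_N) and y_l = q x_l − x_{l+1}. Multiplying Π_N by y_l completes the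
-- product of the q x_a − x_b over a ≤ l < b, which is symmetric in each of the blocks {x_1,…,x_l} and
-- {x_{l+1},…,x_N}; hence λ_N(y_l f) factors through the operators ∂_{w₀} of the two blocks.
--
-- Let f_j = 𝔖_{1^j × v} and B_i = λ_{n+i}(x_1^i f_j). Apply λ_N, N = n+i, to x_1^{i−1} f_j times the identity
--   [N] x_1 = Σ_{l<N} [N−l] y_l + (x_1 + … + x_N),
-- whose last summand is symmetric and contributes 0. The term l = N−1 gives [N] B_{i−1}; for i ≤ j the term
-- l = i gives [N] [n+i−1 choose i] λ_n(f_{j−i}), because f_j becomes f_{j−i} when its first i variables are
-- set to 0. All other terms vanish: for l < i and l > j+p by degree, for i < l ≤ j because f_j is symmetric
-- in x_1,…,x_j, and for j < l ≤ j+p because v is indecomposable: then 1^j × v does not preserve {1,…,l}, so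
-- no word in the divided differences of the two blocks takes f_j to a nonzero constant. Finally
-- x_1^i x_{l+1} and q x_1^i x_l have the same image for l ≤ i, so B_i = f_j(1,q,q²,…) for i = j+p.
-- Altogether ν_v(j) = Σ_i [n+i−1 choose i] a_{v^{[j−i]}}.

-- Only one degree matters: a form F of degree N-1 times Π_N has the degree of the longest
-- permutation, so ∂_{w₀} turns the product into a constant. The power x_1^i raises this degree in
-- step with N, and it decides which cuts survive: a large share of the degree in one block leaves
-- too little for the other. The obstacle is that ∂_{w₀} is given by one fixed word, while every cut
-- l needs a word that applies the letters of its two blocks first. This is why the braid relations
-- and the independence of the path in the weak order are proved; a word counts as reduced once a
-- single polynomial, built from staircase monomials, is not sent to zero by it. The final formula
-- sums over all m ≤ j, the numerator of the theorem only up to n-p-1. The gap is closed by λ_n(f_m)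
-- = 0 for m ≥ n-p, which comes from computing λ_{n+1}(y_n f_m) in two ways. Length 0 is treated
-- apart. Characteristic zero and the condition on q make every [N] with N ≥ 1 nonzero, so that it
-- can be cancelled in the recursions.

open import Algebra.Bundles using (CommutativeRing)
import Algebra.Properties.AbelianGroup as AbelianGroupProperties
import Algebra.Properties.Ring as RingProperties
import Algebra.Solver.Ring
import Algebra.Solver.Ring.AlmostCommutativeRing as ACR
open import Data.Bool using (Bool; true; false; T; if_then_else_)
open import Data.Empty using (⊥-elim)
open import Data.Fin as Fin using (Fin; toℕ; fromℕ<)
open import Data.Fin.Permutation using (Permutation′; _⟨$⟩ʳ_; _⟨$⟩ˡ_; permutation; inverseˡ)
import Data.Fin.Properties as Finₚ
open import Data.Integer as ℤ using (ℤ; +_; -[1+_])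
import Data.Integer.Properties as ℤₚ
open import Data.List using (List; []; _∷_; _++_; map; foldr; length; filter; reverse; upTo; applyUpTo; concatMap)
import Data.List.Properties as Listₚ
open import Data.List.Relation.Unary.All as All using (All; []; _∷_)
import Data.List.Relation.Unary.All.Properties as Allₚ
open import Data.Maybe using (Maybe; just; nothing; maybe)
open import Data.Nat as ℕ using (ℕ; zero; suc; _∸_; _<_; _≤_; z≤n; s≤s; _<ᵇ_)
import Data.Nat.Properties as ℕₚ
open import Algebra.Properties.CommutativeSemigroup ℕₚ.+-commutativeSemigroup using (x∙yz≈y∙xz; interchange)
open import Data.Product using (_×_; _,_; proj₁; proj₂; ∃-syntax)
open import Data.Sum using (_⊎_; inj₁; inj₂)
open import Data.Unit using (⊤; tt)
open import Function using (id; _∘_; const)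
open import Level using (_⊔_)
open import Relation.Binary.Definitions using (tri<; tri≈; tri>)
open import Relation.Binary.PropositionalEquality as ≡ using (_≡_; _≢_)
import Relation.Binary.Reasoning.Setoid as SetoidReasoning
open import Relation.Nullary using (¬_; Dec; yes; no)
open import Defs using (sFun; toFun; prodFun; Indecomposable; len; IsField; CharZero; NotNontrivialRootOfUnity; ν; numer; invPoch; _⋆_)
import Defs


-- The solver needs coefficients with decidable equality, hence the map ℤ → S.
module IntegerSolver {c ℓ} (S : CommutativeRing c ℓ) where
  open CommutativeRing S
  open SetoidReasoning setoid
  open RingProperties ring
  open AbelianGroupProperties +-abelianGroup using (⁻¹-∙-comm)

  -- The separate clause for 1 makes the solver constant `con (+ 1)` reduce to `1#` itself instead
  -- of `1# + 0#`; `⟦suc⟧` restores the uniform recursion.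
  ⟦_⟧ℕ : ℕ → Carrier
  ⟦ 0 ⟧ℕ = 0#
  ⟦ 1 ⟧ℕ = 1#
  ⟦ suc (suc n) ⟧ℕ = 1# + ⟦ suc n ⟧ℕ

  ⟦_⟧ℤ : ℤ → Carrier
  ⟦ + n ⟧ℤ = ⟦ n ⟧ℕ
  ⟦ -[1+ n ] ⟧ℤ = - ⟦ suc n ⟧ℕ

  ⟦suc⟧ : ∀ n → ⟦ suc n ⟧ℕ ≈ 1# + ⟦ n ⟧ℕ
  ⟦suc⟧ zero = sym (+-identityʳ _)
  ⟦suc⟧ (suc n) = refl

  ⟦+⟧ : ∀ m n → ⟦ m ℕ.+ n ⟧ℕ ≈ ⟦ m ⟧ℕ + ⟦ n ⟧ℕ
  ⟦+⟧ zero n = sym (+-identityˡ _)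
  ⟦+⟧ (suc m) n = begin
    ⟦ suc (m ℕ.+ n) ⟧ℕ       ≈⟨ ⟦suc⟧ (m ℕ.+ n) ⟩
    1# + ⟦ m ℕ.+ n ⟧ℕ        ≈⟨ +-congˡ (⟦+⟧ m n) ⟩
    1# + (⟦ m ⟧ℕ + ⟦ n ⟧ℕ)   ≈⟨ +-assoc _ _ _ ⟨
    1# + ⟦ m ⟧ℕ + ⟦ n ⟧ℕ     ≈⟨ +-congʳ (⟦suc⟧ m) ⟨
    ⟦ suc m ⟧ℕ + ⟦ n ⟧ℕ      ∎

  ⟦*⟧ : ∀ m n → ⟦ m ℕ.* n ⟧ℕ ≈ ⟦ m ⟧ℕ * ⟦ n ⟧ℕ
  ⟦*⟧ zero n = sym (zeroˡ _)
  ⟦*⟧ (suc m) n = begin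
    ⟦ n ℕ.+ m ℕ.* n ⟧ℕ                ≈⟨ ⟦+⟧ n (m ℕ.* n) ⟩
    ⟦ n ⟧ℕ + ⟦ m ℕ.* n ⟧ℕ             ≈⟨ +-cong (sym (*-identityˡ _)) (⟦*⟧ m n) ⟩
    1# * ⟦ n ⟧ℕ + ⟦ m ⟧ℕ * ⟦ n ⟧ℕ     ≈⟨ distribʳ _ _ _ ⟨
    (1# + ⟦ m ⟧ℕ) * ⟦ n ⟧ℕ            ≈⟨ *-congʳ (⟦suc⟧ m) ⟨
    ⟦ suc m ⟧ℕ * ⟦ n ⟧ℕ               ∎

  cancel-1# : ∀ a b → a - b ≈ (1# + a) - (1# + b)
  cancel-1# a b = begin
    a - b                     ≈⟨ +-identityˡ _ ⟨
    0# + (a - b)              ≈⟨ +-congʳ (-‿inverseʳ 1#) ⟨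
    (1# - 1#) + (a - b)       ≈⟨ +-assoc _ _ _ ⟩
    1# + (- 1# + (a - b))     ≈⟨ +-congˡ (+-assoc _ _ _) ⟨
    1# + ((- 1# + a) - b)     ≈⟨ +-congˡ (+-congʳ (+-comm _ _)) ⟩
    1# + ((a - 1#) - b)       ≈⟨ +-congˡ (+-assoc _ _ _) ⟩
    1# + (a + (- 1# - b))     ≈⟨ +-assoc _ _ _ ⟨
    (1# + a) + (- 1# - b)     ≈⟨ +-congˡ (⁻¹-∙-comm 1# b) ⟩
    (1# + a) - (1# + b)       ∎

  ⟦⊖⟧ : ∀ m n → ⟦ m ℤ.⊖ n ⟧ℤ ≈ ⟦ m ⟧ℕ - ⟦ n ⟧ℕ
  ⟦⊖⟧ zero zero = sym (-‿inverseʳ 0#)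
  ⟦⊖⟧ zero (suc n) = sym (+-identityˡ _)
  ⟦⊖⟧ (suc m) zero = sym (trans (+-congˡ -0#≈0#) (+-identityʳ _))
  ⟦⊖⟧ (suc m) (suc n) = begin
    ⟦ suc m ℤ.⊖ suc n ⟧ℤ           ≡⟨ ≡.cong ⟦_⟧ℤ (ℤₚ.[1+m]⊖[1+n]≡m⊖n m n) ⟩
    ⟦ m ℤ.⊖ n ⟧ℤ                   ≈⟨ ⟦⊖⟧ m n ⟩
    ⟦ m ⟧ℕ - ⟦ n ⟧ℕ                ≈⟨ cancel-1# _ _ ⟩
    (1# + ⟦ m ⟧ℕ) - (1# + ⟦ n ⟧ℕ)  ≈⟨ +-cong (⟦suc⟧ m) (-‿cong (⟦suc⟧ n)) ⟨
    ⟦ suc m ⟧ℕ - ⟦ suc n ⟧ℕ        ∎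

  ⟦+⟧ℤ : ∀ i j → ⟦ i ℤ.+ j ⟧ℤ ≈ ⟦ i ⟧ℤ + ⟦ j ⟧ℤ
  ⟦+⟧ℤ (+ m) (+ n) = ⟦+⟧ m n
  ⟦+⟧ℤ (+ m) -[1+ n ] = ⟦⊖⟧ m (suc n)
  ⟦+⟧ℤ -[1+ m ] (+ n) = trans (⟦⊖⟧ n (suc m)) (+-comm _ _)
  ⟦+⟧ℤ -[1+ m ] -[1+ n ] = begin
    - ⟦ suc (suc (m ℕ.+ n)) ⟧ℕ      ≡⟨ ≡.cong (λ k → - ⟦ suc k ⟧ℕ) (ℕₚ.+-suc m n) ⟨
    - ⟦ suc m ℕ.+ suc n ⟧ℕ          ≈⟨ -‿cong (⟦+⟧ (suc m) (suc n)) ⟩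
    - (⟦ suc m ⟧ℕ + ⟦ suc n ⟧ℕ)     ≈⟨ ⁻¹-∙-comm _ _ ⟨
    - ⟦ suc m ⟧ℕ - ⟦ suc n ⟧ℕ       ∎

  ⟦-⟧ℤ : ∀ i → ⟦ ℤ.- i ⟧ℤ ≈ - ⟦ i ⟧ℤ
  ⟦-⟧ℤ (+ zero) = sym -0#≈0#
  ⟦-⟧ℤ (+ suc n) = refl
  ⟦-⟧ℤ -[1+ n ] = sym (-‿involutive _)

  ⟦+*+⟧ℤ : ∀ m n → ⟦ + m ℤ.* + n ⟧ℤ ≈ ⟦ m ⟧ℕ * ⟦ n ⟧ℕ
  ⟦+*+⟧ℤ m n = trans (reflexive (≡.cong ⟦_⟧ℤ (≡.sym (ℤₚ.pos-* m n)))) (⟦*⟧ m n)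

  ⟦*⟧ℤ : ∀ i j → ⟦ i ℤ.* j ⟧ℤ ≈ ⟦ i ⟧ℤ * ⟦ j ⟧ℤ
  ⟦*⟧ℤ (+ m) (+ n) = ⟦+*+⟧ℤ m n
  ⟦*⟧ℤ (+ m) -[1+ n ] = begin
    ⟦ + m ℤ.* ℤ.- (+ suc n) ⟧ℤ      ≡⟨ ≡.cong ⟦_⟧ℤ (ℤₚ.neg-distribʳ-* (+ m) (+ suc n)) ⟨
    ⟦ ℤ.- (+ m ℤ.* + suc n) ⟧ℤ      ≈⟨ ⟦-⟧ℤ (+ m ℤ.* + suc n) ⟩
    - ⟦ + m ℤ.* + suc n ⟧ℤ          ≈⟨ -‿cong (⟦+*+⟧ℤ m (suc n)) ⟩
    - (⟦ m ⟧ℕ * ⟦ suc n ⟧ℕ)         ≈⟨ -‿distribʳ-* _ _ ⟩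
    ⟦ m ⟧ℕ * (- ⟦ suc n ⟧ℕ)         ∎
  ⟦*⟧ℤ -[1+ m ] (+ n) = begin
    ⟦ ℤ.- (+ suc m) ℤ.* + n ⟧ℤ      ≡⟨ ≡.cong ⟦_⟧ℤ (ℤₚ.neg-distribˡ-* (+ suc m) (+ n)) ⟨
    ⟦ ℤ.- (+ suc m ℤ.* + n) ⟧ℤ      ≈⟨ ⟦-⟧ℤ (+ suc m ℤ.* + n) ⟩
    - ⟦ + suc m ℤ.* + n ⟧ℤ          ≈⟨ -‿cong (⟦+*+⟧ℤ (suc m) n) ⟩
    - (⟦ suc m ⟧ℕ * ⟦ n ⟧ℕ)         ≈⟨ -‿distribˡ-* _ _ ⟩
    (- ⟦ suc m ⟧ℕ) * ⟦ n ⟧ℕ         ∎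
  ⟦*⟧ℤ -[1+ m ] -[1+ n ] = begin
    ⟦ suc m ℕ.* suc n ⟧ℕ              ≈⟨ ⟦*⟧ (suc m) (suc n) ⟩
    ⟦ suc m ⟧ℕ * ⟦ suc n ⟧ℕ           ≈⟨ -‿involutive _ ⟨
    - - (⟦ suc m ⟧ℕ * ⟦ suc n ⟧ℕ)     ≈⟨ -‿cong (-‿distribʳ-* _ _) ⟩
    - (⟦ suc m ⟧ℕ * - ⟦ suc n ⟧ℕ)     ≈⟨ -‿distribˡ-* _ _ ⟩
    - ⟦ suc m ⟧ℕ * - ⟦ suc n ⟧ℕ       ∎

  homomorphism : CommutativeRing.rawRing ℤₚ.+-*-commutativeRing ACR.-Raw-AlmostCommutative⟶ ACR.fromCommutativeRing S
  homomorphism = record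
    { ⟦_⟧ = ⟦_⟧ℤ ; +-homo = ⟦+⟧ℤ ; *-homo = ⟦*⟧ℤ ; -‿homo = ⟦-⟧ℤ ; 0-homo = refl ; 1-homo = refl }

  ≟-coefficient : (i j : ℤ) → Maybe (⟦ i ⟧ℤ ≈ ⟦ j ⟧ℤ)
  ≟-coefficient i j with i ℤ.≟ j
  ... | yes i≡j = just (reflexive (≡.cong ⟦_⟧ℤ i≡j))
  ... | no _ = nothing

  open Algebra.Solver.Ring _ _ homomorphism ≟-coefficient public
    using (solve; _:=_; _:+_; _:*_; _:-_; :-_; con)

-- Comparisons of naturals and adjacent transpositions

<ᵇ-true : ∀ {m n} → (m ℕ.<ᵇ n) ≡ true → m ℕ.< n
<ᵇ-true {m} {n} eq = ℕₚ.<ᵇ⇒< m n (≡.subst T (≡.sym eq) tt)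

<ᵇ-false : ∀ {m n} → (m ℕ.<ᵇ n) ≡ false → n ℕ.≤ m
<ᵇ-false {m} {n} eq = ℕₚ.≮⇒≥ λ m<n → ≡.subst T eq (ℕₚ.<⇒<ᵇ m<n)

sFun-left : ∀ i → Defs.sFun i i ≡ suc i
sFun-left i with i ℕ.≟ i | i ℕ.≟ suc i
... | yes _ | _ = ≡.refl
... | no i≢i | _ = ⊥-elim (i≢i ≡.refl)

sFun-right : ∀ i → Defs.sFun i (suc i) ≡ i
sFun-right i with suc i ℕ.≟ i | suc i ℕ.≟ suc i
... | yes 1+i≡i | _ = ⊥-elim (ℕₚ.1+n≢n 1+i≡i)
... | no _ | yes _ = ≡.refl
... | no _ | no i≢i = ⊥-elim (i≢i ≡.refl)

sFun-other : ∀ {i k} → k ≢ i → k ≢ suc i → Defs.sFun i k ≡ k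
sFun-other {i} {k} k≢i k≢1+i with k ℕ.≟ i | k ℕ.≟ suc i
... | yes k≡i | _ = ⊥-elim (k≢i k≡i)
... | no _ | yes k≡1+i = ⊥-elim (k≢1+i k≡1+i)
... | no _ | no _ = ≡.refl

data SView (i : ℕ) : ℕ → Set where
  left : SView i i
  right : SView i (suc i)
  other : ∀ {k} → k ≢ i → k ≢ suc i → SView i k

sView : ∀ i k → SView i k
sView i k with k ℕ.≟ i | k ℕ.≟ suc i
... | yes ≡.refl | _ = left
... | no _ | yes ≡.refl = right
... | no k≢i | no k≢1+i = other k≢i k≢1+i

sFun-involutive : ∀ i k → Defs.sFun i (Defs.sFun i k) ≡ k
sFun-involutive i k with sView i k
... | left = ≡.trans (≡.cong (Defs.sFun i) (sFun-left i)) (sFun-right i)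
... | right = ≡.trans (≡.cong (Defs.sFun i) (sFun-right i)) (sFun-left i)
... | other a b = ≡.trans (≡.cong (Defs.sFun i) (sFun-other a b)) (sFun-other a b)

-- Evaluation of exponent lists

module EvalHom {c ℓ} (S : CommutativeRing c ℓ) where
  open CommutativeRing S
  open SetoidReasoning setoid
  open IntegerSolver S

  pow-+ : ∀ x m n → Defs.pow S x (m ℕ.+ n) ≈ Defs.pow S x m * Defs.pow S x n
  pow-+ x zero n = sym (*-identityˡ _)
  pow-+ x (suc m) n = trans (*-congˡ (pow-+ x m n)) (sym (*-assoc _ _ _))

  pow-cong : ∀ {x y} n → x ≈ y → Defs.pow S x n ≈ Defs.pow S y n
  pow-cong zero x≈y = refl
  pow-cong (suc n) x≈y = *-cong x≈y (pow-cong n x≈y)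

  evalE-addE : ∀ θ i a b → Defs.evalE S θ i (Defs.addE S a b) ≈ Defs.evalE S θ i a * Defs.evalE S θ i b
  evalE-addE θ i [] b = sym (*-identityˡ _)
  evalE-addE θ i (a ∷ as) [] = sym (*-identityʳ _)
  evalE-addE θ i (a ∷ as) (b ∷ bs) = trans (*-cong (pow-+ (θ i) a b) (evalE-addE θ (suc i) as bs))
    (solve 4 (λ u v w z → (u :* v) :* (w :* z) := (u :* w) :* (v :* z)) refl _ _ _ _)

  evalE-zeros : ∀ θ i a → (∀ k → Defs.getE S a k ≡ 0) → Defs.evalE S θ i a ≈ 1#
  evalE-zeros θ i [] a≡0 = refl
  evalE-zeros θ i (e ∷ es) a≡0 rewrite a≡0 0 =
    trans (*-identityˡ _) (evalE-zeros θ (suc i) es (a≡0 ∘ suc))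

  evalE-ext : ∀ θ i a b → (∀ k → Defs.getE S a k ≡ Defs.getE S b k) → Defs.evalE S θ i a ≈ Defs.evalE S θ i b
  evalE-ext θ i [] b eq = sym (evalE-zeros θ i b (≡.sym ∘ eq))
  evalE-ext θ i (a ∷ as) [] eq = evalE-zeros θ i (a ∷ as) eq
  evalE-ext θ i (a ∷ as) (b ∷ bs) eq rewrite eq 0 = *-congˡ (evalE-ext θ (suc i) as bs (eq ∘ suc))

  evalE-cong : ∀ {θ θ′} i a → (∀ k → θ k ≈ θ′ k) → Defs.evalE S θ i a ≈ Defs.evalE S θ′ i a
  evalE-cong i [] eq = refl
  evalE-cong i (e ∷ es) eq = *-cong (pow-cong e (eq i)) (evalE-cong (suc i) es eq)

-- The ring of polynomials up to equality of linear functionals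

module Polynomials {c ℓ} (R : CommutativeRing c ℓ) where
  open CommutativeRing R renaming (_+_ to _⊕_; _*_ to _⊛_; -_ to ⊝_)
  open SetoidReasoning setoid
  open IntegerSolver R
  open RingProperties ring using (-0#≈0#)

  Poly : Set c
  Poly = Defs.Poly R

  getE : List ℕ → ℕ → ℕ
  getE = Defs.getE R

  setE : List ℕ → ℕ → ℕ → List ℕ
  setE = Defs.setE R

  addE : List ℕ → List ℕ → List ℕ
  addE = Defs.addE R

  infix 4 _≐_
  -- Lists that differ by trailing zeros are the same monomial, so propositional equality of lists
  -- would be too fine.
  record _≐_ (a b : List ℕ) : Set where
    constructor mk≐
    field get : ∀ k → getE a k ≡ getE b k
  open _≐_ public

  ≐-refl : ∀ {a} → a ≐ a
  ≐-refl = mk≐ λ _ → ≡.refl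

  ≐-trans : ∀ {a b d} → a ≐ b → b ≐ d → a ≐ d
  ≐-trans a≐b b≐d .get k = ≡.trans (get a≐b k) (get b≐d k)

  getE-setE : ∀ a i v → getE (setE a i v) i ≡ v
  getE-setE [] zero v = ≡.refl
  getE-setE [] (suc i) v = getE-setE [] i v
  getE-setE (e ∷ es) zero v = ≡.refl
  getE-setE (e ∷ es) (suc i) v = getE-setE es i v

  getE-setE-≢ : ∀ a {i k} v → k ≢ i → getE (setE a i v) k ≡ getE a k
  getE-setE-≢ [] {zero} {zero} v k≢i = ⊥-elim (k≢i ≡.refl)
  getE-setE-≢ [] {zero} {suc k} v k≢i = ≡.refl
  getE-setE-≢ [] {suc i} {zero} v k≢i = ≡.refl
  getE-setE-≢ [] {suc i} {suc k} v k≢i = getE-setE-≢ [] v (k≢i ∘ ≡.cong suc)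
  getE-setE-≢ (e ∷ es) {zero} {zero} v k≢i = ⊥-elim (k≢i ≡.refl)
  getE-setE-≢ (e ∷ es) {zero} {suc k} v k≢i = ≡.refl
  getE-setE-≢ (e ∷ es) {suc i} {zero} v k≢i = ≡.refl
  getE-setE-≢ (e ∷ es) {suc i} {suc k} v k≢i = getE-setE-≢ es v (k≢i ∘ ≡.cong suc)

  getE-addE : ∀ a b k → getE (addE a b) k ≡ getE a k ℕ.+ getE b k
  getE-addE [] b k = ≡.refl
  getE-addE (a ∷ as) [] k = ≡.sym (ℕₚ.+-identityʳ _)
  getE-addE (a ∷ as) (b ∷ bs) zero = ≡.refl
  getE-addE (a ∷ as) (b ∷ bs) (suc k) = getE-addE as bs k

  addE-cong : ∀ {a a′ b b′} → a ≐ a′ → b ≐ b′ → addE a b ≐ addE a′ b′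
  addE-cong {a} {a′} {b} {b′} p q .get k =
    ≡.trans (getE-addE a b k) (≡.trans (≡.cong₂ ℕ._+_ (get p k) (get q k)) (≡.sym (getE-addE a′ b′ k)))

  addE-comm : ∀ a b → addE a b ≐ addE b a
  addE-comm a b .get k = ≡.trans (getE-addE a b k) (≡.trans (ℕₚ.+-comm (getE a k) _) (≡.sym (getE-addE b a k)))

  addE-assoc : ∀ a b d → addE (addE a b) d ≐ addE a (addE b d)
  addE-assoc a b d .get k rewrite getE-addE (addE a b) d k | getE-addE a b k | getE-addE a (addE b d) k | getE-addE b d k =
    ℕₚ.+-assoc (getE a k) _ _

  unitE : ℕ → List ℕ
  unitE k = setE [] k 1

  Ext : (List ℕ → Carrier) → Set ℓ
  Ext φ = ∀ {a b} → a ≐ b → φ a ≈ φ b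

  infix 8 _⟪_⟫
  _⟪_⟫ : Poly → (List ℕ → Carrier) → Carrier
  [] ⟪ φ ⟫ = 0#
  ((x , a) ∷ p) ⟪ φ ⟫ = x ⊛ φ a ⊕ p ⟪ φ ⟫

  -- Polynomials agree when all linear functionals on them agree; functionals are
  -- given by their values on monomials.
  infix 4 _≈ₚ_
  record _≈ₚ_ (p r : Poly) : Set (c ⊔ ℓ) where
    constructor mk≈
    field at : ∀ φ → Ext φ → p ⟪ φ ⟫ ≈ r ⟪ φ ⟫
  open _≈ₚ_ public

  ⟪⟫-cong : ∀ p {φ ψ} → (∀ a → φ a ≈ ψ a) → p ⟪ φ ⟫ ≈ p ⟪ ψ ⟫
  ⟪⟫-cong [] eq = refl
  ⟪⟫-cong ((x , a) ∷ p) eq = +-cong (*-congˡ (eq a)) (⟪⟫-cong p eq)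

  ⟪⟫-++ : ∀ p r φ → (p ++ r) ⟪ φ ⟫ ≈ p ⟪ φ ⟫ ⊕ r ⟪ φ ⟫
  ⟪⟫-++ [] r φ = sym (+-identityˡ _)
  ⟪⟫-++ ((x , a) ∷ p) r φ = trans (+-congˡ (⟪⟫-++ p r φ)) (sym (+-assoc _ _ _))

  ⟪⟫-+ : ∀ p φ ψ → p ⟪ (λ a → φ a ⊕ ψ a) ⟫ ≈ p ⟪ φ ⟫ ⊕ p ⟪ ψ ⟫
  ⟪⟫-+ [] φ ψ = sym (+-identityˡ _)
  ⟪⟫-+ ((x , a) ∷ p) φ ψ = trans (+-congˡ (⟪⟫-+ p φ ψ))
    (solve 5 (λ x u v s t → x :* (u :+ v) :+ (s :+ t) := (x :* u :+ s) :+ (x :* v :+ t)) refl x (φ a) (ψ a) _ _)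

  ⟪⟫-* : ∀ p y φ → p ⟪ (λ a → y ⊛ φ a) ⟫ ≈ y ⊛ p ⟪ φ ⟫
  ⟪⟫-* [] y φ = sym (zeroʳ _)
  ⟪⟫-* ((x , a) ∷ p) y φ = trans (+-congˡ (⟪⟫-* p y φ))
    (solve 4 (λ x y u s → x :* (y :* u) :+ y :* s := y :* (x :* u :+ s)) refl x y (φ a) _)

  ⟪⟫-0 : ∀ p → p ⟪ (λ _ → 0#) ⟫ ≈ 0#
  ⟪⟫-0 [] = refl
  ⟪⟫-0 ((x , a) ∷ p) = trans (+-cong (zeroʳ _) (⟪⟫-0 p)) (+-identityˡ _)

  ⟪⟫-swap : ∀ p r (Φ : List ℕ → List ℕ → Carrier) →
    p ⟪ (λ a → r ⟪ (λ b → Φ a b) ⟫) ⟫ ≈ r ⟪ (λ b → p ⟪ (λ a → Φ a b) ⟫) ⟫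
  ⟪⟫-swap [] r Φ = sym (⟪⟫-0 r)
  ⟪⟫-swap ((x , a) ∷ p) r Φ = begin
    x ⊛ r ⟪ Φ a ⟫ ⊕ p ⟪ (λ a′ → r ⟪ Φ a′ ⟫) ⟫                    ≈⟨ +-cong (sym (⟪⟫-* r x (Φ a))) (⟪⟫-swap p r Φ) ⟩
    r ⟪ (λ b → x ⊛ Φ a b) ⟫ ⊕ r ⟪ (λ b → p ⟪ (λ a′ → Φ a′ b) ⟫) ⟫ ≈⟨ ⟪⟫-+ r _ _ ⟨
    r ⟪ (λ b → x ⊛ Φ a b ⊕ p ⟪ (λ a′ → Φ a′ b) ⟫) ⟫              ∎

  ⟪⟫-ext : ∀ p {Φ : List ℕ → List ℕ → Carrier} → (∀ b → Ext (λ a → Φ a b)) → Ext (λ a → p ⟪ Φ a ⟫)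
  ⟪⟫-ext p ext a≐b = ⟪⟫-cong p (λ b → ext b a≐b)

  infixl 6 _+ₚ_
  infixl 7 _*ₚ_
  infix 8 -ₚ_

  opaque
    _+ₚ_ : Poly → Poly → Poly
    p +ₚ r = p ++ r

    _*ₚ_ : Poly → Poly → Poly
    p *ₚ r = Defs.mulP R p r

    -ₚ_ : Poly → Poly
    -ₚ p = map (λ { (x , a) → (⊝ x , a) }) p

    +ₚ-++ : ∀ p r → p +ₚ r ≡ p ++ r
    +ₚ-++ p r = ≡.refl

    *ₚ-mulP : ∀ p r → p *ₚ r ≡ Defs.mulP R p r
    *ₚ-mulP p r = ≡.refl

    ⟪⟫-+ₚ : ∀ p r φ → (p +ₚ r) ⟪ φ ⟫ ≈ p ⟪ φ ⟫ ⊕ r ⟪ φ ⟫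
    ⟪⟫-+ₚ p r φ = ⟪⟫-++ p r φ

    ⟪⟫-neg : ∀ p φ → (-ₚ p) ⟪ φ ⟫ ≈ ⊝ (p ⟪ φ ⟫)
    ⟪⟫-neg [] φ = sym -0#≈0#
    ⟪⟫-neg ((x , a) ∷ p) φ = trans (+-congˡ (⟪⟫-neg p φ))
      (solve 3 (λ x u s → (:- x) :* u :+ (:- s) := :- (x :* u :+ s)) refl x (φ a) _)

    ⟪⟫-mul : ∀ p r φ → (p *ₚ r) ⟪ φ ⟫ ≈ p ⟪ (λ a → r ⟪ (λ b → φ (addE a b)) ⟫) ⟫
    ⟪⟫-mul [] r φ = refl
    ⟪⟫-mul ((x , a) ∷ p) r φ = trans (⟪⟫-++ (map _ r) _ φ) (+-cong (mulTerm r) (⟪⟫-mul p r φ))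
      where
      mulTerm : ∀ r → map (λ { (y , b) → (x ⊛ y , addE a b) }) r ⟪ φ ⟫ ≈ x ⊛ r ⟪ (λ b → φ (addE a b)) ⟫
      mulTerm [] = sym (zeroʳ _)
      mulTerm ((y , b) ∷ r) = trans (+-congˡ (mulTerm r))
        (solve 4 (λ x y u s → (x :* y) :* u :+ x :* s := x :* (y :* u :+ s)) refl x y _ _)

  ≈ₚ-refl : ∀ {p} → p ≈ₚ p
  ≈ₚ-refl = mk≈ λ _ _ → refl

  mulExt : ∀ r {φ} → Ext φ → Ext (λ a → r ⟪ (λ b → φ (addE a b)) ⟫)
  mulExt r ext = ⟪⟫-ext r (λ b a≐a′ → ext (addE-cong a≐a′ ≐-refl))

  *ₚ-comm : ∀ p r → p *ₚ r ≈ₚ r *ₚ p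
  *ₚ-comm p r .at φ ext = begin
    (p *ₚ r) ⟪ φ ⟫                              ≈⟨ ⟪⟫-mul p r φ ⟩
    p ⟪ (λ a → r ⟪ (λ b → φ (addE a b)) ⟫) ⟫    ≈⟨ ⟪⟫-swap p r _ ⟩
    r ⟪ (λ b → p ⟪ (λ a → φ (addE a b)) ⟫) ⟫    ≈⟨ ⟪⟫-cong r (λ b → ⟪⟫-cong p (λ a → ext (addE-comm a b))) ⟩
    r ⟪ (λ b → p ⟪ (λ a → φ (addE b a)) ⟫) ⟫    ≈⟨ ⟪⟫-mul r p φ ⟨
    (r *ₚ p) ⟪ φ ⟫                              ∎

  *ₚ-cong : ∀ {p p′ r r′} → p ≈ₚ p′ → r ≈ₚ r′ → p *ₚ r ≈ₚ p′ *ₚ r′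
  *ₚ-cong {p} {p′} {r} {r′} p≈ r≈ .at φ ext = begin
    (p *ₚ r) ⟪ φ ⟫                               ≈⟨ ⟪⟫-mul p r φ ⟩
    p ⟪ (λ a → r ⟪ (λ b → φ (addE a b)) ⟫) ⟫     ≈⟨ at p≈ _ (mulExt r ext) ⟩
    p′ ⟪ (λ a → r ⟪ (λ b → φ (addE a b)) ⟫) ⟫    ≈⟨ ⟪⟫-cong p′ (λ a → at r≈ _ (λ b≐ → ext (addE-cong {a} ≐-refl b≐))) ⟩
    p′ ⟪ (λ a → r′ ⟪ (λ b → φ (addE a b)) ⟫) ⟫   ≈⟨ ⟪⟫-mul p′ r′ φ ⟨
    (p′ *ₚ r′) ⟪ φ ⟫                             ∎

  *ₚ-assoc : ∀ p r s → (p *ₚ r) *ₚ s ≈ₚ p *ₚ (r *ₚ s)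
  *ₚ-assoc p r s .at φ ext = begin
    ((p *ₚ r) *ₚ s) ⟪ φ ⟫
      ≈⟨ ⟪⟫-mul (p *ₚ r) s φ ⟩
    (p *ₚ r) ⟪ (λ a → s ⟪ (λ b → φ (addE a b)) ⟫) ⟫
      ≈⟨ ⟪⟫-mul p r _ ⟩
    p ⟪ (λ a → r ⟪ (λ b → s ⟪ (λ d → φ (addE (addE a b) d)) ⟫) ⟫) ⟫
      ≈⟨ ⟪⟫-cong p (λ a → ⟪⟫-cong r (λ b → ⟪⟫-cong s (λ d → ext (addE-assoc a b d)))) ⟩
    p ⟪ (λ a → r ⟪ (λ b → s ⟪ (λ d → φ (addE a (addE b d))) ⟫) ⟫) ⟫
      ≈⟨ ⟪⟫-cong p (λ a → ⟪⟫-mul r s _) ⟨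
    p ⟪ (λ a → (r *ₚ s) ⟪ (λ e → φ (addE a e)) ⟫) ⟫
      ≈⟨ ⟪⟫-mul p (r *ₚ s) φ ⟨
    (p *ₚ (r *ₚ s)) ⟪ φ ⟫ ∎

  1ₚ : Poly
  1ₚ = Defs.oneP R

  *ₚ-identityˡ : ∀ p → 1ₚ *ₚ p ≈ₚ p
  *ₚ-identityˡ p .at φ ext = trans (⟪⟫-mul 1ₚ p φ) (trans (+-identityʳ _) (*-identityˡ _))

  *ₚ-distribʳ : ∀ s p r → (p +ₚ r) *ₚ s ≈ₚ p *ₚ s +ₚ r *ₚ s
  *ₚ-distribʳ s p r .at φ ext = begin
    ((p +ₚ r) *ₚ s) ⟪ φ ⟫                     ≈⟨ ⟪⟫-mul (p +ₚ r) s φ ⟩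
    (p +ₚ r) ⟪ _ ⟫                            ≈⟨ ⟪⟫-+ₚ p r _ ⟩
    p ⟪ _ ⟫ ⊕ r ⟪ _ ⟫                         ≈⟨ +-cong (⟪⟫-mul p s φ) (⟪⟫-mul r s φ) ⟨
    (p *ₚ s) ⟪ φ ⟫ ⊕ (r *ₚ s) ⟪ φ ⟫           ≈⟨ ⟪⟫-+ₚ (p *ₚ s) (r *ₚ s) φ ⟨
    (p *ₚ s +ₚ r *ₚ s) ⟪ φ ⟫                  ∎

  ≈ₚ-sym : ∀ {p r} → p ≈ₚ r → r ≈ₚ p
  ≈ₚ-sym p≈r = mk≈ λ φ ext → sym (at p≈r φ ext)

  ≈ₚ-trans : ∀ {p r s} → p ≈ₚ r → r ≈ₚ s → p ≈ₚ s
  ≈ₚ-trans p≈r r≈s = mk≈ λ φ ext → trans (at p≈r φ ext) (at r≈s φ ext)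

  +ₚ-cong : ∀ {p p′ r r′} → p ≈ₚ p′ → r ≈ₚ r′ → p +ₚ r ≈ₚ p′ +ₚ r′
  +ₚ-cong {p} {p′} {r} {r′} p≈ r≈ .at φ ext =
    trans (⟪⟫-+ₚ p r φ) (trans (+-cong (at p≈ φ ext) (at r≈ φ ext)) (sym (⟪⟫-+ₚ p′ r′ φ)))

  +ₚ-comm : ∀ p r → p +ₚ r ≈ₚ r +ₚ p
  +ₚ-comm p r .at φ ext = trans (⟪⟫-+ₚ p r φ) (trans (+-comm _ _) (sym (⟪⟫-+ₚ r p φ)))

  +ₚ-assoc : ∀ p r s → (p +ₚ r) +ₚ s ≈ₚ p +ₚ (r +ₚ s)
  +ₚ-assoc p r s .at φ ext = begin
    ((p +ₚ r) +ₚ s) ⟪ φ ⟫             ≈⟨ trans (⟪⟫-+ₚ (p +ₚ r) s φ) (+-congʳ (⟪⟫-+ₚ p r φ)) ⟩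
    p ⟪ φ ⟫ ⊕ r ⟪ φ ⟫ ⊕ s ⟪ φ ⟫       ≈⟨ +-assoc _ _ _ ⟩
    p ⟪ φ ⟫ ⊕ (r ⟪ φ ⟫ ⊕ s ⟪ φ ⟫)     ≈⟨ trans (⟪⟫-+ₚ p (r +ₚ s) φ) (+-congˡ (⟪⟫-+ₚ r s φ)) ⟨
    (p +ₚ (r +ₚ s)) ⟪ φ ⟫             ∎

  +ₚ-identityˡ : ∀ p → [] +ₚ p ≈ₚ p
  +ₚ-identityˡ p .at φ ext = trans (⟪⟫-+ₚ [] p φ) (+-identityˡ _)

  +ₚ-inverseʳ : ∀ p → p +ₚ (-ₚ p) ≈ₚ []
  +ₚ-inverseʳ p .at φ ext = trans (⟪⟫-+ₚ p (-ₚ p) φ) (trans (+-congˡ (⟪⟫-neg p φ)) (-‿inverseʳ _))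

  PR : CommutativeRing c (c ⊔ ℓ)
  PR = record
    { Carrier = Poly
    ; _≈_ = _≈ₚ_
    ; _+_ = _+ₚ_
    ; _*_ = _*ₚ_
    ; -_ = -ₚ_
    ; 0# = []
    ; 1# = 1ₚ
    ; isCommutativeRing = record
      { isRing = record
        { +-isAbelianGroup = record
          { isGroup = record
            { isMonoid = record
              { isSemigroup = record
                { isMagma = record
                  { isEquivalence = record { refl = ≈ₚ-refl ; sym = ≈ₚ-sym ; trans = ≈ₚ-trans }
                  ; ∙-cong = +ₚ-cong }
                ; assoc = +ₚ-assoc }
              ; identity = +ₚ-identityˡ , (λ p → ≈ₚ-trans (+ₚ-comm p []) (+ₚ-identityˡ p)) }
            ; inverse = (λ p → ≈ₚ-trans (+ₚ-comm (-ₚ p) p) (+ₚ-inverseʳ p)) , +ₚ-inverseʳ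
            ; ⁻¹-cong = λ {p} {r} p≈r → mk≈ λ φ ext →
                trans (⟪⟫-neg p φ) (trans (-‿cong (at p≈r φ ext)) (sym (⟪⟫-neg r φ))) }
          ; comm = +ₚ-comm }
        ; *-cong = *ₚ-cong
        ; *-assoc = *ₚ-assoc
        ; *-identity = *ₚ-identityˡ , (λ p → ≈ₚ-trans (*ₚ-comm p 1ₚ) (*ₚ-identityˡ p))
        ; distrib = (λ s p r → ≈ₚ-trans (*ₚ-comm s (p +ₚ r)) (≈ₚ-trans (*ₚ-distribʳ s p r)
                      (+ₚ-cong (*ₚ-comm p s) (*ₚ-comm r s)))) , *ₚ-distribʳ }
      ; *-comm = *ₚ-comm } }

-- Finite sums in a commutative ring

module Sums {c ℓ} (S : CommutativeRing c ℓ) where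
  open CommutativeRing S
  open SetoidReasoning setoid
  open IntegerSolver S
  open RingProperties ring using (-0#≈0#)

  ∑ : ℕ → (ℕ → Carrier) → Carrier
  ∑ zero h = 0#
  ∑ (suc n) h = h 0 + ∑ n (h ∘ suc)

  ∑-cong : ∀ n {h h′} → (∀ k → k ℕ.< n → h k ≈ h′ k) → ∑ n h ≈ ∑ n h′
  ∑-cong zero eq = refl
  ∑-cong (suc n) eq = +-cong (eq 0 (ℕ.s≤s ℕ.z≤n)) (∑-cong n (λ k k<n → eq (suc k) (ℕ.s≤s k<n)))

  ∑-last : ∀ n (h : ℕ → Carrier) → ∑ (suc n) h ≈ ∑ n h + h n
  ∑-last zero h = +-comm _ _
  ∑-last (suc n) h = trans (+-congˡ (∑-last n (h ∘ suc))) (sym (+-assoc _ _ _))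

  ∑-* : ∀ n x h → ∑ n (λ k → x * h k) ≈ x * ∑ n h
  ∑-* zero x h = sym (zeroʳ x)
  ∑-* (suc n) x h = trans (+-congˡ (∑-* n x (h ∘ suc))) (sym (distribˡ _ _ _))

  ∑-0 : ∀ n {h} → (∀ k → k ℕ.< n → h k ≈ 0#) → ∑ n h ≈ 0#
  ∑-0 zero eq = refl
  ∑-0 (suc n) eq = trans (+-cong (eq 0 (ℕ.s≤s ℕ.z≤n)) (∑-0 n (λ k k<n → eq (suc k) (ℕ.s≤s k<n)))) (+-identityˡ _)

  ∑-minus : ∀ n h h′ → ∑ n (λ k → h k - h′ k) ≈ ∑ n h - ∑ n h′
  ∑-minus zero h h′ = sym (-‿inverseʳ 0#)
  ∑-minus (suc n) h h′ = trans (+-congˡ (∑-minus n (h ∘ suc) (h′ ∘ suc)))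
    (solve 4 (λ a b s t → (a :- b) :+ (s :- t) := (a :+ s) :- (b :+ t)) refl (h 0) (h′ 0) _ _)

  ∑-telescope : ∀ n (g : ℕ → Carrier) → ∑ n (λ k → g k - g (suc k)) ≈ g 0 - g n
  ∑-telescope zero g = sym (-‿inverseʳ _)
  ∑-telescope (suc n) g = trans (+-congˡ (∑-telescope n (g ∘ suc)))
    (solve 3 (λ a b s → (a :- b) :+ (b :- s) := a :- s) refl (g 0) (g 1) (g (suc n)))

-- Substitutions, algebra endomorphisms and evaluation

module Operators {c ℓ} (K : CommutativeRing c ℓ) where
  module 𝕂 where
    open CommutativeRing K public
    open SetoidReasoning setoid public
    open IntegerSolver K public
    open RingProperties ring public
    open Sums K public
    open EvalHom K public
  open Polynomials K public
  open CommutativeRing PR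
  open SetoidReasoning setoid
  open IntegerSolver PR
  module PE = EvalHom PR

  C : 𝕂.Carrier → Poly
  C x = (x , []) ∷ []

  X : ℕ → Poly
  X k = (𝕂.1# , unitE k) ∷ []

  ⟪⟫-C* : ∀ x p φ → (C x * p) ⟪ φ ⟫ 𝕂.≈ x 𝕂.* p ⟪ φ ⟫
  ⟪⟫-C* x p φ = 𝕂.trans (⟪⟫-mul (C x) p φ) (𝕂.+-identityʳ _)

  C-cong : ∀ {x y} → x 𝕂.≈ y → C x ≈ C y
  C-cong x≈y = mk≈ λ φ ext → 𝕂.+-congʳ (𝕂.*-congʳ x≈y)

  C-+ : ∀ x y → C (x 𝕂.+ y) ≈ C x + C y
  C-+ x y = mk≈ λ φ ext → 𝕂.trans
    (𝕂.solve 3 (λ x y u → (x 𝕂.:+ y) 𝕂.:* u 𝕂.:+ 𝕂.con (+ 0) 𝕂.:= (x 𝕂.:* u 𝕂.:+ 𝕂.con (+ 0)) 𝕂.:+ (y 𝕂.:* u 𝕂.:+ 𝕂.con (+ 0))) 𝕂.refl x y (φ []))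
    (𝕂.sym (⟪⟫-+ₚ (C x) (C y) φ))

  C-* : ∀ x y → C (x 𝕂.* y) ≈ C x * C y
  C-* x y = sym (reflexive (*ₚ-mulP (C x) (C y)))

  C-0 : C 𝕂.0# ≈ 0#
  C-0 = mk≈ λ φ ext → 𝕂.trans (𝕂.+-identityʳ _) (𝕂.zeroˡ _)

  C-neg : ∀ x → C (𝕂.- x) ≈ - C x
  C-neg x = mk≈ λ φ ext → 𝕂.trans (𝕂.solve 2 (λ x u → (𝕂.:- x) 𝕂.:* u 𝕂.:+ 𝕂.con (+ 0) 𝕂.:= 𝕂.:- (x 𝕂.:* u 𝕂.:+ 𝕂.con (+ 0))) 𝕂.refl x (φ [])) (𝕂.sym (⟪⟫-neg (C x) φ))

  evalE-unitE : ∀ {c′ ℓ′} (S : CommutativeRing c′ ℓ′) (let module S = CommutativeRing S) θ i k →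
    Defs.evalE S θ i (unitE k) S.≈ θ (i ℕ.+ k)
  evalE-unitE S θ i zero = S.trans (S.*-identityʳ _) (S.trans (S.*-identityʳ _)
    (S.reflexive (≡.cong θ (≡.sym (ℕₚ.+-identityʳ i)))))
    where module S = CommutativeRing S
  evalE-unitE S θ i (suc k) = S.trans (S.*-identityˡ _) (S.trans (evalE-unitE S θ (suc i) k)
    (S.reflexive (≡.cong θ (≡.sym (ℕₚ.+-suc i k)))))
    where module S = CommutativeRing S

  shiftE : ℕ → List ℕ → List ℕ
  shiftE zero a = a
  shiftE (suc i) a = 0 ∷ shiftE i a

  unit-* : ∀ x a y b → ((x , a) ∷ []) * ((y , b) ∷ []) ≈ ((x 𝕂.* y , addE a b) ∷ [])
  unit-* x a y b = reflexive (*ₚ-mulP ((x , a) ∷ []) ((y , b) ∷ []))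

  ∷-+ : ∀ x a p → ((x , a) ∷ p) ≈ ((x , a) ∷ []) + p
  ∷-+ x a p = sym (reflexive (+ₚ-++ ((x , a) ∷ []) p))

  unit-ext : ∀ {x y a b} → x 𝕂.≈ y → a ≐ b → ((x , a) ∷ []) ≈ ((y , b) ∷ [])
  unit-ext x≈y a≐b = mk≈ λ φ ext → 𝕂.+-congʳ (𝕂.*-cong x≈y (ext a≐b))

  pow-X : ∀ k e → Defs.pow PR (X k) e ≈ ((𝕂.1# , setE [] k e) ∷ [])
  pow-X k zero = unit-ext 𝕂.refl (mk≐ (zeros k))
    where
    zeros : ∀ k m → 0 ≡ getE (setE [] k 0) m
    zeros zero zero = ≡.refl
    zeros zero (suc m) = ≡.refl
    zeros (suc k) zero = ≡.refl
    zeros (suc k) (suc m) = zeros k m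
  pow-X k (suc e) = trans (*-congˡ (pow-X k e)) (trans (unit-* _ (unitE k) _ (setE [] k e)) (unit-ext (𝕂.*-identityˡ _) (mk≐ (add k))))
    where
    add : ∀ k m → getE (addE (unitE k) (setE [] k e)) m ≡ getE (setE [] k (suc e)) m
    add zero zero = ≡.refl
    add zero (suc m) = ≡.refl
    add (suc k) zero = ≡.refl
    add (suc k) (suc m) = add k m

  evalE-X : ∀ i a → Defs.evalE PR X i a ≈ ((𝕂.1# , shiftE i a) ∷ [])
  evalE-X i [] = unit-ext 𝕂.refl (mk≐ (zeros i))
    where
    zeros : ∀ i m → 0 ≡ getE (shiftE i []) m
    zeros zero m = ≡.refl
    zeros (suc i) zero = ≡.refl
    zeros (suc i) (suc m) = zeros i m
  evalE-X i (e ∷ es) = trans (*-cong (pow-X i e) (evalE-X (suc i) es)) (trans (unit-* _ (setE [] i e) _ (shiftE (suc i) es)) (unit-ext (𝕂.*-identityˡ _) (mk≐ (add i))))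
    where
    add : ∀ i m → getE (addE (setE [] i e) (shiftE (suc i) es)) m ≡ getE (shiftE i (e ∷ es)) m
    add zero zero = ℕₚ.+-identityʳ e
    add zero (suc m) = ≡.refl
    add (suc i) zero = ≡.refl
    add (suc i) (suc m) = add i m

  term-evalE : ∀ x a → ((x , a) ∷ []) ≈ C x * Defs.evalE PR X 0 a
  term-evalE x a = trans (unit-ext (𝕂.sym (𝕂.*-identityʳ x)) ≐-refl)
    (trans (sym (unit-* x [] 𝕂.1# a)) (*-congˡ (sym (evalE-X 0 a))))

  record IsHom (Φ : Poly → Poly) : Set (c ⊔ ℓ) where
    field
      cong : ∀ {p r} → p ≈ r → Φ p ≈ Φ r
      +-homo : ∀ p r → Φ (p + r) ≈ Φ p + Φ r
      *-homo : ∀ p r → Φ (p * r) ≈ Φ p * Φ r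
      C-homo : ∀ x → Φ (C x) ≈ C x

    0-homo : Φ 0# ≈ 0#
    0-homo = trans (cong (sym C-0)) (trans (C-homo _) C-0)

    neg-homo : ∀ p → Φ (- p) ≈ - Φ p
    neg-homo p = begin
      Φ (- p)                          ≈⟨ solve 2 (λ u v → u := (u :+ v) :- v) refl _ (Φ p) ⟩
      (Φ (- p) + Φ p) - Φ p            ≈⟨ +-congʳ (+-homo (- p) p) ⟨
      Φ (- p + p) - Φ p                ≈⟨ trans (+-congʳ (trans (cong (-‿inverseˡ p)) 0-homo)) (+-identityˡ _) ⟩
      - Φ p                            ∎

    sub-homo : ∀ p r → Φ (p - r) ≈ Φ p - Φ r
    sub-homo p r = trans (+-homo p (- r)) (+-congˡ (neg-homo r))

    pow-homo : ∀ p n → Φ (Defs.pow PR p n) ≈ Defs.pow PR (Φ p) n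
    pow-homo p zero = C-homo _
    pow-homo p (suc n) = trans (*-homo _ _) (*-congˡ (pow-homo p n))

    evalE-homo : ∀ θ i a → Φ (Defs.evalE PR θ i a) ≈ Defs.evalE PR (Φ ∘ θ) i a
    evalE-homo θ i [] = C-homo _
    evalE-homo θ i (e ∷ es) = trans (*-homo _ _) (*-cong (pow-homo (θ i) e) (evalE-homo θ (suc i) es))

  -- Every term is a constant times a product of variables. This reduces later identities between
  -- substitutions, such as `s-braid` and `emb-emb`, to computations with indices.
  hom-unique : ∀ {Φ Ψ} → IsHom Φ → IsHom Ψ → (∀ k → Φ (X k) ≈ Ψ (X k)) → ∀ p → Φ p ≈ Ψ p
  hom-unique {Φ} {Ψ} Φh Ψh eq [] = trans (IsHom.0-homo Φh) (sym (IsHom.0-homo Ψh))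
  hom-unique {Φ} {Ψ} Φh Ψh eq ((x , a) ∷ p) = begin
    Φ ((x , a) ∷ p)                           ≈⟨ Φh.cong (∷-+ x a p) ⟩
    Φ (((x , a) ∷ []) + p)                    ≈⟨ Φh.+-homo _ _ ⟩
    Φ ((x , a) ∷ []) + Φ p                    ≈⟨ +-cong onTerm (hom-unique Φh Ψh eq p) ⟩
    Ψ ((x , a) ∷ []) + Ψ p                    ≈⟨ Ψh.+-homo _ _ ⟨
    Ψ (((x , a) ∷ []) + p)                    ≈⟨ Ψh.cong (∷-+ x a p) ⟨
    Ψ ((x , a) ∷ p)                           ∎
    where
    module Φh = IsHom Φh
    module Ψh = IsHom Ψh
    onTerm : Φ ((x , a) ∷ []) ≈ Ψ ((x , a) ∷ [])
    onTerm = begin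
      Φ ((x , a) ∷ [])                          ≈⟨ trans (Φh.cong (term-evalE x a)) (Φh.*-homo _ _) ⟩
      Φ (C x) * Φ (Defs.evalE PR X 0 a)         ≈⟨ *-cong (Φh.C-homo x) (Φh.evalE-homo X 0 a) ⟩
      C x * Defs.evalE PR (Φ ∘ X) 0 a           ≈⟨ *-congˡ (PE.evalE-cong 0 a eq) ⟩
      C x * Defs.evalE PR (Ψ ∘ X) 0 a           ≈⟨ *-cong (Ψh.C-homo x) (Ψh.evalE-homo X 0 a) ⟨
      Ψ (C x) * Ψ (Defs.evalE PR X 0 a)         ≈⟨ trans (Ψh.cong (term-evalE x a)) (Ψh.*-homo _ _) ⟨
      Ψ ((x , a) ∷ [])                          ∎

  id-isHom : IsHom id
  id-isHom = record { cong = id ; +-homo = λ _ _ → refl ; *-homo = λ _ _ → refl ; C-homo = λ _ → refl }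

  ∘-isHom : ∀ {Φ Ψ} → IsHom Φ → IsHom Ψ → IsHom (Φ ∘ Ψ)
  ∘-isHom Φh Ψh = record
    { cong = Φh.cong ∘ Ψh.cong
    ; +-homo = λ p r → trans (Φh.cong (Ψh.+-homo p r)) (Φh.+-homo _ _)
    ; *-homo = λ p r → trans (Φh.cong (Ψh.*-homo p r)) (Φh.*-homo _ _)
    ; C-homo = λ x → trans (Φh.cong (Ψh.C-homo x)) (Φh.C-homo x) }
    where
    module Φh = IsHom Φh
    module Ψh = IsHom Ψh

  opaque
    sub : (ℕ → Poly) → Poly → Poly
    sub θ [] = []
    sub θ ((x , a) ∷ p) = C x * Defs.evalE PR θ 0 a + sub θ p

    ⟪⟫-sub : ∀ θ p φ → sub θ p ⟪ φ ⟫ 𝕂.≈ p ⟪ (λ a → Defs.evalE PR θ 0 a ⟪ φ ⟫) ⟫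
    ⟪⟫-sub θ [] φ = 𝕂.refl
    ⟪⟫-sub θ ((x , a) ∷ p) φ = 𝕂.trans (⟪⟫-+ₚ (C x * Defs.evalE PR θ 0 a) _ φ)
      (𝕂.+-cong (⟪⟫-C* x _ φ) (⟪⟫-sub θ p φ))

    sub-C : ∀ θ x → sub θ (C x) ≈ C x
    sub-C θ x = trans (+-identityʳ _) (*-identityʳ (C x))

    sub-X : ∀ θ k → sub θ (X k) ≈ θ k
    sub-X θ k = trans (+-identityʳ _) (trans (*-identityˡ _) (evalE-unitE PR θ 0 k))

  evalE-Ext : ∀ θ φ → Ext φ → Ext (λ a → Defs.evalE PR θ 0 a ⟪ φ ⟫)
  evalE-Ext θ φ ext {a} {b} a≐b = at (PE.evalE-ext θ 0 a b (getPR a≐b)) φ ext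
    where
    getPR≡ : ∀ a k → Defs.getE PR a k ≡ getE a k
    getPR≡ [] k = ≡.refl
    getPR≡ (e ∷ es) zero = ≡.refl
    getPR≡ (e ∷ es) (suc k) = getPR≡ es k
    getPR : ∀ {a b} → a ≐ b → ∀ k → Defs.getE PR a k ≡ Defs.getE PR b k
    getPR {a} {b} a≐b k = ≡.trans (getPR≡ a k) (≡.trans (get a≐b k) (≡.sym (getPR≡ b k)))

  addE-PR : ∀ a b → Defs.addE PR a b ≡ addE a b
  addE-PR [] b = ≡.refl
  addE-PR (a ∷ as) [] = ≡.refl
  addE-PR (a ∷ as) (b ∷ bs) = ≡.cong (a ℕ.+ b ∷_) (addE-PR as bs)

  sub-isHom : ∀ θ → IsHom (sub θ)
  sub-isHom θ = record
    { cong = λ {p} {r} p≈r → mk≈ λ φ ext →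
        𝕂.trans (⟪⟫-sub θ p φ) (𝕂.trans (at p≈r _ (evalE-Ext θ φ ext)) (𝕂.sym (⟪⟫-sub θ r φ)))
    ; +-homo = +-homo
    ; *-homo = λ p r → mk≈ (*-homo p r)
    ; C-homo = sub-C θ }
    where
    E : List ℕ → Poly
    E = Defs.evalE PR θ 0
    +-homo : ∀ p r → sub θ (p + r) ≈ sub θ p + sub θ r
    +-homo p r = mk≈ λ φ ext → 𝕂.trans (𝕂.trans (⟪⟫-sub θ (p + r) φ) (⟪⟫-+ₚ p r _))
      (𝕂.sym (𝕂.trans (⟪⟫-+ₚ (sub θ p) (sub θ r) φ) (𝕂.+-cong (⟪⟫-sub θ p φ) (⟪⟫-sub θ r φ))))
    *-homo : ∀ p r φ → Ext φ → sub θ (p * r) ⟪ φ ⟫ 𝕂.≈ (sub θ p * sub θ r) ⟪ φ ⟫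
    *-homo p r φ ext = 𝕂.begin
      sub θ (p * r) ⟪ φ ⟫
        𝕂.≈⟨ ⟪⟫-sub θ (p * r) φ ⟩
      (p * r) ⟪ (λ a → E a ⟪ φ ⟫) ⟫
        𝕂.≈⟨ ⟪⟫-mul p r _ ⟩
      p ⟪ (λ a → r ⟪ (λ b → E (addE a b) ⟪ φ ⟫) ⟫) ⟫
        𝕂.≈⟨ ⟪⟫-cong p (λ a → ⟪⟫-cong r (λ b → 𝕂.trans (𝕂.reflexive (≡.cong (λ e → E e ⟪ φ ⟫) (≡.sym (addE-PR a b))))
              (at (PE.evalE-addE θ 0 a b) φ ext))) ⟩
      p ⟪ (λ a → r ⟪ (λ b → (E a * E b) ⟪ φ ⟫) ⟫) ⟫
        𝕂.≈⟨ ⟪⟫-cong p (λ a → ⟪⟫-cong r (λ b → ⟪⟫-mul (E a) (E b) φ)) ⟩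
      p ⟪ (λ a → r ⟪ (λ b → E a ⟪ (λ u → E b ⟪ (λ v → φ (addE u v)) ⟫) ⟫) ⟫) ⟫
        𝕂.≈⟨ ⟪⟫-cong p (λ a → ⟪⟫-swap r (E a) _) ⟩
      p ⟪ (λ a → E a ⟪ (λ u → r ⟪ (λ b → E b ⟪ (λ v → φ (addE u v)) ⟫) ⟫) ⟫) ⟫
        𝕂.≈⟨ ⟪⟫-cong p (λ a → ⟪⟫-cong (E a) (λ u → ⟪⟫-sub θ r _)) ⟨
      p ⟪ (λ a → E a ⟪ (λ u → sub θ r ⟪ (λ v → φ (addE u v)) ⟫) ⟫) ⟫
        𝕂.≈⟨ ⟪⟫-sub θ p _ ⟨
      sub θ p ⟪ (λ u → sub θ r ⟪ (λ v → φ (addE u v)) ⟫) ⟫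
        𝕂.≈⟨ ⟪⟫-mul (sub θ p) (sub θ r) φ ⟨
      (sub θ p * sub θ r) ⟪ φ ⟫ 𝕂.∎

  ev : (ℕ → 𝕂.Carrier) → Poly → 𝕂.Carrier
  ev = Defs.evalP K

  ev-⟪⟫ : ∀ f p → ev f p 𝕂.≈ p ⟪ Defs.evalE K f 0 ⟫
  ev-⟪⟫ f [] = 𝕂.refl
  ev-⟪⟫ f ((x , a) ∷ p) = 𝕂.+-congˡ (ev-⟪⟫ f p)

  evK-Ext : ∀ f → Ext (Defs.evalE K f 0)
  evK-Ext f {a} {b} a≐b = 𝕂.evalE-ext f 0 a b (get a≐b)

  ev-cong : ∀ f {p r} → p ≈ r → ev f p 𝕂.≈ ev f r
  ev-cong f {p} {r} p≈r = 𝕂.trans (ev-⟪⟫ f p) (𝕂.trans (at p≈r _ (evK-Ext f)) (𝕂.sym (ev-⟪⟫ f r)))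

  ev-+ : ∀ f p r → ev f (p + r) 𝕂.≈ ev f p 𝕂.+ ev f r
  ev-+ f p r = 𝕂.trans (ev-⟪⟫ f (p + r)) (𝕂.trans (⟪⟫-+ₚ p r _) (𝕂.sym (𝕂.+-cong (ev-⟪⟫ f p) (ev-⟪⟫ f r))))

  ev-* : ∀ f p r → ev f (p * r) 𝕂.≈ ev f p 𝕂.* ev f r
  ev-* f p r = 𝕂.begin
    ev f (p * r)                                     𝕂.≈⟨ 𝕂.trans (ev-⟪⟫ f (p * r)) (⟪⟫-mul p r _) ⟩
    p ⟪ (λ a → r ⟪ (λ b → E (addE a b)) ⟫) ⟫         𝕂.≈⟨ ⟪⟫-cong p (λ a → ⟪⟫-cong r (𝕂.evalE-addE f 0 a)) ⟩
    p ⟪ (λ a → r ⟪ (λ b → E a 𝕂.* E b) ⟫) ⟫          𝕂.≈⟨ ⟪⟫-cong p (λ a → 𝕂.trans (⟪⟫-* r (E a) E) (𝕂.*-comm _ _)) ⟩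
    p ⟪ (λ a → r ⟪ E ⟫ 𝕂.* E a) ⟫                    𝕂.≈⟨ 𝕂.trans (⟪⟫-* p (r ⟪ E ⟫) E) (𝕂.*-comm _ _) ⟩
    p ⟪ E ⟫ 𝕂.* r ⟪ E ⟫                              𝕂.≈⟨ 𝕂.*-cong (ev-⟪⟫ f p) (ev-⟪⟫ f r) ⟨
    ev f p 𝕂.* ev f r                                𝕂.∎
    where
    E : List ℕ → 𝕂.Carrier
    E = Defs.evalE K f 0

  ev-C : ∀ f x → ev f (C x) 𝕂.≈ x
  ev-C f x = 𝕂.trans (𝕂.+-identityʳ _) (𝕂.*-identityʳ x)

  ev-X : ∀ f k → ev f (X k) 𝕂.≈ f k
  ev-X f k = 𝕂.trans (𝕂.+-identityʳ _) (𝕂.trans (𝕂.*-identityˡ _) (evalE-unitE K f 0 k))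

-- Transpositions and divided differences on polynomials

module Differences {c ℓ} (K : CommutativeRing c ℓ) where
  open Operators K public
  open CommutativeRing PR
  open SetoidReasoning setoid
  open IntegerSolver PR

  set2 : ℕ → List ℕ → ℕ → ℕ → List ℕ
  set2 i a u v = setE (setE a i u) (suc i) v

  swapE : ℕ → List ℕ → List ℕ
  swapE i a = set2 i a (getE a (suc i)) (getE a i)

  i≢1+i : ∀ {i} → i ≢ suc i
  i≢1+i i≡1+i = ℕₚ.1+n≢n (≡.sym i≡1+i)

  set2-left : ∀ i a u v → getE (set2 i a u v) i ≡ u
  set2-left i a u v = ≡.trans (getE-setE-≢ (setE a i u) v i≢1+i) (getE-setE a i u)

  set2-right : ∀ i a u v → getE (set2 i a u v) (suc i) ≡ v
  set2-right i a u v = getE-setE (setE a i u) (suc i) v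

  set2-other : ∀ {i k} a u v → k ≢ i → k ≢ suc i → getE (set2 i a u v) k ≡ getE a k
  set2-other {i} a u v k≢i k≢1+i = ≡.trans (getE-setE-≢ (setE a i u) v k≢1+i) (getE-setE-≢ a u k≢i)

  getE-swapE : ∀ i a k → getE (swapE i a) k ≡ getE a (Defs.sFun i k)
  getE-swapE i a k with sView i k
  ... | left = ≡.trans (set2-left i a _ _) (≡.cong (getE a) (≡.sym (sFun-left i)))
  ... | right = ≡.trans (set2-right i a _ _) (≡.cong (getE a) (≡.sym (sFun-right i)))
  ... | other k≢i k≢1+i = ≡.trans (set2-other a _ _ k≢i k≢1+i) (≡.cong (getE a) (≡.sym (sFun-other k≢i k≢1+i)))

  set2-ext : ∀ {i a b u u′ v v′} → a ≐ b → u ≡ u′ → v ≡ v′ → set2 i a u v ≐ set2 i b u′ v′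
  set2-ext {i} {a} {b} {u} {_} {v} a≐b ≡.refl ≡.refl .get k with sView i k
  ... | left = ≡.trans (set2-left i a u v) (≡.sym (set2-left i b u v))
  ... | right = ≡.trans (set2-right i a u v) (≡.sym (set2-right i b u v))
  ... | other p q = ≡.trans (set2-other a u v p q) (≡.trans (get a≐b k) (≡.sym (set2-other b u v p q)))

  set2-get : ∀ i a → set2 i a (getE a i) (getE a (suc i)) ≐ a
  set2-get i a .get k with sView i k
  ... | left = set2-left i a _ _
  ... | right = set2-right i a _ _
  ... | other p q = set2-other a _ _ p q

  unitE-same : ∀ k → getE (unitE k) k ≡ 1
  unitE-same k = getE-setE [] k 1

  unitE-≢ : ∀ {k m} → m ≢ k → getE (unitE k) m ≡ 0
  unitE-≢ m≢k = getE-setE-≢ [] 1 m≢k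

  add-left : ∀ i a u v → addE (unitE i) (set2 i a u v) ≐ set2 i a (suc u) v
  add-left i a u v .get k rewrite getE-addE (unitE i) (set2 i a u v) k with sView i k
  ... | left rewrite unitE-same i | set2-left i a u v = ≡.sym (set2-left i a (suc u) v)
  ... | right rewrite unitE-≢ {i} (i≢1+i ∘ ≡.sym) | set2-right i a u v = ≡.sym (set2-right i a (suc u) v)
  ... | other p q rewrite unitE-≢ p | set2-other a u v p q = ≡.sym (set2-other a (suc u) v p q)

  add-right : ∀ i a u v → addE (unitE (suc i)) (set2 i a u v) ≐ set2 i a u (suc v)
  add-right i a u v .get k rewrite getE-addE (unitE (suc i)) (set2 i a u v) k with sView i k
  ... | left rewrite unitE-≢ (i≢1+i {i}) | set2-left i a u v = ≡.sym (set2-left i a u (suc v))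
  ... | right rewrite unitE-same (suc i) | set2-right i a u v = ≡.sym (set2-right i a u (suc v))
  ... | other p q rewrite unitE-≢ q | set2-other a u v p q = ≡.sym (set2-other a u (suc v) p q)

  opaque
    s : ℕ → Poly → Poly
    s i = map (λ { (x , a) → (x , swapE i a) })

    ⟪⟫-s : ∀ i p φ → s i p ⟪ φ ⟫ 𝕂.≈ p ⟪ φ ∘ swapE i ⟫
    ⟪⟫-s i [] φ = 𝕂.refl
    ⟪⟫-s i ((x , a) ∷ p) φ = 𝕂.+-congˡ (⟪⟫-s i p φ)

  swapE-ext : ∀ i {a b} → a ≐ b → swapE i a ≐ swapE i b
  swapE-ext i a≐b = set2-ext a≐b (get a≐b (suc i)) (get a≐b i)

  swapE-addE : ∀ i a b → swapE i (addE a b) ≐ addE (swapE i a) (swapE i b)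
  swapE-addE i a b .get k rewrite getE-swapE i (addE a b) k | getE-addE a b (Defs.sFun i k)
    | getE-addE (swapE i a) (swapE i b) k | getE-swapE i a k | getE-swapE i b k = ≡.refl

  s-isHom : ∀ i → IsHom (s i)
  s-isHom i = record
    { cong = λ {p} {r} p≈r → mk≈ λ φ ext →
        𝕂.trans (⟪⟫-s i p φ) (𝕂.trans (at p≈r _ (ext ∘ swapE-ext i)) (𝕂.sym (⟪⟫-s i r φ)))
    ; +-homo = λ p r → mk≈ λ φ ext → 𝕂.trans (𝕂.trans (⟪⟫-s i (p + r) φ) (⟪⟫-+ₚ p r _))
        (𝕂.sym (𝕂.trans (⟪⟫-+ₚ (s i p) (s i r) φ) (𝕂.+-cong (⟪⟫-s i p φ) (⟪⟫-s i r φ))))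
    ; *-homo = λ p r → mk≈ (*-homo p r)
    ; C-homo = λ x → mk≈ λ φ ext → 𝕂.trans (⟪⟫-s i (C x) φ) (𝕂.+-congʳ (𝕂.*-congˡ (ext (set2-get i [])))) }
    where
    *-homo : ∀ p r φ → Ext φ → s i (p * r) ⟪ φ ⟫ 𝕂.≈ (s i p * s i r) ⟪ φ ⟫
    *-homo p r φ ext = 𝕂.begin
      s i (p * r) ⟪ φ ⟫
        𝕂.≈⟨ 𝕂.trans (⟪⟫-s i (p * r) φ) (⟪⟫-mul p r _) ⟩
      p ⟪ (λ a → r ⟪ (λ b → φ (swapE i (addE a b))) ⟫) ⟫
        𝕂.≈⟨ ⟪⟫-cong p (λ a → ⟪⟫-cong r (λ b → ext (swapE-addE i a b))) ⟩
      p ⟪ (λ a → r ⟪ (λ b → φ (addE (swapE i a) (swapE i b))) ⟫) ⟫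
        𝕂.≈⟨ ⟪⟫-cong p (λ a → ⟪⟫-s i r _) ⟨
      p ⟪ (λ a → s i r ⟪ (λ b → φ (addE (swapE i a) b)) ⟫) ⟫
        𝕂.≈⟨ ⟪⟫-s i p _ ⟨
      s i p ⟪ (λ a → s i r ⟪ (λ b → φ (addE a b)) ⟫) ⟫
        𝕂.≈⟨ ⟪⟫-mul (s i p) (s i r) φ ⟨
      (s i p * s i r) ⟪ φ ⟫ 𝕂.∎

  module s {i} = IsHom (s-isHom i)

  s-X : ∀ i k → s i (X k) ≈ X (Defs.sFun i k)
  s-X i k = mk≈ λ φ ext → 𝕂.trans (⟪⟫-s i (X k) φ) (𝕂.+-congʳ (𝕂.*-congˡ (ext (mk≐ swap))))
    where
    swap : ∀ m → getE (swapE i (unitE k)) m ≡ getE (unitE (Defs.sFun i k)) m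
    swap m rewrite getE-swapE i (unitE k) m with Defs.sFun i m ℕ.≟ k
    ... | yes ≡.refl rewrite sFun-involutive i m = ≡.trans (unitE-same (Defs.sFun i m)) (≡.sym (unitE-same m))
    ... | no ≢k = ≡.trans (unitE-≢ ≢k) (≡.sym (unitE-≢ {Defs.sFun i k} {m} λ m≡ → ≢k (≡.trans (≡.cong (Defs.sFun i) m≡) (sFun-involutive i k))))

  s-involutive : ∀ i p → s i (s i p) ≈ p
  s-involutive i = hom-unique (∘-isHom (s-isHom i) (s-isHom i)) id-isHom
    λ k → trans (s.cong (s-X i k)) (trans (s-X i _) (reflexive (≡.cong X (sFun-involutive i k))))

  opaque
    ∂ : ℕ → Poly → Poly
    ∂ = Defs.∂ K

    ∂-Defs : ∀ i p → ∂ i p ≡ Defs.∂ K i p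
    ∂-Defs i p = ≡.refl

  -- The transpose of the divided difference on one monomial: φ applied to (x_i^A x_{i+1}^B - x_i^B
  -- x_{i+1}^A)/(x_i - x_{i+1}), with the remaining exponents taken from a. Keeping A and B as
  -- separate arguments lets `δ-ext` replace a by an equivalent list without touching the case
  -- distinction.
  δ : ℕ → (List ℕ → 𝕂.Carrier) → List ℕ → ℕ → ℕ → 𝕂.Carrier
  δ i φ a A B = if B ℕ.<ᵇ A
    then 𝕂.∑ (A ℕ.∸ B) (λ k → φ (set2 i a (A ℕ.∸ 1 ℕ.∸ k) (B ℕ.+ k)))
    else (if A ℕ.<ᵇ B then 𝕂.- 𝕂.∑ (B ℕ.∸ A) (λ k → φ (set2 i a (B ℕ.∸ 1 ℕ.∸ k) (A ℕ.+ k))) else 𝕂.0#)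

  ⟪⟫-applyUpTo : ∀ y φ (m : ℕ → List ℕ) g n →
    map (λ k → (y , m k)) (applyUpTo g n) ⟪ φ ⟫ 𝕂.≈ y 𝕂.* 𝕂.∑ n (φ ∘ m ∘ g)
  ⟪⟫-applyUpTo y φ m g zero = 𝕂.sym (𝕂.zeroʳ y)
  ⟪⟫-applyUpTo y φ m g (suc n) = 𝕂.trans (𝕂.+-congˡ (⟪⟫-applyUpTo y φ m (g ∘ suc) n)) (𝕂.sym (𝕂.distribˡ _ _ _))

  ⟪⟫-dTerm : ∀ i x a φ → Defs.dTerm K i (x , a) ⟪ φ ⟫ 𝕂.≈ x 𝕂.* δ i φ a (getE a i) (getE a (suc i))
  ⟪⟫-dTerm i x a φ with getE a (suc i) ℕ.<ᵇ getE a i | getE a i ℕ.<ᵇ getE a (suc i)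
  ... | true | _ = ⟪⟫-applyUpTo x φ (λ k → set2 i a (getE a i ℕ.∸ 1 ℕ.∸ k) (getE a (suc i) ℕ.+ k)) id (getE a i ℕ.∸ getE a (suc i))
  ... | false | true = 𝕂.trans (⟪⟫-applyUpTo (𝕂.- x) φ (λ k → set2 i a (getE a (suc i) ℕ.∸ 1 ℕ.∸ k) (getE a i ℕ.+ k)) id (getE a (suc i) ℕ.∸ getE a i)) (𝕂.trans (𝕂.sym (𝕂.-‿distribˡ-* _ _)) (𝕂.-‿distribʳ-* _ _))
  ... | false | false = 𝕂.sym (𝕂.zeroʳ x)

  ∂* : ℕ → (List ℕ → 𝕂.Carrier) → List ℕ → 𝕂.Carrier
  ∂* i φ a = δ i φ a (getE a i) (getE a (suc i))

  opaque
    unfolding ∂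
    ⟪⟫-∂ : ∀ i p φ → ∂ i p ⟪ φ ⟫ 𝕂.≈ p ⟪ ∂* i φ ⟫
    ⟪⟫-∂ i [] φ = 𝕂.refl
    ⟪⟫-∂ i ((x , a) ∷ p) φ = 𝕂.trans (⟪⟫-++ (Defs.dTerm K i (x , a)) _ φ) (𝕂.+-cong (⟪⟫-dTerm i x a φ) (⟪⟫-∂ i p φ))

  δ-ext : ∀ i φ → Ext φ → ∀ {a b} → a ≐ b → ∀ A B → δ i φ a A B 𝕂.≈ δ i φ b A B
  δ-ext i φ ext a≐b A B with B ℕ.<ᵇ A | A ℕ.<ᵇ B
  ... | true | _ = 𝕂.∑-cong (A ℕ.∸ B) (λ k _ → ext (set2-ext {i} a≐b ≡.refl ≡.refl))
  ... | false | true = 𝕂.-‿cong (𝕂.∑-cong (B ℕ.∸ A) (λ k _ → ext (set2-ext {i} a≐b ≡.refl ≡.refl)))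
  ... | false | false = 𝕂.refl

  ∂*-Ext : ∀ i φ → Ext φ → Ext (∂* i φ)
  ∂*-Ext i φ ext {a} {b} a≐b rewrite get a≐b i | get a≐b (suc i) = δ-ext i φ ext a≐b (getE b i) (getE b (suc i))

  ∂-cong : ∀ i {p r} → p ≈ r → ∂ i p ≈ ∂ i r
  ∂-cong i {p} {r} p≈r = mk≈ λ φ ext → 𝕂.trans (⟪⟫-∂ i p φ) (𝕂.trans (at p≈r _ (∂*-Ext i φ ext)) (𝕂.sym (⟪⟫-∂ i r φ)))

  ∂-+ : ∀ i p r → ∂ i (p + r) ≈ ∂ i p + ∂ i r
  ∂-+ i p r = mk≈ λ φ ext → 𝕂.trans (𝕂.trans (⟪⟫-∂ i (p + r) φ) (⟪⟫-+ₚ p r _))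
    (𝕂.sym (𝕂.trans (⟪⟫-+ₚ (∂ i p) (∂ i r) φ) (𝕂.+-cong (⟪⟫-∂ i p φ) (⟪⟫-∂ i r φ))))

  ⟪⟫-X* : ∀ k p φ → (X k * p) ⟪ φ ⟫ 𝕂.≈ p ⟪ (λ a → φ (addE (unitE k) a)) ⟫
  ⟪⟫-X* k p φ = 𝕂.trans (⟪⟫-mul (X k) p φ) (𝕂.trans (𝕂.+-identityʳ _) (𝕂.*-identityˡ _))

  ⟪⟫-minus : ∀ p r φ → (p - r) ⟪ φ ⟫ 𝕂.≈ p ⟪ φ ⟫ 𝕂.- r ⟪ φ ⟫
  ⟪⟫-minus p r φ = 𝕂.trans (⟪⟫-+ₚ p (- r) φ) (𝕂.+-congˡ (⟪⟫-neg r φ))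

  -- In the list of monomials of the quotient, x_{i+1} times one of them is x_i times the next.
  -- Multiplication by x_i - x_{i+1} therefore leaves only the two ends.
  telescope : ∀ i a φ → Ext φ → ∀ A B → B ℕ.≤ A →
    𝕂.∑ (A ℕ.∸ B) (λ k → φ (addE (unitE i) (set2 i a (A ℕ.∸ 1 ℕ.∸ k) (B ℕ.+ k))))
      𝕂.- 𝕂.∑ (A ℕ.∸ B) (λ k → φ (addE (unitE (suc i)) (set2 i a (A ℕ.∸ 1 ℕ.∸ k) (B ℕ.+ k))))
      𝕂.≈ φ (set2 i a A B) 𝕂.- φ (set2 i a B A)
  telescope i a φ ext A B B≤A = 𝕂.begin
    𝕂.∑ d _ 𝕂.- 𝕂.∑ d _
      𝕂.≈⟨ 𝕂.+-cong (𝕂.∑-cong d λ k k<d → 𝕂.trans (ext (add-left i a _ _)) (𝕂.reflexive (≡.cong (λ u → φ (set2 i a u (B ℕ.+ k))) (suc-pred k (ℕₚ.<-≤-trans k<d (ℕₚ.m∸n≤m A B))))))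
            (𝕂.-‿cong (𝕂.∑-cong d λ k k<d → 𝕂.trans (ext (add-right i a _ _)) (𝕂.reflexive (≡.cong₂ (λ u v → φ (set2 i a u v)) (ℕₚ.∸-+-assoc A 1 k) (≡.sym (ℕₚ.+-suc B k)))))) ⟩
    𝕂.∑ d g 𝕂.- 𝕂.∑ d (g ∘ suc)
      𝕂.≈⟨ 𝕂.∑-minus d g (g ∘ suc) ⟨
    𝕂.∑ d (λ k → g k 𝕂.- g (suc k))
      𝕂.≈⟨ 𝕂.∑-telescope d g ⟩
    g 0 𝕂.- g d
      𝕂.≡⟨ ≡.cong₂ 𝕂._-_ (≡.cong (λ v → φ (set2 i a A v)) (ℕₚ.+-identityʳ B)) (≡.cong₂ (λ u v → φ (set2 i a u v)) (ℕₚ.m∸[m∸n]≡n B≤A) (ℕₚ.m+[n∸m]≡n B≤A)) ⟩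
    φ (set2 i a A B) 𝕂.- φ (set2 i a B A) 𝕂.∎
    where
    d : ℕ
    d = A ℕ.∸ B
    g : ℕ → 𝕂.Carrier
    g k = φ (set2 i a (A ℕ.∸ k) (B ℕ.+ k))
    suc-pred : ∀ k → k ℕ.< A → suc (A ℕ.∸ 1 ℕ.∸ k) ≡ A ℕ.∸ k
    suc-pred k k<A rewrite ℕₚ.∸-+-assoc A 1 k = ≡.sym (ℕₚ.+-∸-assoc 1 k<A)

  ∂*-difference : ∀ i φ → Ext φ → ∀ a →
    ∂* i (λ b → φ (addE (unitE i) b)) a 𝕂.- ∂* i (λ b → φ (addE (unitE (suc i)) b)) a 𝕂.≈ φ a 𝕂.- φ (swapE i a)
  ∂*-difference i φ ext a with getE a (suc i) ℕ.<ᵇ getE a i in eq₁ | getE a i ℕ.<ᵇ getE a (suc i) in eq₂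
  ... | true | _ = 𝕂.trans (telescope i a φ ext _ _ (ℕₚ.<⇒≤ (<ᵇ-true eq₁))) (𝕂.+-congʳ (ext (set2-get i a)))
  ... | false | true = 𝕂.begin
    𝕂.- u 𝕂.- 𝕂.- v               𝕂.≈⟨ 𝕂.solve 2 (λ u v → (𝕂.:- u) 𝕂.:- (𝕂.:- v) 𝕂.:= 𝕂.:- (u 𝕂.:- v)) 𝕂.refl u v ⟩
    𝕂.- (u 𝕂.- v)                 𝕂.≈⟨ 𝕂.-‿cong (telescope i a φ ext B A (ℕₚ.<⇒≤ (<ᵇ-true eq₂))) ⟩
    𝕂.- (φ (swapE i a) 𝕂.- φ (set2 i a A B)) 𝕂.≈⟨ 𝕂.solve 2 (λ u v → 𝕂.:- (u 𝕂.:- v) 𝕂.:= v 𝕂.:- u) 𝕂.refl _ _ ⟩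
    φ (set2 i a A B) 𝕂.- φ (swapE i a) 𝕂.≈⟨ 𝕂.+-congʳ (ext (set2-get i a)) ⟩
    φ a 𝕂.- φ (swapE i a)         𝕂.∎
    where
    A B : ℕ
    A = getE a i
    B = getE a (suc i)
    u v : 𝕂.Carrier
    u = 𝕂.∑ (B ℕ.∸ A) (λ k → φ (addE (unitE i) (set2 i a (B ℕ.∸ 1 ℕ.∸ k) (A ℕ.+ k))))
    v = 𝕂.∑ (B ℕ.∸ A) (λ k → φ (addE (unitE (suc i)) (set2 i a (B ℕ.∸ 1 ℕ.∸ k) (A ℕ.+ k))))
  ... | false | false = 𝕂.trans (𝕂.-‿inverseʳ 𝕂.0#) (𝕂.sym (𝕂.trans (𝕂.+-congˡ (𝕂.-‿cong (ext (≐-trans swap≐ (set2-get i a))))) (𝕂.-‿inverseʳ (φ a))))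
    where
    A≡B : getE a i ≡ getE a (suc i)
    A≡B = ℕₚ.≤-antisym (<ᵇ-false eq₁) (<ᵇ-false eq₂)
    swap≐ : swapE i a ≐ set2 i a (getE a i) (getE a (suc i))
    swap≐ = set2-ext ≐-refl (≡.sym A≡B) A≡B

  α : ℕ → Poly
  α i = X i - X (suc i)

  -- Together with the cancellation of α (`α-injective`) this equation determines `∂ i`; the Leibniz
  -- rule and the nil-Coxeter relations are derived from these two facts.
  α*∂ : ∀ i p → α i * ∂ i p ≈ p - s i p
  α*∂ i p = mk≈ λ φ ext → 𝕂.begin
    (α i * ∂ i p) ⟪ φ ⟫
      𝕂.≈⟨ at (solve 3 (λ x y d → (x :- y) :* d := x :* d :- y :* d) refl (X i) (X (suc i)) (∂ i p)) φ ext ⟩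
    (X i * ∂ i p - X (suc i) * ∂ i p) ⟪ φ ⟫
      𝕂.≈⟨ 𝕂.trans (⟪⟫-minus (X i * ∂ i p) (X (suc i) * ∂ i p) φ) (𝕂.+-cong (⟪⟫-X* i (∂ i p) φ) (𝕂.-‿cong (⟪⟫-X* (suc i) (∂ i p) φ))) ⟩
    ∂ i p ⟪ (λ a → φ (addE (unitE i) a)) ⟫ 𝕂.- ∂ i p ⟪ (λ a → φ (addE (unitE (suc i)) a)) ⟫
      𝕂.≈⟨ 𝕂.+-cong (⟪⟫-∂ i p _) (𝕂.-‿cong (⟪⟫-∂ i p _)) ⟩
    p ⟪ ψ φ ⟫ 𝕂.- p ⟪ ψ′ φ ⟫
      𝕂.≈⟨ ⟪⟫-diff p (ψ φ) (ψ′ φ) ⟨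
    p ⟪ (λ a → ψ φ a 𝕂.- ψ′ φ a) ⟫
      𝕂.≈⟨ ⟪⟫-cong p (∂*-difference i φ ext) ⟩
    p ⟪ (λ a → φ a 𝕂.- φ (swapE i a)) ⟫
      𝕂.≈⟨ ⟪⟫-diff p φ (φ ∘ swapE i) ⟩
    p ⟪ φ ⟫ 𝕂.- p ⟪ φ ∘ swapE i ⟫
      𝕂.≈⟨ 𝕂.trans (⟪⟫-minus p (s i p) φ) (𝕂.+-congˡ (𝕂.-‿cong (⟪⟫-s i p φ))) ⟨
    (p - s i p) ⟪ φ ⟫ 𝕂.∎
    where
    ψ ψ′ : (List ℕ → 𝕂.Carrier) → List ℕ → 𝕂.Carrier
    ψ φ = ∂* i (λ a → φ (addE (unitE i) a))
    ψ′ φ = ∂* i (λ a → φ (addE (unitE (suc i)) a))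
    ⟪⟫-diff : ∀ p φ ψ → p ⟪ (λ a → φ a 𝕂.- ψ a) ⟫ 𝕂.≈ p ⟪ φ ⟫ 𝕂.- p ⟪ ψ ⟫
    ⟪⟫-diff p φ ψ = 𝕂.begin
      p ⟪ (λ a → φ a 𝕂.- ψ a) ⟫                   𝕂.≈⟨ ⟪⟫-cong p (λ a → 𝕂.+-congˡ (𝕂.-1*x≈-x (ψ a))) ⟨
      p ⟪ (λ a → φ a 𝕂.+ (𝕂.- 𝕂.1#) 𝕂.* ψ a) ⟫    𝕂.≈⟨ ⟪⟫-+ p φ _ ⟩
      p ⟪ φ ⟫ 𝕂.+ p ⟪ (λ a → (𝕂.- 𝕂.1#) 𝕂.* ψ a) ⟫ 𝕂.≈⟨ 𝕂.+-congˡ (𝕂.trans (⟪⟫-* p _ ψ) (𝕂.-1*x≈-x _)) ⟩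
      p ⟪ φ ⟫ 𝕂.- p ⟪ ψ ⟫                         𝕂.∎

  -- Every functional φ is the pullback of some ψ along multiplication by α i: solve
  -- φ(a) = ψ(a + eᵢ) − ψ(a + eᵢ₊₁) by recursion on the exponent of xᵢ.
  antidifference : ℕ → (List ℕ → 𝕂.Carrier) → ℕ → List ℕ → 𝕂.Carrier
  antidifference i φ zero b = 𝕂.0#
  antidifference i φ (suc k) b =
    φ (setE b i k) 𝕂.+ antidifference i φ k (setE (setE b i k) (suc i) (suc (getE b (suc i))))

  antidifference-ext : ∀ i φ → Ext φ → ∀ k → Ext (antidifference i φ k)
  antidifference-ext i φ ext zero a≐b = 𝕂.refl
  antidifference-ext i φ ext (suc k) {a} {b} a≐b = 𝕂.+-cong (ext (setE-ext i k a≐b))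
    (antidifference-ext i φ ext k (set2-ext a≐b ≡.refl (≡.cong suc (get a≐b (suc i)))))
    where
    setE-ext : ∀ i v {a b} → a ≐ b → setE a i v ≐ setE b i v
    setE-ext i v {a} {b} a≐b .get m with m ℕ.≟ i
    ... | yes ≡.refl = ≡.trans (getE-setE a m v) (≡.sym (getE-setE b m v))
    ... | no m≢i = ≡.trans (getE-setE-≢ a v m≢i) (≡.trans (get a≐b m) (≡.sym (getE-setE-≢ b v m≢i)))

  α-cancel : ∀ i p → α i * p ≈ 0# → p ≈ 0#
  α-cancel i p αp≈0 = mk≈ λ φ ext → 𝕂.begin
    p ⟪ φ ⟫
      𝕂.≈⟨ 𝕂.solve 2 (λ u v → u 𝕂.:= (u 𝕂.:+ v) 𝕂.:- v) 𝕂.refl _ (p ⟪ ψ φ ∘ addE (unitE (suc i)) ⟫) ⟩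
    (p ⟪ φ ⟫ 𝕂.+ p ⟪ ψ φ ∘ addE (unitE (suc i)) ⟫) 𝕂.- p ⟪ ψ φ ∘ addE (unitE (suc i)) ⟫
      𝕂.≈⟨ 𝕂.+-congʳ (⟪⟫-+ p φ _) ⟨
    p ⟪ (λ a → φ a 𝕂.+ ψ φ (addE (unitE (suc i)) a)) ⟫ 𝕂.- p ⟪ ψ φ ∘ addE (unitE (suc i)) ⟫
      𝕂.≈⟨ 𝕂.+-congʳ (⟪⟫-cong p (ψ-solves φ ext)) ⟨
    p ⟪ ψ φ ∘ addE (unitE i) ⟫ 𝕂.- p ⟪ ψ φ ∘ addE (unitE (suc i)) ⟫
      𝕂.≈⟨ 𝕂.trans (⟪⟫-minus (X i * p) (X (suc i) * p) (ψ φ)) (𝕂.+-cong (⟪⟫-X* i p (ψ φ)) (𝕂.-‿cong (⟪⟫-X* (suc i) p (ψ φ)))) ⟨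
    (X i * p - X (suc i) * p) ⟪ ψ φ ⟫
      𝕂.≈⟨ at (solve 3 (λ x y d → (x :- y) :* d := x :* d :- y :* d) refl (X i) (X (suc i)) p) (ψ φ) (ψ-Ext φ ext) ⟨
    (α i * p) ⟪ ψ φ ⟫
      𝕂.≈⟨ at αp≈0 (ψ φ) (ψ-Ext φ ext) ⟩
    𝕂.0# 𝕂.∎
    where
    ψ : (List ℕ → 𝕂.Carrier) → List ℕ → 𝕂.Carrier
    ψ φ b = antidifference i φ (getE b i) b
    ψ-Ext : ∀ φ → Ext φ → Ext (ψ φ)
    ψ-Ext φ ext {_} {b} a≐b rewrite get a≐b i = antidifference-ext i φ ext (getE b i) a≐b
    ψ-solves : ∀ φ → Ext φ → ∀ a → ψ φ (addE (unitE i) a) 𝕂.≈ φ a 𝕂.+ ψ φ (addE (unitE (suc i)) a)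
    ψ-solves φ ext a
      rewrite getE-addE (unitE i) a i | unitE-same i | getE-addE (unitE (suc i)) a i | unitE-≢ (i≢1+i {i})
      = 𝕂.+-cong (ext (mk≐ lower)) (antidifference-ext i φ ext (getE a i) {set2 i (addE (unitE i) a) (getE a i) (suc (getE (addE (unitE i) a) (suc i)))} {addE (unitE (suc i)) a} (mk≐ move))
      where
      lower : ∀ m → getE (setE (addE (unitE i) a) i (getE a i)) m ≡ getE a m
      lower m with m ℕ.≟ i
      ... | yes ≡.refl = getE-setE (addE (unitE i) a) m _
      ... | no m≢i = ≡.trans (getE-setE-≢ (addE (unitE i) a) _ m≢i) (≡.trans (getE-addE (unitE i) a m) (≡.cong (ℕ._+ getE a m) (unitE-≢ m≢i)))
      move : ∀ m → getE (set2 i (addE (unitE i) a) (getE a i) (suc (getE (addE (unitE i) a) (suc i)))) m ≡ getE (addE (unitE (suc i)) a) m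
      move m rewrite getE-addE (unitE (suc i)) a m with sView i m
      ... | left rewrite unitE-≢ (i≢1+i {i}) = set2-left i (addE (unitE i) a) _ _
      ... | right rewrite unitE-same (suc i) = ≡.trans (set2-right i (addE (unitE i) a) _ _)
              (≡.cong suc (≡.trans (getE-addE (unitE i) a (suc i)) (≡.cong (ℕ._+ getE a (suc i)) (unitE-≢ {i} (i≢1+i ∘ ≡.sym)))))
      ... | other p q rewrite unitE-≢ q = ≡.trans (set2-other (addE (unitE i) a) _ _ p q) (≡.trans (getE-addE (unitE i) a m) (≡.cong (ℕ._+ getE a m) (unitE-≢ p)))

-- Commutation and braid relations of adjacent transpositions

Far : ℕ → ℕ → Set
Far i j = i ≢ j × i ≢ suc j × suc i ≢ j

Far-sym : ∀ {i j} → Far i j → Far j i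
Far-sym (a , b , c) = a ∘ ≡.sym , c ∘ ≡.sym , b ∘ ≡.sym

sFun-comm : ∀ {i j} → Far i j → ∀ k → sFun i (sFun j k) ≡ sFun j (sFun i k)
sFun-comm {i} {j} (i≢j , i≢1+j , 1+i≢j) k with sView i k
... | left rewrite sFun-other i≢j i≢1+j | sFun-left i | sFun-other {j} 1+i≢j (i≢j ∘ ℕₚ.suc-injective) = ≡.refl
... | right rewrite sFun-right i | sFun-other {j} 1+i≢j (i≢j ∘ ℕₚ.suc-injective) | sFun-right i | sFun-other i≢j i≢1+j = ≡.refl
... | other k≢i k≢1+i rewrite sFun-other k≢i k≢1+i with sView j k
...   | left rewrite sFun-left j = sFun-other {i} (i≢1+j ∘ ≡.sym) (i≢j ∘ ≡.sym ∘ ℕₚ.suc-injective)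
...   | right rewrite sFun-right j = sFun-other {i} (i≢j ∘ ≡.sym) (1+i≢j ∘ ≡.sym)
...   | other k≢j k≢1+j rewrite sFun-other k≢j k≢1+j = sFun-other k≢i k≢1+i

sFun-2+ : ∀ i → sFun i (suc (suc i)) ≡ suc (suc i)
sFun-2+ i = sFun-other (ℕₚ.m+1+n≢n 1) (ℕₚ.1+n≢n ∘ ℕₚ.suc-injective)

sFun-suc-self : ∀ i → sFun (suc i) i ≡ i
sFun-suc-self i = sFun-other (ℕₚ.1+n≢n ∘ ≡.sym) (ℕₚ.m+1+n≢n 1 ∘ ≡.sym)

sFun-braid : ∀ i k → sFun i (sFun (suc i) (sFun i k)) ≡ sFun (suc i) (sFun i (sFun (suc i) k))
sFun-braid i k with sView i k
... | left rewrite sFun-left i | sFun-left (suc i) | sFun-2+ i | sFun-suc-self i | sFun-left i | sFun-left (suc i) = ≡.refl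
... | right rewrite sFun-right i | sFun-suc-self i | sFun-left i | sFun-left (suc i) | sFun-2+ i | sFun-right (suc i) = ≡.refl
... | other k≢i k≢1+i rewrite sFun-other k≢i k≢1+i with sView (suc i) k
...   | left = ⊥-elim (k≢1+i ≡.refl)
...   | right rewrite sFun-right (suc i) | sFun-right i | sFun-suc-self i = ≡.refl
...   | other p q rewrite sFun-other p q | sFun-other k≢i k≢1+i | sFun-other p q = ≡.refl

sFun-+ : ∀ l i k → sFun (l ℕ.+ i) (l ℕ.+ k) ≡ l ℕ.+ sFun i k
sFun-+ l i k with sView i k
... | left rewrite sFun-left i | sFun-left (l ℕ.+ i) = ≡.sym (ℕₚ.+-suc l i)
... | right rewrite sFun-right i | ℕₚ.+-suc l i = sFun-right (l ℕ.+ i)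
... | other p q rewrite sFun-other p q =
  sFun-other (p ∘ ℕₚ.+-cancelˡ-≡ l k i) (λ e → q (ℕₚ.+-cancelˡ-≡ l k (suc i) (≡.trans e (≡.sym (ℕₚ.+-suc l i)))))

-- Leibniz rule, nil-Coxeter relations and words of divided differences

module NilCoxeter {c ℓ} (K : CommutativeRing c ℓ) where
  open Differences K public
  open CommutativeRing PR
  open SetoidReasoning setoid
  open IntegerSolver PR
  open RingProperties ring using (-‿distribˡ-*; -‿distribʳ-*; -0#≈0#)

  α-injective : ∀ i {p r} → α i * p ≈ α i * r → p ≈ r
  α-injective i {p} {r} eq = begin
    p              ≈⟨ solve 2 (λ p r → p := (p :- r) :+ r) refl p r ⟩
    (p - r) + r    ≈⟨ +-congʳ (α-cancel i (p - r) (begin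
      α i * (p - r)          ≈⟨ solve 3 (λ a p r → a :* (p :- r) := a :* p :- a :* r) refl (α i) p r ⟩
      α i * p - α i * r      ≈⟨ +-congʳ eq ⟩
      α i * r - α i * r      ≈⟨ -‿inverseʳ _ ⟩
      0#                     ∎)) ⟩
    0# + r         ≈⟨ +-identityˡ r ⟩
    r              ∎

  s-α : ∀ i → s i (α i) ≈ - α i
  s-α i = begin
    s i (X i - X (suc i))         ≈⟨ s.sub-homo (X i) (X (suc i)) ⟩
    s i (X i) - s i (X (suc i))   ≈⟨ +-cong (trans (s-X i i) (reflexive (≡.cong X (sFun-left i))))
                                      (-‿cong (trans (s-X i (suc i)) (reflexive (≡.cong X (sFun-right i))))) ⟩
    X (suc i) - X i               ≈⟨ solve 2 (λ x y → y :- x := :- (x :- y)) refl (X i) (X (suc i)) ⟩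
    - α i                         ∎

  ∂-sym : ∀ i {p} → s i p ≈ p → ∂ i p ≈ 0#
  ∂-sym i {p} sp≈p = α-cancel i (∂ i p) (trans (α*∂ i p) (trans (+-congˡ (-‿cong sp≈p)) (-‿inverseʳ p)))

  sym-∂ : ∀ i {p} → ∂ i p ≈ 0# → s i p ≈ p
  sym-∂ i {p} ∂p≈0 = begin
    s i p                ≈⟨ solve 2 (λ p r → r := p :- (p :- r)) refl p (s i p) ⟩
    p - (p - s i p)      ≈⟨ +-congˡ (-‿cong (trans (sym (α*∂ i p)) (trans (*-congˡ ∂p≈0) (zeroʳ _)))) ⟩
    p - 0#               ≈⟨ trans (+-congˡ -0#≈0#) (+-identityʳ p) ⟩
    p                    ∎

  leibniz : ∀ i p r → ∂ i (p * r) ≈ ∂ i p * r + s i p * ∂ i r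
  leibniz i p r = α-injective i (begin
    α i * ∂ i (p * r)                              ≈⟨ trans (α*∂ i (p * r)) (+-congˡ (-‿cong (s.*-homo p r))) ⟩
    p * r - s i p * s i r                          ≈⟨ solve 4 (λ p r p′ r′ → p :* r :- p′ :* r′ := (p :- p′) :* r :+ p′ :* (r :- r′)) refl p r (s i p) (s i r) ⟩
    (p - s i p) * r + s i p * (r - s i r)          ≈⟨ +-cong (*-congʳ (α*∂ i p)) (*-congˡ (α*∂ i r)) ⟨
    α i * ∂ i p * r + s i p * (α i * ∂ i r)        ≈⟨ solve 5 (λ a d r p′ e → a :* d :* r :+ p′ :* (a :* e) := a :* (d :* r :+ p′ :* e)) refl (α i) (∂ i p) r (s i p) (∂ i r) ⟩
    α i * (∂ i p * r + s i p * ∂ i r)              ∎)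

  ∂-*-sym : ∀ i {p} r → s i p ≈ p → ∂ i (p * r) ≈ p * ∂ i r
  ∂-*-sym i {p} r sp≈p = begin
    ∂ i (p * r)                      ≈⟨ leibniz i p r ⟩
    ∂ i p * r + s i p * ∂ i r        ≈⟨ +-cong (trans (*-congʳ (∂-sym i sp≈p)) (zeroˡ r)) (*-congʳ sp≈p) ⟩
    0# + p * ∂ i r                   ≈⟨ +-identityˡ _ ⟩
    p * ∂ i r                        ∎

  ∂-C : ∀ i x p → ∂ i (C x * p) ≈ C x * ∂ i p
  ∂-C i x p = ∂-*-sym i p (s.C-homo x)

  ∂-0 : ∀ i → ∂ i 0# ≈ 0#
  ∂-0 i = mk≈ λ φ ext → ⟪⟫-∂ i [] φ

  ∂-neg : ∀ i p → ∂ i (- p) ≈ - ∂ i p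
  ∂-neg i p = begin
    ∂ i (- p)                          ≈⟨ solve 2 (λ u v → u := (u :+ v) :- v) refl _ (∂ i p) ⟩
    (∂ i (- p) + ∂ i p) - ∂ i p        ≈⟨ +-congʳ (∂-+ i (- p) p) ⟨
    ∂ i (- p + p) - ∂ i p              ≈⟨ +-congʳ (trans (∂-cong i (-‿inverseˡ p)) (∂-0 i)) ⟩
    0# - ∂ i p                         ≈⟨ +-identityˡ _ ⟩
    - ∂ i p                            ∎

  s-∂ : ∀ i p → s i (∂ i p) ≈ ∂ i p
  s-∂ i p = α-injective i (begin
    α i * s i (∂ i p)            ≈⟨ solve 2 (λ a d → a :* d := :- ((:- a) :* d)) refl (α i) (s i (∂ i p)) ⟩
    - (- α i * s i (∂ i p))      ≈⟨ -‿cong (*-congʳ (s-α i)) ⟨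
    - (s i (α i) * s i (∂ i p))  ≈⟨ -‿cong (s.*-homo (α i) (∂ i p)) ⟨
    - s i (α i * ∂ i p)          ≈⟨ -‿cong (trans (s.cong (α*∂ i p)) (trans (s.sub-homo p (s i p)) (+-congˡ (-‿cong (s-involutive i p))))) ⟩
    - (s i p - p)                ≈⟨ solve 2 (λ p r → :- (r :- p) := p :- r) refl p (s i p) ⟩
    p - s i p                    ≈⟨ α*∂ i p ⟨
    α i * ∂ i p                  ∎)

  ∂∂ : ∀ i p → ∂ i (∂ i p) ≈ 0#
  ∂∂ i p = ∂-sym i (s-∂ i p)

  -- Both sides agree after multiplication by `α j`. It is applied to a transposition with distant
  -- indices, to the shift `emb` and to `ρ`, which sets the first variable to 0.
  ∂-hom : ∀ {Φ} → IsHom Φ → ∀ i j → (∀ p → Φ (s i p) ≈ s j (Φ p)) → Φ (α i) ≈ α j →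
    ∀ p → ∂ j (Φ p) ≈ Φ (∂ i p)
  ∂-hom {Φ} Φh i j Φs Φα p = α-injective j (begin
    α j * ∂ j (Φ p)       ≈⟨ α*∂ j (Φ p) ⟩
    Φ p - s j (Φ p)       ≈⟨ +-congˡ (-‿cong (Φs p)) ⟨
    Φ p - Φ (s i p)       ≈⟨ Φh.sub-homo p (s i p) ⟨
    Φ (p - s i p)         ≈⟨ Φh.cong (α*∂ i p) ⟨
    Φ (α i * ∂ i p)       ≈⟨ Φh.*-homo (α i) (∂ i p) ⟩
    Φ (α i) * Φ (∂ i p)   ≈⟨ *-congʳ Φα ⟩
    α j * Φ (∂ i p)       ∎)
    where module Φh = IsHom Φh

  s-s : ∀ i j k → s i (s j (X k)) ≈ X (sFun i (sFun j k))
  s-s i j k = trans (s.cong (s-X j k)) (s-X i _)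

  s-comm : ∀ {i j} → Far i j → ∀ p → s i (s j p) ≈ s j (s i p)
  s-comm {i} {j} far = hom-unique (∘-isHom (s-isHom i) (s-isHom j)) (∘-isHom (s-isHom j) (s-isHom i))
    λ k → trans (s-s i j k) (trans (reflexive (≡.cong X (sFun-comm far k))) (sym (s-s j i k)))

  s-braid : ∀ i p → s i (s (suc i) (s i p)) ≈ s (suc i) (s i (s (suc i) p))
  s-braid i = hom-unique (∘-isHom (s-isHom i) (∘-isHom (s-isHom (suc i)) (s-isHom i)))
    (∘-isHom (s-isHom (suc i)) (∘-isHom (s-isHom i) (s-isHom (suc i))))
    λ k → trans (s.cong (s-s (suc i) i k)) (trans (s-X i _) (trans (reflexive (≡.cong X (sFun-braid i k)))
            (sym (trans (s.cong (s-s i (suc i) k)) (s-X (suc i) _)))))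

  s-X-≡ : ∀ i k {m} → sFun i k ≡ m → s i (X k) ≈ X m
  s-X-≡ i k eq = trans (s-X i k) (reflexive (≡.cong X eq))

  s-α-far : ∀ {i j} → Far i j → s i (α j) ≈ α j
  s-α-far {i} {j} (i≢j , i≢1+j , 1+i≢j) = trans (s.sub-homo _ _)
    (+-cong (s-X-≡ i j (sFun-other (i≢j ∘ ≡.sym) (1+i≢j ∘ ≡.sym)))
      (-‿cong (s-X-≡ i (suc j) (sFun-other (i≢1+j ∘ ≡.sym) (i≢j ∘ ≡.sym ∘ ℕₚ.suc-injective)))))

  ∂-comm : ∀ {i j} → Far i j → ∀ p → ∂ i (∂ j p) ≈ ∂ j (∂ i p)
  ∂-comm {i} {j} far p = α-injective i (begin
    α i * ∂ i (∂ j p)                   ≈⟨ α*∂ i (∂ j p) ⟩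
    ∂ j p - s i (∂ j p)                 ≈⟨ +-congˡ (-‿cong (∂-hom (s-isHom i) j j (s-comm far) (s-α-far far) p)) ⟨
    ∂ j p - ∂ j (s i p)                 ≈⟨ +-congˡ (∂-neg j (s i p)) ⟨
    ∂ j p + ∂ j (- s i p)               ≈⟨ ∂-+ j p (- s i p) ⟨
    ∂ j (p - s i p)                     ≈⟨ ∂-cong j (α*∂ i p) ⟨
    ∂ j (α i * ∂ i p)                   ≈⟨ ∂-*-sym j (∂ i p) (s-α-far (Far-sym far)) ⟩
    α i * ∂ j (∂ i p)                   ∎)

  s-α-next : ∀ i → s i (α (suc i)) ≈ α i + α (suc i)
  s-α-next i = begin
    s i (α (suc i))               ≈⟨ s.sub-homo _ _ ⟩
    s i (X (suc i)) - s i (X (suc (suc i)))  ≈⟨ +-cong (s-X-≡ i (suc i) (sFun-right i)) (-‿cong (s-X-≡ i (suc (suc i)) (sFun-2+ i))) ⟩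
    X i - X (suc (suc i))         ≈⟨ solve 3 (λ x y z → x :- z := (x :- y) :+ (y :- z)) refl (X i) (X (suc i)) (X (suc (suc i))) ⟩
    α i + α (suc i)               ∎

  s-α-prev : ∀ i → s (suc i) (α i) ≈ α i + α (suc i)
  s-α-prev i = begin
    s (suc i) (α i)               ≈⟨ s.sub-homo _ _ ⟩
    s (suc i) (X i) - s (suc i) (X (suc i))  ≈⟨ +-cong (s-X-≡ (suc i) i (sFun-suc-self i)) (-‿cong (s-X-≡ (suc i) (suc i) (sFun-left (suc i)))) ⟩
    X i - X (suc (suc i))         ≈⟨ solve 3 (λ x y z → x :- z := (x :- y) :+ (y :- z)) refl (X i) (X (suc i)) (X (suc (suc i))) ⟩
    α i + α (suc i)               ∎

  -- The sum of the two roots is the image of `α (suc i)` under the involution `s i`, so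
  -- cancellation carries over from `α (suc i)`.
  α+α-injective : ∀ i {p r} → (α i + α (suc i)) * p ≈ (α i + α (suc i)) * r → p ≈ r
  α+α-injective i {p} {r} eq = begin
    p               ≈⟨ s-involutive i p ⟨
    s i (s i p)     ≈⟨ s.cong (α-injective (suc i) (begin
      α (suc i) * s i p                        ≈⟨ trans (sym (s-involutive i _)) (s.cong (push p)) ⟩
      s i ((α i + α (suc i)) * p)              ≈⟨ s.cong eq ⟩
      s i ((α i + α (suc i)) * r)              ≈⟨ trans (sym (s-involutive i _)) (s.cong (push r)) ⟨
      α (suc i) * s i r                        ∎)) ⟩
    s i (s i r)     ≈⟨ s-involutive i r ⟩
    r               ∎
    where
    push : ∀ p → s i (α (suc i) * s i p) ≈ (α i + α (suc i)) * p
    push p = trans (s.*-homo _ _) (*-cong (s-α-next i) (s-involutive i p))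

  -- (a b c) ∂ ∂ ∂ f is the antisymmetrisation of f, where c = a + b; the extra factor a
  -- is cancelled. Here (i , j) is (i , suc i) or (suc i , i).
  module Braid (i j : ℕ) (s-αj : s i (α j) ≈ α i + α j) (s-αi : s j (α i) ≈ α i + α j) where
    a b : Poly
    a = α i
    b = α j

    antisymmetrised : Poly → Poly
    antisymmetrised f = f - s i f - s j f + s j (s i f) + s i (s j f) - s i (s j (s i f))

    stage₂ : ∀ f → a * b * (a + b) * ∂ j (∂ i f) ≈ (a + b) * (f - s i f) - a * (s j f - s j (s i f))
    stage₂ f = begin
      a * b * (a + b) * ∂ j g                     ≈⟨ solve 3 (λ a b d → a :* b :* (a :+ b) :* d := (a :+ b) :* a :* (b :* d)) refl a b (∂ j g) ⟩
      (a + b) * a * (b * ∂ j g)                   ≈⟨ *-congˡ (α*∂ j g) ⟩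
      (a + b) * a * (g - s j g)                   ≈⟨ solve 4 (λ a b g h → (a :+ b) :* a :* (g :- h) := (a :+ b) :* (a :* g) :- a :* ((a :+ b) :* h)) refl a b g (s j g) ⟩
      (a + b) * (a * g) - a * ((a + b) * s j g)   ≈⟨ +-cong (*-congˡ (α*∂ i f)) (-‿cong (*-congˡ (begin
        (a + b) * s j g        ≈⟨ *-congʳ s-αi ⟨
        s j a * s j g          ≈⟨ s.*-homo a g ⟨
        s j (a * g)            ≈⟨ s.cong (α*∂ i f) ⟩
        s j (f - s i f)        ≈⟨ s.sub-homo f (s i f) ⟩
        s j f - s j (s i f)    ∎))) ⟩
      (a + b) * (f - s i f) - a * (s j f - s j (s i f)) ∎
      where
      g : Poly
      g = ∂ i f

    s-a+b : s i (a + b) ≈ b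
    s-a+b = trans (s.+-homo a b) (trans (+-cong (s-α i) s-αj) (solve 2 (λ a b → :- a :+ (a :+ b) := b) refl a b))

    s-abc : s i (a * b * (a + b)) ≈ - (a * b * (a + b))
    s-abc = begin
      s i (a * b * (a + b))             ≈⟨ trans (s.*-homo _ _) (*-congʳ (s.*-homo _ _)) ⟩
      s i a * s i b * s i (a + b)       ≈⟨ *-cong (*-cong (s-α i) s-αj) s-a+b ⟩
      - a * (a + b) * b                 ≈⟨ solve 2 (λ a b → :- a :* (a :+ b) :* b := :- (a :* b :* (a :+ b))) refl a b ⟩
      - (a * b * (a + b))               ∎

    stage₃ : ∀ f → a * b * (a + b) * ∂ i (∂ j (∂ i f)) ≈ antisymmetrised f
    stage₃ f = α-injective i (begin
      a * (abc * ∂ i h)                     ≈⟨ solve 3 (λ a b d → a :* (b :* d) := b :* (a :* d)) refl a abc (∂ i h) ⟩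
      abc * (a * ∂ i h)                     ≈⟨ *-congˡ (α*∂ i h) ⟩
      abc * (h - s i h)                     ≈⟨ solve 3 (λ m h k → m :* (h :- k) := m :* h :+ (:- m) :* k) refl abc h (s i h) ⟩
      abc * h + - abc * s i h               ≈⟨ +-congˡ (trans (*-congʳ (sym s-abc)) (sym (s.*-homo abc h))) ⟩
      abc * h + s i (abc * h)               ≈⟨ +-cong (stage₂ f) (s.cong (stage₂ f)) ⟩
      k + s i k                             ≈⟨ +-congˡ s-k ⟩
      k + (b * (s i f - f) - - a * (s i (s j f) - s i (s j (s i f))))
        ≈⟨ solve 8 (λ a b f f₁ f₂ f₂₁ f₁₂ f₁₂₁ →
             ((a :+ b) :* (f :- f₁) :- a :* (f₂ :- f₂₁)) :+ (b :* (f₁ :- f) :- (:- a) :* (f₁₂ :- f₁₂₁))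
             := a :* (f :- f₁ :- f₂ :+ f₂₁ :+ f₁₂ :- f₁₂₁)) refl a b f (s i f) (s j f) (s j (s i f)) (s i (s j f)) (s i (s j (s i f))) ⟩
      a * antisymmetrised f ∎)
      where
      abc h k : Poly
      abc = a * b * (a + b)
      h = ∂ j (∂ i f)
      k = (a + b) * (f - s i f) - a * (s j f - s j (s i f))
      s-k : s i k ≈ b * (s i f - f) - - a * (s i (s j f) - s i (s j (s i f)))
      s-k = trans (s.sub-homo _ _) (+-cong
        (trans (s.*-homo _ _) (*-cong s-a+b (trans (s.sub-homo _ _) (+-congˡ (-‿cong (s-involutive i f))))))
        (-‿cong (trans (s.*-homo _ _) (*-cong (s-α i) (s.sub-homo _ _)))))

  ∂-braid : ∀ i p → ∂ i (∂ (suc i) (∂ i p)) ≈ ∂ (suc i) (∂ i (∂ (suc i) p))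
  ∂-braid i f = α-injective i (α-injective (suc i) (α+α-injective i (begin
    (a + b) * (b * (a * ∂ i (∂ (suc i) (∂ i f))))
      ≈⟨ solve 3 (λ a b d → (a :+ b) :* (b :* (a :* d)) := a :* b :* (a :+ b) :* d) refl a b _ ⟩
    a * b * (a + b) * ∂ i (∂ (suc i) (∂ i f))
      ≈⟨ Braid.stage₃ i (suc i) (s-α-next i) (s-α-prev i) f ⟩
    f - s i f - s (suc i) f + s (suc i) (s i f) + s i (s (suc i) f) - s i (s (suc i) (s i f))
      ≈⟨ +-congˡ (-‿cong (s-braid i f)) ⟩
    f - s i f - s (suc i) f + s (suc i) (s i f) + s i (s (suc i) f) - s (suc i) (s i (s (suc i) f))
      ≈⟨ solve 6 (λ f f₁ f₂ f₂₁ f₁₂ g → f :- f₁ :- f₂ :+ f₂₁ :+ f₁₂ :- g := f :- f₂ :- f₁ :+ f₁₂ :+ f₂₁ :- g) refl f (s i f) (s (suc i) f) (s (suc i) (s i f)) (s i (s (suc i) f)) _ ⟩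
    f - s (suc i) f - s i f + s i (s (suc i) f) + s (suc i) (s i f) - s (suc i) (s i (s (suc i) f))
      ≈⟨ Braid.stage₃ (suc i) i (trans (s-α-prev i) (+-comm a b)) (trans (s-α-next i) (+-comm a b)) f ⟨
    b * a * (b + a) * ∂ (suc i) (∂ i (∂ (suc i) f))
      ≈⟨ solve 3 (λ a b d → b :* a :* (b :+ a) :* d := (a :+ b) :* (b :* (a :* d))) refl a b _ ⟩
    (a + b) * (b * (a * ∂ (suc i) (∂ i (∂ (suc i) f)))) ∎)))
    where
    a b : Poly
    a = α i
    b = α (suc i)

  ∂-X : ∀ i → ∂ i (X i) ≈ 1#
  ∂-X i = α-injective i (trans (α*∂ i (X i)) (trans (+-congˡ (-‿cong (s-X-≡ i i (sFun-left i)))) (sym (*-identityʳ (α i)))))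

  ∂-X-suc : ∀ i → ∂ i (X (suc i)) ≈ - 1#
  ∂-X-suc i = α-injective i (trans (α*∂ i (X (suc i))) (trans (+-congˡ (-‿cong (s-X-≡ i (suc i) (sFun-right i))))
    (solve 2 (λ x y → y :- x := (x :- y) :* (:- con (+ 1))) refl (X i) (X (suc i)))))

  ∂-X-other : ∀ {i k} → k ≢ i → k ≢ suc i → ∂ i (X k) ≈ 0#
  ∂-X-other {i} {k} p q = ∂-sym i (s-X-≡ i k (sFun-other p q))

  word : List ℕ → Poly → Poly
  word [] p = p
  word (i ∷ w) p = ∂ i (word w p)

  word-Defs : ∀ w p → word w p ≡ Defs.applyWord K w p
  word-Defs [] p = ≡.refl
  word-Defs (i ∷ w) p = ≡.trans (∂-Defs i _) (≡.cong (Defs.∂ K i) (word-Defs w p))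

  word-cong : ∀ w {p r} → p ≈ r → word w p ≈ word w r
  word-cong [] p≈r = p≈r
  word-cong (i ∷ w) p≈r = ∂-cong i (word-cong w p≈r)

  word-+ : ∀ w p r → word w (p + r) ≈ word w p + word w r
  word-+ [] p r = refl
  word-+ (i ∷ w) p r = trans (∂-cong i (word-+ w p r)) (∂-+ i _ _)

  word-0 : ∀ w → word w 0# ≈ 0#
  word-0 [] = refl
  word-0 (i ∷ w) = trans (∂-cong i (word-0 w)) (∂-0 i)

  word-++ : ∀ w w′ p → word (w ++ w′) p ≡ word w (word w′ p)
  word-++ [] w′ p = ≡.refl
  word-++ (i ∷ w) w′ p = ≡.cong (∂ i) (word-++ w w′ p)

  Symmetric : List ℕ → Poly → Set _
  Symmetric w p = All (λ i → s i p ≈ p) w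

  word-*-sym : ∀ w {p} r → Symmetric w p → word w (p * r) ≈ p * word w r
  word-*-sym [] r [] = refl
  word-*-sym (i ∷ w) r (sp ∷ sps) = trans (∂-cong i (word-*-sym w r sps)) (∂-*-sym i _ sp)

  C-sym : ∀ w x → Symmetric w (C x)
  C-sym [] x = []
  C-sym (i ∷ w) x = s.C-homo x ∷ C-sym w x

  word-C : ∀ w x r → word w (C x * r) ≈ C x * word w r
  word-C w x r = word-*-sym w r (C-sym w x)

  opaque
    emb : ℕ → Poly → Poly
    emb l = sub (λ k → X (l ℕ.+ k))

    emb-isHom : ∀ l → IsHom (emb l)
    emb-isHom l = sub-isHom _

    emb-X : ∀ l k → emb l (X k) ≈ X (l ℕ.+ k)
    emb-X l k = sub-X _ k

  module emb {l} = IsHom (emb-isHom l)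

  s-emb : ∀ l i p → emb l (s i p) ≈ s (l ℕ.+ i) (emb l p)
  s-emb l i = hom-unique (∘-isHom (emb-isHom l) (s-isHom i)) (∘-isHom (s-isHom (l ℕ.+ i)) (emb-isHom l))
    λ k → trans (emb.cong (s-X i k)) (trans (emb-X l _) (sym (trans (s.cong (emb-X l k)) (s-X-≡ (l ℕ.+ i) (l ℕ.+ k) (sFun-+ l i k)))))

  emb-α : ∀ l i → emb l (α i) ≈ α (l ℕ.+ i)
  emb-α l i = trans (emb.sub-homo _ _) (+-cong (emb-X l i) (-‿cong (trans (emb-X l (suc i)) (reflexive (≡.cong X (ℕₚ.+-suc l i))))))

  ∂-emb : ∀ l i p → ∂ (l ℕ.+ i) (emb l p) ≈ emb l (∂ i p)
  ∂-emb l i = ∂-hom (emb-isHom l) i (l ℕ.+ i) (s-emb l i) (emb-α l i)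

  word-emb : ∀ l w p → word (map (l ℕ.+_) w) (emb l p) ≈ emb l (word w p)
  word-emb l [] p = refl
  word-emb l (i ∷ w) p = trans (∂-cong (l ℕ.+ i) (word-emb l w p)) (∂-emb l i _)

  s-emb-below : ∀ {l k} → suc k ℕ.< l → ∀ p → s k (emb l p) ≈ emb l p
  s-emb-below {l} {k} 1+k<l = hom-unique (∘-isHom (s-isHom k) (emb-isHom l)) (emb-isHom l)
    λ m → trans (s.cong (emb-X l m)) (trans (s-X-≡ k (l ℕ.+ m) (sFun-other
      (ℕₚ.<⇒≢ (ℕₚ.<-≤-trans (ℕₚ.<-trans (ℕₚ.n<1+n k) 1+k<l) (ℕₚ.m≤m+n l m)) ∘ ≡.sym)
      (ℕₚ.<⇒≢ (ℕₚ.<-≤-trans 1+k<l (ℕₚ.m≤m+n l m)) ∘ ≡.sym))) (sym (emb-X l m)))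

-- Ascents, inversions and permutations as functions

<⇒<ᵇ-true : ∀ {m n} → m < n → (m <ᵇ n) ≡ true
<⇒<ᵇ-true {m} {n} m<n with m <ᵇ n in eq
... | true = ≡.refl
... | false = ⊥-elim (ℕₚ.<⇒≱ m<n (<ᵇ-false eq))

≥⇒<ᵇ-false : ∀ {m n} → n ≤ m → (m <ᵇ n) ≡ false
≥⇒<ᵇ-false {m} {n} n≤m with m <ᵇ n in eq
... | true = ⊥-elim (ℕₚ.<⇒≱ (<ᵇ-true eq) n≤m)
... | false = ≡.refl

firstAscent : (ℕ → ℕ) → List ℕ → Maybe ℕ
firstAscent w [] = nothing
firstAscent w (i ∷ is) = if w i <ᵇ w (suc i) then just i else firstAscent w is

-- The left-hand side of ascent-go is the local function go of Defs.ascent, which has no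
-- name outside its where block; it is inferred from its use in ascent-firstAscent.
mutual
  ascent-go : ∀ (N : ℕ) (w : ℕ → ℕ) (is : List ℕ) → _ ≡ firstAscent w is

  ascent-firstAscent : ∀ N w → Defs.ascent N w ≡ firstAscent w (upTo (N ∸ 1))
  ascent-firstAscent N w with upTo (N ∸ 1)
  ... | is = ascent-go N w is

  ascent-go N w [] = ≡.refl
  ascent-go N w (i ∷ is) rewrite ascent-go N w is = ≡.refl

firstAscent-just : ∀ w f M {i} → firstAscent w (applyUpTo f M) ≡ just i →
  (∃[ k ] (k < M × f k ≡ i)) × w i < w (suc i)
firstAscent-just w f (suc M) eq with w (f 0) <ᵇ w (suc (f 0)) in lt
firstAscent-just w f (suc M) ≡.refl | true = (0 , s≤s z≤n , ≡.refl) , <ᵇ-true lt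
firstAscent-just w f (suc M) eq | false with firstAscent-just w (f ∘ suc) M eq
... | (k , k<M , fk≡i) , asc = (suc k , s≤s k<M , fk≡i) , asc

firstAscent-nothing : ∀ w f M → firstAscent w (applyUpTo f M) ≡ nothing → ∀ k → k < M → w (suc (f k)) ≤ w (f k)
firstAscent-nothing w f (suc M) eq k k<M with w (f 0) <ᵇ w (suc (f 0)) in lt
firstAscent-nothing w f (suc M) eq zero k<M | false = <ᵇ-false lt
firstAscent-nothing w f (suc M) eq (suc k) (s≤s k<M) | false = firstAscent-nothing w (f ∘ suc) M eq k k<M

firstAscent-cong : ∀ {w w′} f M → (∀ k → k < M → w (f k) ≡ w′ (f k) × w (suc (f k)) ≡ w′ (suc (f k))) →
  firstAscent w (applyUpTo f M) ≡ firstAscent w′ (applyUpTo f M)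
firstAscent-cong f zero eq = ≡.refl
firstAscent-cong {w} {w′} f (suc M) eq
  rewrite proj₁ (eq 0 (s≤s z≤n)) | proj₂ (eq 0 (s≤s z≤n)) | firstAscent-cong {w} {w′} (f ∘ suc) M (λ k k<M → eq (suc k) (s≤s k<M)) = ≡.refl

pred-< : ∀ {k N} → k < N ∸ 1 → suc k < N
pred-< {k} {suc N} k<N = s≤s k<N

<-pred : ∀ {k N} → suc k < N → k < N ∸ 1
<-pred {k} {suc N} (s≤s k<N) = k<N

count : ℕ → (ℕ → Bool) → ℕ
count zero P = 0
count (suc N) P = (if P 0 then 1 else 0) ℕ.+ count N (P ∘ suc)

inv : ℕ → (ℕ → ℕ) → ℕ
inv zero w = 0
inv (suc N) w = count N (λ j → w (suc j) <ᵇ w 0) ℕ.+ inv N (w ∘ suc)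

-- The binomial coefficient N choose 2, the length of the longest permutation of N letters.
tri : ℕ → ℕ
tri zero = 0
tri (suc N) = N ℕ.+ tri N

count-cong : ∀ N {P Q} → (∀ k → k < N → P k ≡ Q k) → count N P ≡ count N Q
count-cong zero eq = ≡.refl
count-cong (suc N) eq rewrite eq 0 (s≤s z≤n) = ≡.cong (_ ℕ.+_) (count-cong N (λ k k<N → eq (suc k) (s≤s k<N)))

inv-cong : ∀ N {w w′} → (∀ k → k < N → w k ≡ w′ k) → inv N w ≡ inv N w′
inv-cong zero eq = ≡.refl
inv-cong (suc N) eq = ≡.cong₂ ℕ._+_
  (count-cong N (λ k k<N → ≡.cong₂ _<ᵇ_ (eq (suc k) (s≤s k<N)) (eq 0 (s≤s z≤n))))
  (inv-cong N (λ k k<N → eq (suc k) (s≤s k<N)))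

sFun-zero-2+ : ∀ k → sFun 0 (suc (suc k)) ≡ suc (suc k)
sFun-zero-2+ k = sFun-other {0} (λ ()) (λ ())

count-swap : ∀ N i P → suc i < N → count N (P ∘ sFun i) ≡ count N P
count-swap (suc zero) zero P (s≤s ())
count-swap (suc (suc N)) zero P _ rewrite sFun-left 0 | sFun-right 0 =
  ≡.trans (≡.cong (λ t → b 1 ℕ.+ (b 0 ℕ.+ t)) (count-cong N (λ k _ → ≡.cong P (sFun-zero-2+ k))))
    (x∙yz≈y∙xz (b 1) (b 0) (count N (P ∘ suc ∘ suc)))
  where
  b : ℕ → ℕ
  b k = if P k then 1 else 0
count-swap (suc N) (suc i) P (s≤s 1+i<N) rewrite sFun-other {suc i} {0} (λ ()) (λ ()) =
  ≡.cong (_ ℕ.+_) (≡.trans (count-cong N (λ k _ → ≡.cong P (sFun-+ 1 i k))) (count-swap N i (P ∘ suc) 1+i<N))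

-- Only the exchanged pair changes its order. The inversions of these two positions with later ones
-- trade places, and an earlier position sees the same values as before.
inv-swap : ∀ N i w → suc i < N → w i < w (suc i) → inv N (w ∘ sFun i) ≡ suc (inv N w)
inv-swap (suc zero) zero w (s≤s ()) _
inv-swap (suc (suc N)) zero w _ asc
  rewrite sFun-left 0 | sFun-right 0 | <⇒<ᵇ-true asc | ≥⇒<ᵇ-false (ℕₚ.<⇒≤ asc)
  | count-cong N {λ j → w (sFun 0 (suc (suc j))) <ᵇ w 1} {λ j → w (suc (suc j)) <ᵇ w 1} (λ k _ → ≡.cong (λ m → w m <ᵇ w 1) (sFun-zero-2+ k))
  | count-cong N {λ j → w (sFun 0 (suc (suc j))) <ᵇ w 0} {λ j → w (suc (suc j)) <ᵇ w 0} (λ k _ → ≡.cong (λ m → w m <ᵇ w 0) (sFun-zero-2+ k))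
  | inv-cong N {λ k → w (sFun 0 (suc (suc k)))} {λ k → w (suc (suc k))} (λ k _ → ≡.cong w (sFun-zero-2+ k))
  = ≡.cong suc (x∙yz≈y∙xz c₁ c₀ (inv N (w ∘ suc ∘ suc)))
  where
  c₀ c₁ : ℕ
  c₀ = count N (λ j → w (suc (suc j)) <ᵇ w 0)
  c₁ = count N (λ j → w (suc (suc j)) <ᵇ w 1)
inv-swap (suc N) (suc i) w (s≤s 1+i<N) asc rewrite sFun-other {suc i} {0} (λ ()) (λ ()) =
  ≡.trans (≡.cong₂ ℕ._+_
      (≡.trans (count-cong N (λ k _ → ≡.cong (λ m → w m <ᵇ w 0) (sFun-+ 1 i k))) (count-swap N i (λ k → w (suc k) <ᵇ w 0) 1+i<N))
      (≡.trans (inv-cong N (λ k _ → ≡.cong w (sFun-+ 1 i k))) (inv-swap N i (w ∘ suc) 1+i<N asc)))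
    (ℕₚ.+-suc (count N (λ j → w (suc j) <ᵇ w 0)) _)

count≤ : ∀ N P → count N P ≤ N
count≤ zero P = z≤n
count≤ (suc N) P with P 0
... | true = s≤s (count≤ N (P ∘ suc))
... | false = ℕₚ.≤-trans (count≤ N (P ∘ suc)) (ℕₚ.n≤1+n N)

inv≤tri : ∀ N w → inv N w ≤ tri N
inv≤tri zero w = z≤n
inv≤tri (suc N) w = ℕₚ.+-mono-≤ (count≤ N _) (inv≤tri N (w ∘ suc))

count-all : ∀ N P → (∀ k → k < N → P k ≡ true) → count N P ≡ N
count-all zero P eq = ≡.refl
count-all (suc N) P eq rewrite eq 0 (s≤s z≤n) = ≡.cong suc (count-all N (P ∘ suc) (λ k k<N → eq (suc k) (s≤s k<N)))

Decreasing : ℕ → (ℕ → ℕ) → Set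
Decreasing N w = ∀ i → suc i < N → w (suc i) < w i

inv-decreasing : ∀ N w → Decreasing N w → inv N w ≡ tri N
inv-decreasing zero w dec = ≡.refl
inv-decreasing (suc N) w dec = ≡.cong₂ ℕ._+_
  (count-all N _ (λ k k<N → <⇒<ᵇ-true (below k k<N)))
  (inv-decreasing N (w ∘ suc) (λ i 1+i<N → dec (suc i) (s≤s 1+i<N)))
  where
  below : ∀ k → k < N → w (suc k) < w 0
  below zero 0<N = dec 0 (s≤s 0<N)
  below (suc k) 1+k<N = ℕₚ.<-trans (dec (suc k) (s≤s 1+k<N)) (below k (ℕₚ.<-trans (ℕₚ.n<1+n k) 1+k<N))

tri≤square : ∀ N → tri N ≤ N ℕ.* N
tri≤square zero = z≤n
tri≤square (suc N) = ℕₚ.≤-trans (ℕₚ.+-mono-≤ (ℕₚ.n≤1+n N) (tri≤square N))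
  (ℕₚ.+-monoʳ-≤ (suc N) (ℕₚ.*-monoʳ-≤ N (ℕₚ.n≤1+n N)))

-- Arguments from N on are left free, so that one function can serve for several N. Surjectivity
-- follows from the two fields by the pigeonhole principle.
record Perm (N : ℕ) (w : ℕ → ℕ) : Set where
  field
    injective : ∀ {a b} → a < N → b < N → w a ≡ w b → a ≡ b
    bounded : ∀ {a} → a < N → w a < N

sFun-< : ∀ {i k N} → suc i < N → k < N → sFun i k < N
sFun-< {i} {k} 1+i<N k<N with sView i k
... | left rewrite sFun-left i = 1+i<N
... | right rewrite sFun-right i = ℕₚ.<-trans (ℕₚ.n<1+n i) 1+i<N
... | other p q rewrite sFun-other p q = k<N

Perm-swap : ∀ {N w i} → suc i < N → Perm N w → Perm N (w ∘ sFun i)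
Perm-swap {N} {w} {i} 1+i<N π = record
  { injective = λ {a} {b} a<N b<N eq → ≡.trans (≡.sym (sFun-involutive i a))
      (≡.trans (≡.cong (sFun i) (injective (sFun-< 1+i<N a<N) (sFun-< 1+i<N b<N) eq)) (sFun-involutive i b))
  ; bounded = λ a<N → bounded (sFun-< 1+i<N a<N) }
  where open Perm π

Perm-≢ : ∀ {N w i} → Perm N w → suc i < N → w i ≢ w (suc i)
Perm-≢ {i = i} π 1+i<N eq = ℕₚ.1+n≢n (≡.sym (Perm.injective π (ℕₚ.<-trans (ℕₚ.n<1+n i) 1+i<N) 1+i<N eq))

-- Induction from the left end gives k ≤ w k, and induction from the right end gives w k ≤ k.
increasing-id : ∀ {N w} → Perm N w → (∀ i → suc i < N → w i < w (suc i)) → ∀ k → k < N → w k ≡ k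
increasing-id {N} {w} π inc k k<N = ℕₚ.≤-antisym
  (ℕₚ.+-cancelʳ-≤ (suc (N ∸ suc k)) (w k) k (≡.subst (w k ℕ.+ suc (N ∸ suc k) ≤_) (≡.sym split) (above (N ∸ suc k) k (≡.sym split))))
  (below k k<N)
  where
  below : ∀ k → k < N → k ≤ w k
  below zero _ = z≤n
  below (suc k) 1+k<N = ℕₚ.≤-<-trans (below k (ℕₚ.<-trans (ℕₚ.n<1+n k) 1+k<N)) (inc k 1+k<N)
  above : ∀ d k → N ≡ k ℕ.+ suc d → w k ℕ.+ suc d ≤ N
  above zero k N≡ rewrite ℕₚ.+-comm (w k) 1 =
    Perm.bounded π (≡.subst (k <_) (≡.sym (≡.trans N≡ (ℕₚ.+-comm k 1))) (ℕₚ.n<1+n k))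
  above (suc d) k N≡ = ℕₚ.≤-trans (ℕₚ.≤-reflexive (ℕₚ.+-suc (w k) (suc d)))
    (ℕₚ.≤-trans (ℕₚ.+-monoˡ-≤ (suc d) (inc k (≡.subst (suc k <_) (≡.sym N≡′) (ℕₚ.m<m+n (suc k) (s≤s z≤n)))))
      (above d (suc k) N≡′))
    where
    N≡′ : N ≡ suc k ℕ.+ suc d
    N≡′ = ≡.trans N≡ (ℕₚ.+-suc k (suc d))
  split : k ℕ.+ suc (N ∸ suc k) ≡ N
  split = ≡.trans (ℕₚ.+-suc k (N ∸ suc k)) (ℕₚ.m+[n∸m]≡n k<N)

descent? : ∀ N (w : ℕ → ℕ) → Dec (∃[ i ] (i < N ∸ 1 × w (suc i) < w i))
descent? N w = ℕₚ.anyUpTo? (λ i → w (suc i) ℕ.<? w i) (N ∸ 1)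

no-descent-id : ∀ {N w} → Perm N w → ¬ (∃[ i ] (i < N ∸ 1 × w (suc i) < w i)) → ∀ k → k < N → w k ≡ k
no-descent-id {N} {w} π none = increasing-id {N} {w} π λ i 1+i<N →
  ℕₚ.≤∧≢⇒< {w i} {w (suc i)} (ℕₚ.≮⇒≥ λ desc → none (i , <-pred {i} {N} 1+i<N , desc)) (Perm-≢ {N} {w} π 1+i<N)

no-ascent-decreasing : ∀ {N w} → Perm N w → (∀ i → suc i < N → w (suc i) ≤ w i) → Decreasing N w
no-ascent-decreasing {N} {w} π none i 1+i<N = ℕₚ.≤∧≢⇒< (none i 1+i<N) (Perm-≢ {N} {w} π 1+i<N ∘ ≡.sym)

inv-descent : ∀ N i w → suc i < N → w (suc i) < w i → inv N w ≡ suc (inv N (w ∘ sFun i))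
inv-descent N i w 1+i<N desc = ≡.trans (inv-cong N (λ k _ → ≡.cong w (≡.sym (sFun-involutive i k))))
  (inv-swap N i (w ∘ sFun i) 1+i<N (≡.subst₂ _<_ (≡.cong w (≡.sym (sFun-left i))) (≡.cong w (≡.sym (sFun-right i))) desc))

inv-zero-id : ∀ {N w} → Perm N w → inv N w ≡ 0 → ∀ k → k < N → w k ≡ k
inv-zero-id {N} {w} π inv≡0 = no-descent-id {N} {w} π λ { (i , i<N-1 , desc) →
  ℕₚ.1+n≢0 (≡.trans (≡.sym (inv-descent N i w (pred-< i<N-1) desc)) inv≡0) }

longest : ℕ → ℕ → ℕ
longest N k = N ∸ 1 ∸ k

longest-decreasing : ∀ N → Decreasing N (longest N)
longest-decreasing (suc N) i (s≤s 1+i≤N) = ℕₚ.∸-monoʳ-< (ℕₚ.n<1+n i) 1+i≤N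

Perm-longest : ∀ N → Perm N (longest N)
Perm-longest zero = record { injective = λ () ; bounded = λ () }
Perm-longest (suc N) = record
  { injective = λ { (s≤s a≤N) (s≤s b≤N) eq → ℕₚ.∸-cancelˡ-≡ a≤N b≤N eq }
  ; bounded = λ {a} _ → s≤s (ℕₚ.m∸n≤m N a) }

data Position (i : ℕ) : ℕ → Set where
  same : Position i i
  next : Position i (suc i)
  prev : ∀ {j} → i ≡ suc j → Position i j
  far : ∀ {j} → Far i j → Position i j

position : ∀ i j → Position i j
position i j with i ℕ.≟ j | j ℕ.≟ suc i | i ℕ.≟ suc j
... | yes ≡.refl | _ | _ = same
... | no _ | yes ≡.refl | _ = next
... | no _ | no _ | yes eq = prev eq
... | no i≢j | no j≢1+i | no i≢1+j = far (i≢j , i≢1+j , j≢1+i ∘ ≡.sym)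

-- Independence of the path in the weak order; reduced words

module Transition {c ℓ} (K : CommutativeRing c ℓ) where
  open NilCoxeter K public
  open CommutativeRing PR
  open SetoidReasoning setoid

  -- climb follows a path of ascents from w to the longest permutation. That the result does not
  -- depend on the path (exchange) needs only the nil-Coxeter relations, so F is arbitrary; F = x^δ
  -- gives 𝔖_w and w = id gives ∂_{w₀} F.
  climb : ℕ → ℕ → (ℕ → ℕ) → Poly → Poly
  climb N zero w F = F
  climb N (suc fuel) w F = maybe (λ i → ∂ i (climb N fuel (w ∘ sFun i) F)) F (firstAscent w (upTo (N ∸ 1)))

  schubF-climb : ∀ N fuel w → Defs.schubF K N fuel w ≡ climb N fuel w (Defs.xδ K N)
  schubF-climb N zero w = ≡.refl
  schubF-climb N (suc fuel) w rewrite ascent-firstAscent N w with firstAscent w (upTo (N ∸ 1))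
  ... | nothing = ≡.refl
  ... | just i = ≡.trans (≡.cong (Defs.∂ K i) (schubF-climb N fuel (w ∘ sFun i))) (≡.sym (∂-Defs i _))

  firstAscent-≗ : ∀ N {w w′} → (∀ k → k < N → w k ≡ w′ k) →
    firstAscent w (upTo (N ∸ 1)) ≡ firstAscent w′ (upTo (N ∸ 1))
  firstAscent-≗ N {w} {w′} eq = firstAscent-cong {w} {w′} id (N ∸ 1)
    (λ k k<N-1 → eq k (ℕₚ.<-trans (ℕₚ.n<1+n k) (pred-< k<N-1)) , eq (suc k) (pred-< k<N-1))

  climb-cong : ∀ N fuel {w w′} F → (∀ k → k < N → w k ≡ w′ k) → climb N fuel w F ≈ climb N fuel w′ F
  climb-cong N zero F eq = refl
  climb-cong N (suc fuel) {w} {w′} F eq rewrite ≡.sym (firstAscent-≗ N {w} {w′} eq)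
    with firstAscent w (upTo (N ∸ 1)) in e
  ... | nothing = refl
  ... | just a with firstAscent-just w id (N ∸ 1) e
  ...   | (_ , k<N-1 , ≡.refl) , _ = ∂-cong a (climb-cong N fuel F (λ k k<N → eq (sFun a k) (sFun-< (pred-< k<N-1) k<N)))

  Ascent : ℕ → (ℕ → ℕ) → ℕ → Set
  Ascent N w i = suc i < N × w i < w (suc i)

  firstAscent-Ascent : ∀ N w {i} → firstAscent w (upTo (N ∸ 1)) ≡ just i → Ascent N w i
  firstAscent-Ascent N w eq with firstAscent-just w id (N ∸ 1) eq
  ... | (_ , k<N-1 , ≡.refl) , asc = pred-< k<N-1 , asc

  private
    -- The first ascent, which `climb` would choose, may be replaced by any ascent i. The number k
    -- bounds the inversions that w still lacks and is therefore enough fuel; on the right one step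
    -- is already spent, hence `k ≤ suc f′`.
    Exchange : ℕ → ℕ → Poly → Set _
    Exchange N k F = ∀ w i f f′ → Ascent N w i → tri N ≤ inv N w ℕ.+ k → k ≤ f → k ≤ suc f′ →
      climb N f w F ≈ ∂ i (climb N f′ (w ∘ sFun i) F)

    irrelevance : ∀ N k F → Exchange N k F → ∀ w f f′ → tri N ≤ inv N w ℕ.+ k → k ≤ f → k ≤ f′ →
      climb N f w F ≈ climb N f′ w F
    irrelevance N k F E w f f′ bound k≤f k≤f′ with firstAscent w (upTo (N ∸ 1)) in eq
    ... | just i = trans (E w i f k (firstAscent-Ascent N w eq) bound k≤f (ℕₚ.n≤1+n k))
            (sym (E w i f′ k (firstAscent-Ascent N w eq) bound k≤f′ (ℕₚ.n≤1+n k)))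
    ... | nothing = trans (noAscent f) (sym (noAscent f′))
      where
      noAscent : ∀ f → climb N f w F ≈ F
      noAscent zero = refl
      noAscent (suc f) rewrite eq = refl

  Ascent-swap : ∀ N w i → Ascent N w i → ∀ k → tri N ≤ inv N w ℕ.+ suc k → tri N ≤ inv N (w ∘ sFun i) ℕ.+ k
  Ascent-swap N w i (1+i<N , asc) k bound rewrite inv-swap N i w 1+i<N asc | ℕₚ.+-suc (inv N w) k = bound

  Ascent-far : ∀ {N w i j} → Far i j → Ascent N w j → Ascent N (w ∘ sFun i) j
  Ascent-far {N} {w} {i} {j} (i≢j , i≢1+j , 1+i≢j) (1+j<N , asc) =
    1+j<N , ≡.subst₂ (λ a b → w a < w b) (≡.sym (sFun-other (i≢j ∘ ≡.sym) (1+i≢j ∘ ≡.sym)))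
      (≡.sym (sFun-other (i≢1+j ∘ ≡.sym) (i≢j ∘ ≡.sym ∘ ℕₚ.suc-injective))) asc

  -- Three consecutive increasing values span a hexagon in the weak order. Each step of its two
  -- sides, with letters aba and bab, is an ascent, so the braid relation can compare the two
  -- climbs.
  module _ (N : ℕ) (w : ℕ → ℕ) (a : ℕ) (asc₁ : Ascent N w a) (asc₂ : Ascent N w (suc a)) where
    private
      b : ℕ
      b = suc a
      w₀<w₁ : w a < w (suc a)
      w₀<w₁ = proj₂ asc₁
      w₁<w₂ : w (suc a) < w (suc (suc a))
      w₁<w₂ = proj₂ asc₂
      1+b<N : suc b < N
      1+b<N = proj₁ asc₂

    Ascent-ab : Ascent N (w ∘ sFun a) b
    Ascent-ab = 1+b<N , ≡.subst₂ (λ x y → w x < w y) (≡.sym (sFun-right a)) (≡.sym (sFun-2+ a)) (ℕₚ.<-trans w₀<w₁ w₁<w₂)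

    Ascent-aba : Ascent N (w ∘ sFun a ∘ sFun b) a
    Ascent-aba = proj₁ asc₁ , ≡.subst₂ (λ x y → w x < w y)
      (≡.sym (≡.trans (≡.cong (sFun a) (sFun-suc-self a)) (sFun-left a)))
      (≡.sym (≡.trans (≡.cong (sFun a) (sFun-left b)) (sFun-2+ a))) w₁<w₂

    Ascent-ba : Ascent N (w ∘ sFun b) a
    Ascent-ba = proj₁ asc₁ , ≡.subst₂ (λ x y → w x < w y) (≡.sym (sFun-suc-self a)) (≡.sym (sFun-left b)) (ℕₚ.<-trans w₀<w₁ w₁<w₂)

    Ascent-bab : Ascent N (w ∘ sFun b ∘ sFun a) b
    Ascent-bab = 1+b<N , ≡.subst₂ (λ x y → w x < w y)
      (≡.sym (≡.trans (≡.cong (sFun b) (sFun-right a)) (sFun-suc-self a)))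
      (≡.sym (≡.trans (≡.cong (sFun b) (sFun-2+ a)) (sFun-right b))) w₀<w₁

    module _ (F : Poly) (k : ℕ) (E : Exchange N k F) (bound : tri N ≤ inv N w ℕ.+ suc k) where
      private
        weaken : ∀ {w i} → Ascent N w i → tri N ≤ inv N w ℕ.+ k → tri N ≤ inv N (w ∘ sFun i) ℕ.+ k
        weaken {w} {i} asc bound = Ascent-swap N w i asc k (ℕₚ.≤-trans bound (ℕₚ.+-monoʳ-≤ (inv N w) (ℕₚ.n≤1+n k)))

      aba : ∀ f → k ≤ f → ∂ a (climb N f (w ∘ sFun a) F) ≈ ∂ a (∂ b (∂ a (climb N k (w ∘ sFun a ∘ sFun b ∘ sFun a) F)))
      aba f k≤f = ∂-cong a (trans (E _ b f k Ascent-ab bound₁ k≤f (ℕₚ.n≤1+n k))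
        (∂-cong b (E _ a k k Ascent-aba (weaken Ascent-ab bound₁) ℕₚ.≤-refl (ℕₚ.n≤1+n k))))
        where
        bound₁ : tri N ≤ inv N (w ∘ sFun a) ℕ.+ k
        bound₁ = Ascent-swap N w a asc₁ k bound

      bab : ∀ f → k ≤ f → ∂ b (climb N f (w ∘ sFun b) F) ≈ ∂ b (∂ a (∂ b (climb N k (w ∘ sFun b ∘ sFun a ∘ sFun b) F)))
      bab f k≤f = ∂-cong b (trans (E _ a f k Ascent-ba bound₁ k≤f (ℕₚ.n≤1+n k))
        (∂-cong a (E _ b k k Ascent-bab (weaken Ascent-ba bound₁) ℕₚ.≤-refl (ℕₚ.n≤1+n k))))
        where
        bound₁ : tri N ≤ inv N (w ∘ sFun b) ℕ.+ k
        bound₁ = Ascent-swap N w b asc₂ k bound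

      braid-paths : ∀ f f′ → k ≤ f → k ≤ f′ → ∂ a (climb N f (w ∘ sFun a) F) ≈ ∂ b (climb N f′ (w ∘ sFun b) F)
      braid-paths f f′ k≤f k≤f′ = begin
        ∂ a (climb N f (w ∘ sFun a) F)
          ≈⟨ aba f k≤f ⟩
        ∂ a (∂ b (∂ a (climb N k (w ∘ sFun a ∘ sFun b ∘ sFun a) F)))
          ≈⟨ ∂-cong a (∂-cong b (∂-cong a (climb-cong N k F (λ m _ → ≡.cong w (sFun-braid a m))))) ⟩
        ∂ a (∂ b (∂ a (climb N k (w ∘ sFun b ∘ sFun a ∘ sFun b) F)))
          ≈⟨ ∂-braid a _ ⟩
        ∂ b (∂ a (∂ b (climb N k (w ∘ sFun b ∘ sFun a ∘ sFun b) F)))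
          ≈⟨ bab f′ k≤f′ ⟨
        ∂ b (climb N f′ (w ∘ sFun b) F) ∎

  private
    -- Confluence by induction on the missing inversions: two distinct ascents from w are completed
    -- to a square when they are far apart and to a hexagon when they are adjacent, and ∂ satisfies
    -- the corresponding relation.
    exchange : ∀ N F k → Exchange N k F
    -- With no inversion missing, a further ascent would exceed the maximum `tri N`.
    exchange N F zero w i f f′ (1+i<N , asc) bound _ _ = ⊥-elim (ℕₚ.1+n≰n (ℕₚ.≤-trans
      (ℕₚ.≤-reflexive (≡.sym (inv-swap N i w 1+i<N asc)))
      (ℕₚ.≤-trans (inv≤tri N (w ∘ sFun i)) (≡.subst (tri N ≤_) (ℕₚ.+-identityʳ _) bound))))
    exchange N F (suc k) w i (suc f) f′ ascᵢ bound (s≤s k≤f) (s≤s k≤f′)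
      with firstAscent w (upTo (N ∸ 1)) in eq
    ... | nothing = ⊥-elim (ℕₚ.<⇒≱ (proj₂ ascᵢ) (firstAscent-nothing w id (N ∸ 1) eq i (<-pred (proj₁ ascᵢ))))
    ... | just a with firstAscent-Ascent N w eq | position a i
    ...   | ascₐ | same = ∂-cong a (irrelevance N k F (exchange N F k) (w ∘ sFun a) f f′ (Ascent-swap N w a ascₐ k bound) k≤f k≤f′)
    ...   | ascₐ | next = braid-paths N w a ascₐ ascᵢ F k (exchange N F k) bound f f′ k≤f k≤f′
    ...   | ascₐ | prev ≡.refl = sym (braid-paths N w i ascᵢ ascₐ F k (exchange N F k) bound f′ f k≤f′ k≤f)
    ...   | ascₐ | far a-i = begin
      ∂ a (climb N f (w ∘ sFun a) F)
        ≈⟨ ∂-cong a (exchange N F k _ i f k (Ascent-far {N} {w} a-i ascᵢ) (Ascent-swap N w a ascₐ k bound) k≤f (ℕₚ.n≤1+n k)) ⟩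
      ∂ a (∂ i (climb N k (w ∘ sFun a ∘ sFun i) F))
        ≈⟨ ∂-comm a-i _ ⟩
      ∂ i (∂ a (climb N k (w ∘ sFun a ∘ sFun i) F))
        ≈⟨ ∂-cong i (∂-cong a (climb-cong N k F (λ m _ → ≡.cong w (sFun-comm a-i m)))) ⟩
      ∂ i (∂ a (climb N k (w ∘ sFun i ∘ sFun a) F))
        ≈⟨ ∂-cong i (exchange N F k _ a f′ k (Ascent-far {N} {w} (Far-sym a-i) ascₐ) (Ascent-swap N w i ascᵢ k bound) k≤f′ (ℕₚ.n≤1+n k)) ⟨
      ∂ i (climb N f′ (w ∘ sFun i) F) ∎

  climbTop : ℕ → (ℕ → ℕ) → Poly → Poly
  climbTop N = climb N (N ℕ.* N)

  climbTop-cong : ∀ N {w w′} F → (∀ k → k < N → w k ≡ w′ k) → climbTop N w F ≈ climbTop N w′ F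
  climbTop-cong N = climb-cong N (N ℕ.* N)

  climbTop-ascent : ∀ N w i F → Ascent N w i → climbTop N w F ≈ ∂ i (climbTop N (w ∘ sFun i) F)
  climbTop-ascent N w i F asc = exchange N F (tri N) w i _ _ asc (ℕₚ.m≤n+m _ _) (tri≤square N)
    (ℕₚ.≤-trans (tri≤square N) (ℕₚ.n≤1+n _))

  climbTop-decreasing : ∀ N w F → Decreasing N w → climbTop N w F ≈ F
  climbTop-decreasing N w F dec = go (N ℕ.* N)
    where
    go : ∀ fuel → climb N fuel w F ≈ F
    go zero = refl
    go (suc fuel) with firstAscent w (upTo (N ∸ 1)) in eq
    ... | nothing = refl
    ... | just i = ⊥-elim (ℕₚ.<-asym (proj₂ (firstAscent-Ascent N w eq)) (dec i (proj₁ (firstAscent-Ascent N w eq))))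

  ∂-climbTop-ascent : ∀ N w i F → Ascent N w i → ∂ i (climbTop N w F) ≈ 0#
  ∂-climbTop-ascent N w i F asc = trans (∂-cong i (climbTop-ascent N w i F asc)) (∂∂ i _)

  ∂-climbTop-descent : ∀ N w i F → suc i < N → w (suc i) < w i → ∂ i (climbTop N w F) ≈ climbTop N (w ∘ sFun i) F
  ∂-climbTop-descent N w i F 1+i<N desc = begin
    ∂ i (climbTop N w F)                         ≈⟨ ∂-cong i (climbTop-cong N F (λ k _ → ≡.cong w (≡.sym (sFun-involutive i k)))) ⟩
    ∂ i (climbTop N (w ∘ sFun i ∘ sFun i) F)     ≈⟨ climbTop-ascent N (w ∘ sFun i) i F
      (1+i<N , ≡.subst₂ (λ a b → w a < w b) (≡.sym (sFun-left i)) (≡.sym (sFun-right i)) desc) ⟨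
    climbTop N (w ∘ sFun i) F                    ∎

  Letters : ℕ → List ℕ → Set
  Letters N = All (λ i → suc i < N)

  -- Read from the right, a letter at a descent of w moves to a shorter permutation, and a letter at
  -- an ascent repeats an operator and gives zero by `∂∂`. The letters used are thus counted exactly
  -- by the inversions lost.
  word-climbTop : ∀ N a → Letters N a →
    (∃[ w ] (Perm N w × (inv N w ℕ.+ length a ≡ tri N) × (∀ F → word a F ≈ climbTop N w F))) ⊎ (∀ F → word a F ≈ 0#)
  word-climbTop N [] [] = inj₁ (longest N , Perm-longest N , ≡.trans (ℕₚ.+-identityʳ _) (inv-decreasing N _ (longest-decreasing N))
    , λ F → sym (climbTop-decreasing N (longest N) F (longest-decreasing N)))
  word-climbTop N (i ∷ a) (1+i<N ∷ as) with word-climbTop N a as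
  ... | inj₂ zeros = inj₂ λ F → trans (∂-cong i (zeros F)) (∂-0 i)
  ... | inj₁ (w , π , lengths , eq) with ℕₚ.<-cmp (w i) (w (suc i))
  ...   | tri< asc _ _ = inj₂ λ F → trans (∂-cong i (eq F)) (∂-climbTop-ascent N w i F (1+i<N , asc))
  ...   | tri≈ _ e _ = ⊥-elim (Perm-≢ {N} {w} π 1+i<N e)
  ...   | tri> _ _ desc = inj₁ (w ∘ sFun i , Perm-swap 1+i<N π
          , ≡.trans (ℕₚ.+-suc _ (length a)) (≡.trans (≡.cong (ℕ._+ length a) (≡.sym (inv-descent N i w 1+i<N desc))) lengths)
          , λ F → trans (∂-cong i (eq F)) (∂-climbTop-descent N w i F 1+i<N desc))

  -- The descents that lead from w down to the identity supply the letters of g.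
  climbTop-extend : ∀ N k w → Perm N w → inv N w ≤ k → ∃[ g ] (∀ F → climbTop N id F ≈ word g (climbTop N w F))
  climbTop-extend N k w π inv≤k with descent? N w
  ... | no none = [] , λ F → climbTop-cong N F (λ m m<N → ≡.sym (no-descent-id {N} {w} π none m m<N))
  climbTop-extend N zero w π inv≤0 | yes (i , i<N-1 , desc) rewrite inv-descent N i w (pred-< i<N-1) desc with () ← inv≤0
  climbTop-extend N (suc k) w π inv≤k | yes (i , i<N-1 , desc)
    with climbTop-extend N k (w ∘ sFun i) (Perm-swap (pred-< i<N-1) π)
           (ℕₚ.≤-pred (≡.subst (_≤ suc k) (inv-descent N i w (pred-< i<N-1) desc) inv≤k))
  ... | g , eq = g ++ (i ∷ []) , λ F → trans (eq F) (trans
    (word-cong g (sym (∂-climbTop-descent N w i F (pred-< i<N-1) desc))) (sym (reflexive (word-++ g (i ∷ []) _))))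

  -- The source of all factorisations of ∂_{w₀}: one polynomial F₀ not sent to zero excludes the
  -- second alternative of `word-climbTop`, and then the word can be completed on the left to one
  -- for the longest permutation.
  word-extend : ∀ N a → Letters N a → ∀ F₀ → ¬ (word a F₀ ≈ 0#) → ∃[ g ] (∀ F → climbTop N id F ≈ word g (word a F))
  word-extend N a as F₀ nonzero with word-climbTop N a as
  ... | inj₂ zeros = ⊥-elim (nonzero (zeros F₀))
  ... | inj₁ (w , π , _ , eq) with climbTop-extend N (inv N w) w π ℕₚ.≤-refl
  ...   | g , eq′ = g , λ F → trans (eq′ F) (word-cong g (sym (eq F)))

  word-longest : ∀ N a → Letters N a → length a ≡ tri N → ∀ F₀ → ¬ (word a F₀ ≈ 0#) → ∀ F → word a F ≈ climbTop N id F
  word-longest N a as full F₀ nonzero with word-climbTop N a as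
  ... | inj₂ zeros = ⊥-elim (nonzero (zeros F₀))
  ... | inj₁ (w , π , lengths , eq) = λ F → trans (eq F) (climbTop-cong N F (inv-zero-id {N} {w} π
        (ℕₚ.+-cancelʳ-≡ (length a) _ _ (≡.trans lengths (≡.sym full)))))

-- Homogeneous polynomials, ideals of linear forms, vanishing under words

module Homogeneity {c ℓ} (K : CommutativeRing c ℓ) where
  open Transition K public
  open CommutativeRing PR
  open SetoidReasoning setoid
  open IntegerSolver PR

  -- V says which variables may occur.
  data Hom (V : ℕ → Set) : ℕ → Poly → Set (c ⊔ ℓ) where
    hom-0 : ∀ {d} → Hom V d 0#
    hom-+ : ∀ {d p r} → Hom V d p → Hom V d r → Hom V d (p + r)
    hom-C : ∀ x → Hom V 0 (C x)
    hom-X : ∀ {d p} k → V k → Hom V d p → Hom V (suc d) (X k * p)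
    hom-≈ : ∀ {d p r} → p ≈ r → Hom V d p → Hom V d r

  Any : ℕ → Set
  Any _ = ⊤

  hom-mono : ∀ {V W d p} → (∀ k → V k → W k) → Hom V d p → Hom W d p
  hom-mono f hom-0 = hom-0
  hom-mono f (hom-+ h h′) = hom-+ (hom-mono f h) (hom-mono f h′)
  hom-mono f (hom-C x) = hom-C x
  hom-mono f (hom-X k v h) = hom-X k (f k v) (hom-mono f h)
  hom-mono f (hom-≈ e h) = hom-≈ e (hom-mono f h)

  hom-any : ∀ {V d p} → Hom V d p → Hom Any d p
  hom-any = hom-mono (λ _ _ → tt)

  hom-≡ : ∀ {V d e p} → d ≡ e → Hom V d p → Hom V e p
  hom-≡ ≡.refl h = h

  hom-var : ∀ {V} k → V k → Hom V 1 (X k)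
  hom-var k v = hom-≈ (*-identityʳ (X k)) (hom-X k v (hom-C _))

  hom-C* : ∀ {V d p} x → Hom V d p → Hom V d (C x * p)
  hom-C* x hom-0 = hom-≈ (sym (zeroʳ (C x))) hom-0
  hom-C* x (hom-+ h h′) = hom-≈ (sym (distribˡ (C x) _ _)) (hom-+ (hom-C* x h) (hom-C* x h′))
  hom-C* x (hom-C y) = hom-≈ (C-* x y) (hom-C (x 𝕂.* y))
  hom-C* x (hom-X k v h) = hom-≈ (solve 3 (λ a b p → a :* (b :* p) := b :* (a :* p)) refl (X k) (C x) _) (hom-X k v (hom-C* x h))
  hom-C* x (hom-≈ e h) = hom-≈ (*-congˡ e) (hom-C* x h)

  hom-* : ∀ {V d e p r} → Hom V d p → Hom V e r → Hom V (d ℕ.+ e) (p * r)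
  hom-* {r = r} hom-0 g = hom-≈ (sym (zeroˡ r)) hom-0
  hom-* {r = r} (hom-+ h h′) g = hom-≈ (sym (distribʳ r _ _)) (hom-+ (hom-* h g) (hom-* h′ g))
  hom-* (hom-C x) g = hom-C* x g
  hom-* {r = r} (hom-X k v h) g = hom-≈ (sym (*-assoc (X k) _ r)) (hom-X k v (hom-* h g))
  hom-* (hom-≈ e h) g = hom-≈ (*-congʳ e) (hom-* h g)

  hom-neg : ∀ {V d p} → Hom V d p → Hom V d (- p)
  hom-neg {p = p} h = hom-≈ (begin
    C (𝕂.- 𝕂.1#) * p    ≈⟨ *-congʳ (C-neg 𝕂.1#) ⟩
    - 1# * p            ≈⟨ solve 1 (λ p → (:- con (+ 1)) :* p := :- p) refl p ⟩
    - p                 ∎) (hom-C* (𝕂.- 𝕂.1#) h)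

  hom-minus : ∀ {V d p r} → Hom V d p → Hom V d r → Hom V d (p - r)
  hom-minus h h′ = hom-+ h (hom-neg h′)

  hom-pow : ∀ {V d p} n → Hom V d p → Hom V (n ℕ.* d) (Defs.pow PR p n)
  hom-pow zero h = hom-C _
  hom-pow (suc n) h = hom-* h (hom-pow n h)

  hom-pow-X : ∀ {V} n k → V k → Hom V n (Defs.pow PR (X k) n)
  hom-pow-X n k v = hom-≡ (ℕₚ.*-identityʳ n) (hom-pow n (hom-var k v))

  hom-map : ∀ {V W Φ} → IsHom Φ → (∀ k → V k → Hom W 1 (Φ (X k))) → ∀ {d p} → Hom V d p → Hom W d (Φ p)
  hom-map Φh ΦX hom-0 = hom-≈ (sym (IsHom.0-homo Φh)) hom-0
  hom-map Φh ΦX (hom-+ h h′) = hom-≈ (sym (IsHom.+-homo Φh _ _)) (hom-+ (hom-map Φh ΦX h) (hom-map Φh ΦX h′))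
  hom-map Φh ΦX (hom-C x) = hom-≈ (sym (IsHom.C-homo Φh x)) (hom-C x)
  hom-map Φh ΦX (hom-X k v h) = hom-≈ (sym (IsHom.*-homo Φh _ _)) (hom-* (ΦX k v) (hom-map Φh ΦX h))
  hom-map Φh ΦX (hom-≈ e h) = hom-≈ (IsHom.cong Φh e) (hom-map Φh ΦX h)

  ε : Poly → 𝕂.Carrier
  ε = ev (const 𝕂.0#)

  hom-const : ∀ {V p} → Hom V 0 p → p ≈ C (ε p)
  hom-const hom-0 = sym C-0
  hom-const (hom-+ {p = p} {r} h h′) = trans (+-cong (hom-const h) (hom-const h′))
    (trans (sym (C-+ _ _)) (C-cong (𝕂.sym (ev-+ _ p r))))
  hom-const (hom-C x) = C-cong (𝕂.sym (ev-C (const 𝕂.0#) x))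
  hom-const (hom-≈ e h) = trans (sym e) (trans (hom-const h) (C-cong (ev-cong _ e)))

  ε-X* : ∀ k p → ε (X k * p) 𝕂.≈ 𝕂.0#
  ε-X* k p = 𝕂.trans (ev-* _ (X k) p) (𝕂.trans (𝕂.*-congʳ (ev-X _ k)) (𝕂.zeroˡ _))

  ε-hom : ∀ {V d p} → Hom V (suc d) p → ε p 𝕂.≈ 𝕂.0#
  ε-hom hom-0 = 𝕂.refl
  ε-hom (hom-+ h h′) = 𝕂.trans (ev-+ _ _ _) (𝕂.trans (𝕂.+-cong (ε-hom h) (ε-hom h′)) (𝕂.+-identityˡ _))
  ε-hom (hom-X k v h) = ε-X* k _
  ε-hom (hom-≈ e h) = 𝕂.trans (ev-cong _ (sym e)) (ε-hom h)

  ∂-hom-0 : ∀ {V p} i → Hom V 0 p → ∂ i p ≈ 0#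
  ∂-hom-0 i h = trans (∂-cong i (hom-const h)) (∂-sym i (s.C-homo _))

  Closed : (ℕ → Set) → ℕ → Set
  Closed V i = ∀ k → V k → V (sFun i k)

  ∂-X-const : ∀ i k → ∃[ x ] (∂ i (X k) ≈ C x)
  ∂-X-const i k with sView i k
  ... | left = 𝕂.1# , ∂-X i
  ... | right = 𝕂.- 𝕂.1# , trans (∂-X-suc i) (sym (C-neg _))
  ... | other p q = 𝕂.0# , trans (∂-X-other p q) (sym C-0)

  hom-∂ : ∀ {V d p} i → Closed V i → Hom V (suc d) p → Hom V d (∂ i p)
  hom-∂ i cl hom-0 = hom-≈ (sym (∂-0 i)) hom-0
  hom-∂ i cl (hom-+ h h′) = hom-≈ (sym (∂-+ i _ _)) (hom-+ (hom-∂ i cl h) (hom-∂ i cl h′))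
  hom-∂ i cl (hom-≈ e h) = hom-≈ (∂-cong i e) (hom-∂ i cl h)
  hom-∂ {V} {d} i cl (hom-X {p = p} k v h) with ∂-X-const i k
  ... | x , ∂X≈x = hom-≈ (sym (leibniz i (X k) p)) (hom-+ (hom-≈ (*-congʳ (sym ∂X≈x)) (hom-C* x h)) (second h))
    where
    second : ∀ {d} → Hom V d p → Hom V d (s i (X k) * ∂ i p)
    second {zero} h = hom-≈ (sym (trans (*-congˡ (∂-hom-0 i h)) (zeroʳ _))) hom-0
    second {suc d} h = hom-≈ (*-congʳ (sym (s-X i k))) (hom-X (sFun i k) (cl k v) (hom-∂ i cl h))

  s-fixes : ∀ {V d p} i → (∀ k → V k → sFun i k ≡ k) → Hom V d p → s i p ≈ p
  s-fixes i fix hom-0 = s.0-homo {i}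
  s-fixes i fix (hom-+ h h′) = trans (s.+-homo _ _) (+-cong (s-fixes i fix h) (s-fixes i fix h′))
  s-fixes i fix (hom-C x) = s.C-homo x
  s-fixes i fix (hom-X k v h) = trans (s.*-homo _ _) (*-cong (s-X-≡ i k (fix k v)) (s-fixes i fix h))
  s-fixes i fix (hom-≈ e h) = trans (s.cong (sym e)) (trans (s-fixes i fix h) e)

  hom-word : ∀ {d p} w → Hom Any (length w ℕ.+ d) p → Hom Any d (word w p)
  hom-word [] h = h
  hom-word {d} (i ∷ w) h = hom-∂ i (λ _ _ → tt) (hom-word w (hom-≡ (≡.sym (ℕₚ.+-suc (length w) d)) h))

  -- Each letter lowers the degree by one, and the letter that meets a constant gives zero.
  word-low : ∀ {d p} w → d < length w → Hom Any d p → word w p ≈ 0#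
  word-low {d} {p} (i ∷ w) (s≤s d≤w) h with ℕₚ.m≤n⇒m<n∨m≡n d≤w
  ... | inj₁ d<w = trans (∂-cong i (word-low w d<w h)) (∂-0 i)
  ... | inj₂ ≡.refl = ∂-hom-0 i (hom-word w (hom-≡ (≡.sym (ℕₚ.+-identityʳ _)) h))

  -- G is meant to hold of linear forms only, so that d is the total degree.
  data Ideal (G : Poly → Set (c ⊔ ℓ)) : ℕ → Poly → Set (c ⊔ ℓ) where
    ideal-0 : ∀ {d} → Ideal G d 0#
    ideal-+ : ∀ {d p r} → Ideal G d p → Ideal G d r → Ideal G d (p + r)
    ideal-* : ∀ {d g h} → G g → Hom Any d h → Ideal G (suc d) (g * h)
    ideal-≈ : ∀ {d p r} → p ≈ r → Ideal G d p → Ideal G d r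

  ideal-≡ : ∀ {G d e p} → d ≡ e → Ideal G d p → Ideal G e p
  ideal-≡ ≡.refl I = I

  ideal-gen : ∀ {G g} → G g → Ideal G 1 g
  ideal-gen γ = ideal-≈ (*-identityʳ _) (ideal-* γ (hom-C _))

  ideal-hom : ∀ {G d e p h} → Hom Any e h → Ideal G d p → Ideal G (e ℕ.+ d) (h * p)
  ideal-hom {h = h} H ideal-0 = ideal-≈ (sym (zeroʳ h)) ideal-0
  ideal-hom {h = h} H (ideal-+ I I′) = ideal-≈ (sym (distribˡ h _ _)) (ideal-+ (ideal-hom H I) (ideal-hom H I′))
  ideal-hom {G} {e = e} {h = h} H (ideal-* {d} γ H′) = ideal-≡ (≡.sym (ℕₚ.+-suc e d))
    (ideal-≈ (solve 3 (λ g h h′ → g :* (h :* h′) := h :* (g :* h′)) refl _ h _) (ideal-* γ (hom-* H H′)))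
  ideal-hom H (ideal-≈ e I) = ideal-≈ (*-congˡ e) (ideal-hom H I)

  -- A product minus the product of the images telescopes into multiples of the differences x_k -
  -- θ(x_k). It serves twice, with θ setting the first variables to 0 and with θ sending x_k to q^k
  -- x_0; both times the functional in question annihilates the ideal.
  reduce : ∀ {V G θ} → IsHom θ → (∀ k → V k → Hom Any 1 (θ (X k))) → (∀ k → V k → Ideal G 1 (X k - θ (X k))) →
    ∀ {d p} → Hom V d p → Ideal G d (p - θ p)
  reduce {V} {G} {θ} θh θX θI = go
    where
    module θ = IsHom θh
    go : ∀ {d p} → Hom V d p → Ideal G d (p - θ p)
    go hom-0 = ideal-≈ (sym (trans (+-congˡ (-‿cong θ.0-homo)) (-‿inverseʳ 0#))) ideal-0
    go (hom-+ {p = p} {r} h h′) = ideal-≈ (begin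
      (p - θ p) + (r - θ r)    ≈⟨ solve 4 (λ p p′ r r′ → (p :- p′) :+ (r :- r′) := (p :+ r) :- (p′ :+ r′)) refl p (θ p) r (θ r) ⟩
      (p + r) - (θ p + θ r)    ≈⟨ +-congˡ (-‿cong (θ.+-homo p r)) ⟨
      (p + r) - θ (p + r)      ∎) (ideal-+ (go h) (go h′))
    go (hom-C x) = ideal-≈ (sym (trans (+-congˡ (-‿cong (θ.C-homo x))) (-‿inverseʳ (C x)))) ideal-0
    go (hom-X {d} {p} k v h) = ideal-≈ (begin
      p * (X k - θ (X k)) + θ (X k) * (p - θ p)
        ≈⟨ solve 4 (λ x x′ p p′ → p :* (x :- x′) :+ x′ :* (p :- p′) := x :* p :- x′ :* p′) refl (X k) (θ (X k)) p (θ p) ⟩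
      X k * p - θ (X k) * θ p
        ≈⟨ +-congˡ (-‿cong (θ.*-homo (X k) p)) ⟨
      X k * p - θ (X k * p) ∎)
      (ideal-+ (ideal-≡ (ℕₚ.+-comm d 1) (ideal-hom (hom-any h) (θI k v)))
               (ideal-hom (θX k v) (go h)))
    go (hom-≈ e h) = ideal-≈ (+-cong e (-‿cong (θ.cong e))) (go h)

  Killed : (ℕ → Set) → ℕ → Poly → Set ℓ
  Killed L zero p = ε p 𝕂.≈ 𝕂.0#
  Killed L (suc d) p = ∀ i → L i → Killed L d (∂ i p)

  killed-≡ : ∀ {L d e p} → d ≡ e → Killed L d p → Killed L e p
  killed-≡ ≡.refl k = k

  killed-≈ : ∀ {L} d {p r} → p ≈ r → Killed L d p → Killed L d r
  killed-≈ zero e k = 𝕂.trans (ev-cong _ (sym e)) k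
  killed-≈ (suc d) e k i l = killed-≈ d (∂-cong i e) (k i l)

  killed-0 : ∀ {L} d → Killed L d 0#
  killed-0 zero = 𝕂.refl
  killed-0 (suc d) i l = killed-≈ d (sym (∂-0 i)) (killed-0 d)

  killed-+ : ∀ {L} d {p r} → Killed L d p → Killed L d r → Killed L d (p + r)
  killed-+ zero k k′ = 𝕂.trans (ev-+ _ _ _) (𝕂.trans (𝕂.+-cong k k′) (𝕂.+-identityˡ _))
  killed-+ (suc d) k k′ i l = killed-≈ d (sym (∂-+ i _ _)) (killed-+ d (k i l) (k′ i l))

  killed-C* : ∀ {L} d x {p} → Killed L d p → Killed L d (C x * p)
  killed-C* zero x {p} k = 𝕂.trans (ev-* _ (C x) p) (𝕂.trans (𝕂.*-congˡ k) (𝕂.zeroʳ _))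
  killed-C* (suc d) x k i l = killed-≈ d (sym (∂-C i x _)) (killed-C* d x (k i l))

  killed-X* : ∀ {L} d k {p} → (∀ e → Killed L e p) → Killed L d (X k * p)
  killed-X* zero k kp = ε-X* k _
  killed-X* (suc d) k {p} kp i l with ∂-X-const i k
  ... | x , ∂X≈x = killed-≈ d (sym (trans (leibniz i (X k) p) (+-cong (*-congʳ ∂X≈x) (*-congʳ (s-X i k)))))
    (killed-+ d (killed-C* d x (kp d)) (killed-X* d (sFun i k) (λ e → kp (suc e) i l)))

  killed-* : ∀ {L V n h} d {p} → Hom V n h → (∀ e → Killed L e p) → Killed L d (h * p)
  killed-* d {p} hom-0 kp = killed-≈ d (sym (zeroˡ p)) (killed-0 d)
  killed-* d {p} (hom-+ h h′) kp = killed-≈ d (sym (distribʳ p _ _)) (killed-+ d (killed-* d h kp) (killed-* d h′ kp))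
  killed-* d (hom-C x) kp = killed-C* d x (kp d)
  killed-* d {p} (hom-X k v h) kp = killed-≈ d (sym (*-assoc (X k) _ p)) (killed-X* d k (λ e → killed-* e h kp))
  killed-* d (hom-≈ e h) kp = killed-≈ d (*-congʳ e) (killed-* d h kp)

  killed-word : ∀ {L} d w {p} → All L w → Killed L (length w ℕ.+ d) p → Killed L d (word w p)
  killed-word d [] [] k = k
  killed-word {L} d (i ∷ w) (l ∷ ls) k =
    killed-word (suc d) w ls (killed-≡ {L} (≡.sym (ℕₚ.+-suc (length w) d)) k) i l

-- Explicit words for the longest permutation

down : ℕ → List ℕ
down zero = []
down (suc k) = k ∷ down k

reverse-upTo : ∀ n → reverse (upTo n) ≡ down n
reverse-upTo zero = ≡.refl
reverse-upTo (suc n) = ≡.trans (≡.cong reverse (≡.sym (Listₚ.upTo-∷ʳ n)))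
  (≡.trans (Listₚ.reverse-++ (upTo n) (n ∷ [])) (≡.cong (n ∷_) (reverse-upTo n)))

down-∷ʳ : ∀ k → down (suc k) ≡ map suc (down k) ++ (0 ∷ [])
down-∷ʳ zero = ≡.refl
down-∷ʳ (suc k) = ≡.cong (suc k ∷_) (down-∷ʳ k)

length-down : ∀ k → length (down k) ≡ k
length-down zero = ≡.refl
length-down (suc k) = ≡.cong suc (length-down k)

down-letters : ∀ {N} k → k < N → All (λ i → suc i < N) (down k)
down-letters zero _ = []
down-letters (suc k) 1+k<N = 1+k<N ∷ down-letters k (ℕₚ.<-trans (ℕₚ.n<1+n k) 1+k<N)

longestWord : ℕ → List ℕ
longestWord zero = []
longestWord (suc n) = longestWord n ++ down n

longestWord-Defs : ∀ n → concatMap (λ r → reverse (upTo (suc r))) (upTo (n ∸ 1)) ≡ longestWord n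
longestWord-Defs zero = ≡.refl
longestWord-Defs (suc zero) = ≡.refl
longestWord-Defs (suc (suc n)) = ≡.trans (≡.cong (concatMap _) (≡.sym (Listₚ.upTo-∷ʳ n)))
  (≡.trans (Listₚ.concatMap-++ _ (upTo n) (n ∷ []))
    (≡.cong₂ _++_ (longestWord-Defs (suc n)) (≡.trans (Listₚ.++-identityʳ _) (reverse-upTo (suc n)))))

length-longestWord : ∀ n → length (longestWord n) ≡ tri n
length-longestWord zero = ≡.refl
length-longestWord (suc n) = ≡.trans (Listₚ.length-++ (longestWord n))
  (≡.trans (≡.cong₂ ℕ._+_ (length-longestWord n) (length-down n)) (ℕₚ.+-comm (tri n) n))

longestWord-letters : ∀ n → All (λ i → suc i < n) (longestWord n)
longestWord-letters zero = []
longestWord-letters (suc n) = Allₚ.++⁺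
  (All.map (λ i<n → ℕₚ.<-trans i<n (ℕₚ.n<1+n n)) (longestWord-letters n)) (down-letters n (ℕₚ.n<1+n n))

up : ℕ → ℕ → List ℕ
up k zero = []
up k (suc d) = k ∷ up (suc k) d

map-suc-up : ∀ k d → map suc (up k d) ≡ up (suc k) d
map-suc-up k zero = ≡.refl
map-suc-up k (suc d) = ≡.cong (suc k ∷_) (map-suc-up (suc k) d)

length-up : ∀ k d → length (up k d) ≡ d
length-up k zero = ≡.refl
length-up k (suc d) = ≡.cong suc (length-up (suc k) d)

1× : (ℕ → ℕ) → ℕ → ℕ
1× w zero = zero
1× w (suc k) = suc (w k)

-- Subtracting the values from N-1 makes the sequence increasing, where `increasing-id` applies.
decreasing-longest : ∀ {N w} → Perm N w → Decreasing N w → ∀ k → k < N → w k ≡ N ∸ suc k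
decreasing-longest {N} {w} π dec k k<N = begin
  w k                          ≡⟨ ℕₚ.m∸[m∸n]≡n (ℕₚ.≤-pred (≡.subst (w k <_) (≡.sym N≡) (Perm.bounded π k<N))) ⟨
  N ∸ 1 ∸ (N ∸ 1 ∸ w k)        ≡⟨ ≡.cong (N ∸ 1 ∸_) (increasing-id {N} {λ k → N ∸ 1 ∸ w k} π′ inc k k<N) ⟩
  N ∸ 1 ∸ k                    ≡⟨ ℕₚ.∸-+-assoc N 1 k ⟩
  N ∸ suc k                    ∎
  where
  open ≡.≡-Reasoning
  N≡ : suc (N ∸ 1) ≡ N
  N≡ = ℕₚ.m+[n∸m]≡n (ℕₚ.≤-trans (s≤s z≤n) k<N)
  lemma : ∀ {N a} → a < N → a ≤ N ∸ 1
  lemma (s≤s a≤N) = a≤N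
  π′ : Perm N (λ k → N ∸ 1 ∸ w k)
  π′ = record
    { injective = λ a<N b<N eq → Perm.injective π a<N b<N
        (ℕₚ.∸-cancelˡ-≡ (lemma (Perm.bounded π a<N)) (lemma (Perm.bounded π b<N)) eq)
    ; bounded = λ {a} a<N → ℕₚ.≤-<-trans (ℕₚ.m∸n≤m (N ∸ 1) (w a)) (≡.subst (N ∸ 1 <_) N≡ (ℕₚ.n<1+n (N ∸ 1))) }
  inc : ∀ i → suc i < N → N ∸ 1 ∸ w i < N ∸ 1 ∸ w (suc i)
  inc i 1+i<N = ℕₚ.∸-monoʳ-< (dec i 1+i<N) (lemma (Perm.bounded π (ℕₚ.<-trans (ℕₚ.n<1+n i) 1+i<N)))

-- Schubert polynomials: degree, stability, setting the first variable to 0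

module Schubert {c ℓ} (K : CommutativeRing c ℓ) where
  open Homogeneity K public
  open CommutativeRing PR
  open SetoidReasoning setoid
  open IntegerSolver PR

  X^ : ℕ → ℕ → Poly
  X^ k n = Defs.pow PR (X k) n

  -- The staircase monomial of `xδ`, with its first variable split off so that words shifted by
  -- `emb 1` act on the remaining factor.
  D : ℕ → Poly
  D zero = 1#
  D (suc n) = X^ 0 n * emb 1 (D n)

  emb-1 : ∀ l → emb l 1# ≈ 1#
  emb-1 l = emb.C-homo _

  hom-emb : ∀ {V W d p} l → (∀ k → V k → W (l ℕ.+ k)) → Hom V d p → Hom W d (emb l p)
  hom-emb l f = hom-map (emb-isHom l) (λ k v → hom-≈ (sym (emb-X l k)) (hom-var (l ℕ.+ k) (f k v)))

  hom-D : ∀ n → Hom (_< n) (tri n) (D n)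
  hom-D zero = hom-C _
  hom-D (suc n) = hom-* (hom-pow-X n 0 (s≤s z≤n)) (hom-emb 1 (λ k → s≤s) (hom-D n))

  evalE-suc : ∀ θ i a → Defs.evalE PR θ (suc i) a ≡ Defs.evalE PR (θ ∘ suc) i a
  evalE-suc θ i [] = ≡.refl
  evalE-suc θ i (e ∷ es) = ≡.cong (_ *_) (evalE-suc θ (suc i) es)

  xδ-D : ∀ N → Defs.xδ K N ≈ D N
  xδ-D N = trans (term-evalE 𝕂.1# _) (trans (*-identityˡ _) (staircase N))
    where
    staircase : ∀ N → Defs.evalE PR X 0 (map (λ k → N ∸ 1 ∸ k) (upTo N)) ≈ D N
    staircase zero = refl
    staircase (suc N) = *-congˡ (begin
      Defs.evalE PR X 1 (map (λ k → N ∸ k) (applyUpTo suc N))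
        ≡⟨ ≡.cong (Defs.evalE PR X 1) (≡.trans (Listₚ.map-applyUpTo suc (N ∸_) N)
             (≡.trans (≡.sym (Listₚ.map-upTo (λ k → N ∸ suc k) N)) (Listₚ.map-cong (λ k → ≡.sym (ℕₚ.∸-+-assoc N 1 k)) (upTo N)))) ⟩
      Defs.evalE PR X 1 L
        ≡⟨ evalE-suc X 0 L ⟩
      Defs.evalE PR (X ∘ suc) 0 L
        ≈⟨ PE.evalE-cong 0 L (λ k → emb-X 1 k) ⟨
      Defs.evalE PR (emb 1 ∘ X) 0 L
        ≈⟨ emb.evalE-homo X 0 L ⟨
      emb 1 (Defs.evalE PR X 0 L)
        ≈⟨ emb.cong (staircase N) ⟩
      emb 1 (D N) ∎)
      where
      L : List ℕ
      L = map (λ k → N ∸ 1 ∸ k) (upTo N)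

  climb-F : ∀ N fuel w {F F′} → F ≈ F′ → climb N fuel w F ≈ climb N fuel w F′
  climb-F N zero w e = e
  climb-F N (suc fuel) w e with firstAscent w (upTo (N ∸ 1))
  ... | nothing = e
  ... | just i = ∂-cong i (climb-F N fuel (w ∘ sFun i) e)

  𝔖 : ℕ → (ℕ → ℕ) → Poly
  𝔖 N w = climbTop N w (D N)

  schub-𝔖 : ∀ N w → Defs.schub K N w ≈ 𝔖 N w
  schub-𝔖 N w = trans (reflexive (schubF-climb N (N ℕ.* N) w)) (climb-F N (N ℕ.* N) w (xδ-D N))

  hom-𝔖 : ∀ N w → Perm N w → Hom (_< N) (inv N w) (𝔖 N w)
  hom-𝔖 N w π = go (N ℕ.* N) w π (ℕₚ.≤-trans (tri≤square N) (ℕₚ.m≤n+m _ (inv N w)))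
    where
    full : ∀ w → inv N w ≡ tri N → Hom (_< N) (inv N w) (D N)
    full w eq = hom-≡ (≡.sym eq) (hom-D N)
    go : ∀ fuel w → Perm N w → tri N ≤ inv N w ℕ.+ fuel → Hom (_< N) (inv N w) (climb N fuel w (D N))
    go zero w π bound = full w (ℕₚ.≤-antisym (inv≤tri N w) (≡.subst (tri N ≤_) (ℕₚ.+-identityʳ _) bound))
    go (suc fuel) w π bound with firstAscent w (upTo (N ∸ 1)) in eq
    ... | nothing = full w (inv-decreasing N w (no-ascent-decreasing {N} {w} π (λ i 1+i<N → firstAscent-nothing w id (N ∸ 1) eq i (<-pred 1+i<N))))
    ... | just i = hom-∂ i (λ k → sFun-< (proj₁ asc))
            (hom-≡ (inv-swap N i w (proj₁ asc) (proj₂ asc)) (go fuel (w ∘ sFun i) (Perm-swap (proj₁ asc) π) (Ascent-swap N w i asc fuel bound)))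
      where
      asc : Ascent N w i
      asc = firstAscent-Ascent N w eq

  -- The number of missing inversions drops at every ascent, so a property can be carried down from
  -- the longest permutation, where the Schubert polynomial is the explicit monomial `D N`.
  ascent-induction : ∀ {a} (P : (ℕ → ℕ) → Set a) N →
    (∀ w → Perm N w → Decreasing N w → P w) →
    (∀ w i → Perm N w → Ascent N w i → P (w ∘ sFun i) → P w) → ∀ w → Perm N w → P w
  ascent-induction P N top step w π = go (tri N) w π (ℕₚ.m≤n+m _ (inv N w))
    where
    go : ∀ k w → Perm N w → tri N ≤ inv N w ℕ.+ k → P w
    go k w π bound with firstAscent w (upTo (N ∸ 1)) in eq
    ... | nothing = top w π (no-ascent-decreasing {N} {w} π (λ i 1+i<N → firstAscent-nothing w id (N ∸ 1) eq i (<-pred 1+i<N)))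
    go zero w π bound | just i = ⊥-elim (ℕₚ.1+n≰n (ℕₚ.≤-trans
        (ℕₚ.≤-reflexive (≡.sym (inv-swap N i w (proj₁ asc) (proj₂ asc))))
        (ℕₚ.≤-trans (inv≤tri N (w ∘ sFun i)) (≡.subst (tri N ≤_) (ℕₚ.+-identityʳ _) bound))))
      where
      asc : Ascent N w i
      asc = firstAscent-Ascent N w eq
    go (suc k) w π bound | just i = step w i π asc (go k (w ∘ sFun i) (Perm-swap (proj₁ asc) π) (Ascent-swap N w i asc k bound))
      where
      asc : Ascent N w i
      asc = firstAscent-Ascent N w eq

  ∂-pow-X : ∀ i n z → s i z ≈ z → ∂ i (X^ i (suc n) * (X^ (suc i) n * z)) ≈ X^ i n * (X^ (suc i) n * z)
  ∂-pow-X i n z sz = begin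
    ∂ i (X^ i (suc n) * (X^ (suc i) n * z))       ≈⟨ ∂-cong i (solve 4 (λ x u v z → (x :* u) :* (v :* z) := (u :* (v :* z)) :* x) refl (X i) (X^ i n) (X^ (suc i) n) z) ⟩
    ∂ i ((X^ i n * (X^ (suc i) n * z)) * X i)     ≈⟨ ∂-*-sym i (X i) symmetric ⟩
    (X^ i n * (X^ (suc i) n * z)) * ∂ i (X i)     ≈⟨ trans (*-congˡ (∂-X i)) (*-identityʳ _) ⟩
    X^ i n * (X^ (suc i) n * z)                   ∎
    where
    symmetric : s i (X^ i n * (X^ (suc i) n * z)) ≈ X^ i n * (X^ (suc i) n * z)
    symmetric = begin
      s i (X^ i n * (X^ (suc i) n * z))             ≈⟨ trans (s.*-homo _ _) (*-congˡ (s.*-homo _ _)) ⟩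
      s i (X^ i n) * (s i (X^ (suc i) n) * s i z)   ≈⟨ *-cong (trans (s.pow-homo (X i) n) (PE.pow-cong n (s-X-≡ i i (sFun-left i))))
                                                        (*-cong (trans (s.pow-homo (X (suc i)) n) (PE.pow-cong n (s-X-≡ i (suc i) (sFun-right i)))) sz) ⟩
      X^ (suc i) n * (X^ i n * z)                   ≈⟨ solve 3 (λ u v z → v :* (u :* z) := u :* (v :* z)) refl (X^ i n) (X^ (suc i) n) z ⟩
      X^ i n * (X^ (suc i) n * z)                   ∎

  emb-pow-X : ∀ l k n → emb l (X^ k n) ≈ X^ (l ℕ.+ k) n
  emb-pow-X l k n = trans (emb.pow-homo (X k) n) (PE.pow-cong n (emb-X l k))

  word-emb-1 : ∀ w n p → word (map suc w) (X^ 0 n * emb 1 p) ≈ X^ 0 n * emb 1 (word w p)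
  word-emb-1 w n p = trans (word-*-sym (map suc w) (emb 1 p) (Allₚ.map⁺ (All.universal (λ i → X^-0-sym i) w))) (*-congˡ (word-emb 1 w p))
    where
    X^-0-sym : ∀ i → s (suc i) (X^ 0 n) ≈ X^ 0 n
    X^-0-sym i = trans (s.pow-homo (X 0) n) (PE.pow-cong n (s-X-≡ (suc i) 0 {0} (sFun-other {suc i} {0} (λ ()) (λ ()))))

  emb-emb : ∀ l m p → emb l (emb m p) ≈ emb (l ℕ.+ m) p
  emb-emb l m = hom-unique (∘-isHom (emb-isHom l) (emb-isHom m)) (emb-isHom (l ℕ.+ m))
    λ k → trans (emb.cong (emb-X m k)) (trans (emb-X l _) (trans (reflexive (≡.cong X (≡.sym (ℕₚ.+-assoc l m k)))) (sym (emb-X (l ℕ.+ m) k))))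

  -- The letters act in the order 0, 1, ..., n-1. Each meets two exponents that differ by one and
  -- equalises them, and in the end every exponent of the staircase has dropped to that of the
  -- smaller one.
  word-down-D : ∀ n → word (down n) (D (suc n)) ≈ D n
  word-down-D zero = trans (*-identityˡ _) (emb-1 1)
  word-down-D (suc n) = begin
    word (down (suc n)) (D (suc (suc n)))
      ≡⟨ ≡.trans (≡.cong (λ w → word w (D (suc (suc n)))) (down-∷ʳ n)) (word-++ (map suc (down n)) (0 ∷ []) _) ⟩
    word (map suc (down n)) (∂ 0 (X^ 0 (suc n) * emb 1 (X^ 0 n * emb 1 (D n))))
      ≈⟨ word-cong (map suc (down n)) (∂-cong 0 (*-congˡ (trans (emb.*-homo _ _) (*-cong (emb-pow-X 1 0 n) (emb-emb 1 1 (D n)))))) ⟩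
    word (map suc (down n)) (∂ 0 (X^ 0 (suc n) * (X^ 1 n * emb 2 (D n))))
      ≈⟨ word-cong (map suc (down n)) (∂-pow-X 0 n _ (s-emb-below (s≤s (s≤s z≤n)) (D n))) ⟩
    word (map suc (down n)) (X^ 0 n * (X^ 1 n * emb 2 (D n)))
      ≈⟨ word-cong (map suc (down n)) (*-congˡ (trans (emb.*-homo _ _) (*-cong (emb-pow-X 1 0 n) (emb-emb 1 1 (D n))))) ⟨
    word (map suc (down n)) (X^ 0 n * emb 1 (D (suc n)))
      ≈⟨ word-emb-1 (down n) n (D (suc n)) ⟩
    X^ 0 n * emb 1 (word (down n) (D (suc n)))
      ≈⟨ *-congˡ (emb.cong (word-down-D n)) ⟩
    X^ 0 n * emb 1 (D n) ∎

  word-longestWord-D : ∀ n → word (longestWord n) (D n) ≈ 1#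
  word-longestWord-D zero = refl
  word-longestWord-D (suc n) = trans (reflexive (word-++ (longestWord n) (down n) _))
    (trans (word-cong (longestWord n) (word-down-D n)) (word-longestWord-D n))

  1≉0 : ¬ (𝕂.1# 𝕂.≈ 𝕂.0#) → ¬ (1# ≈ 0#)
  1≉0 nontrivial 1≈0 = nontrivial (𝕂.trans (𝕂.sym (ev-C (const 𝕂.0#) 𝕂.1#)) (ev-cong (const 𝕂.0#) 1≈0))

  -- The witness is the decreasing sequence with its largest value moved to position k. For k = N it
  -- is the longest permutation of N letters followed by the fixed point N, the base case of
  -- `𝔖-stable`.
  𝔖-down : ∀ N k → k ≤ N → ∃[ w ] (w k ≡ N × (∀ m → m < k → w m ≡ N ∸ suc m) × (∀ m → k < m → m ≤ N → w m ≡ N ∸ m) ×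
    (∀ F → climbTop (suc N) w F ≈ word (down k) F))
  𝔖-down N zero _ = longest (suc N) , ≡.refl , (λ _ ()) , (λ _ _ _ → ≡.refl) , λ F → climbTop-decreasing (suc N) _ F (longest-decreasing (suc N))
  𝔖-down N (suc k) 1+k≤N with 𝔖-down N k (ℕₚ.<⇒≤ 1+k≤N)
  ... | w , here , below , above , path = w ∘ sFun k
    , ≡.trans (≡.cong w (sFun-right k)) here , below′
    , (λ m 1+k<m m≤N → ≡.trans (≡.cong w (sFun-other (ℕₚ.>⇒≢ (ℕₚ.<-trans (ℕₚ.n<1+n k) 1+k<m)) (ℕₚ.>⇒≢ 1+k<m))) (above m (ℕₚ.<-trans (ℕₚ.n<1+n k) 1+k<m) m≤N))
    , λ F → trans (climbTop-ascent (suc N) (w ∘ sFun k) k F (s≤s 1+k≤N , ≡.subst₂ _<_ (≡.sym (below′ k (ℕₚ.n<1+n k))) (≡.sym (≡.trans (≡.cong w (sFun-right k)) here)) (lemma 1+k≤N)))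
        (∂-cong k (trans (climbTop-cong (suc N) F (λ m _ → ≡.cong w (sFun-involutive k m))) (path F)))
    where
    lemma : ∀ {k N} → suc k ≤ N → N ∸ suc k < N
    lemma {k} {suc N} _ = s≤s (ℕₚ.m∸n≤m N k)
    below′ : ∀ m → m < suc k → w (sFun k m) ≡ N ∸ suc m
    below′ m (s≤s m≤k) with ℕₚ.m≤n⇒m<n∨m≡n m≤k
    ... | inj₁ m<k = ≡.trans (≡.cong w (sFun-other (ℕₚ.<⇒≢ m<k) (ℕₚ.<⇒≢ (ℕₚ.<-trans m<k (ℕₚ.n<1+n k))))) (below m m<k)
    ... | inj₂ ≡.refl = ≡.trans (≡.cong w (sFun-left k)) (above (suc k) (ℕₚ.n<1+n k) 1+k≤N)

  Ascent-suc : ∀ {N w i} → Ascent N w i → Ascent (suc N) w i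
  Ascent-suc (1+i<N , asc) = ℕₚ.<-trans 1+i<N (ℕₚ.n<1+n _) , asc

  𝔖-stable : ∀ N w → Perm N w → w N ≡ N → 𝔖 (suc N) w ≈ 𝔖 N w
  𝔖-stable N = ascent-induction (λ w → w N ≡ N → 𝔖 (suc N) w ≈ 𝔖 N w) N top step
    where
    top : ∀ w → Perm N w → Decreasing N w → w N ≡ N → 𝔖 (suc N) w ≈ 𝔖 N w
    top w π dec wN≡N with 𝔖-down N N ℕₚ.≤-refl
    ... | u , here , below , _ , path = begin
      climbTop (suc N) w (D (suc N))     ≈⟨ climbTop-cong (suc N) (D (suc N)) agree ⟩
      climbTop (suc N) u (D (suc N))     ≈⟨ path (D (suc N)) ⟩
      word (down N) (D (suc N))          ≈⟨ word-down-D N ⟩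
      D N                                ≈⟨ climbTop-decreasing N w (D N) dec ⟨
      climbTop N w (D N)                 ∎
      where
      agree : ∀ k → k < suc N → w k ≡ u k
      agree k (s≤s k≤N) with ℕₚ.m≤n⇒m<n∨m≡n k≤N
      ... | inj₁ k<N = ≡.trans (decreasing-longest π dec k k<N) (≡.sym (below k k<N))
      ... | inj₂ ≡.refl = ≡.trans wN≡N (≡.sym here)
    step : ∀ w i → Perm N w → Ascent N w i → (w (sFun i N) ≡ N → 𝔖 (suc N) (w ∘ sFun i) ≈ 𝔖 N (w ∘ sFun i)) → w N ≡ N → 𝔖 (suc N) w ≈ 𝔖 N w
    step w i π asc IH wN≡N = begin
      𝔖 (suc N) w                   ≈⟨ climbTop-ascent (suc N) w i _ (Ascent-suc {N} {w} asc) ⟩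
      ∂ i (𝔖 (suc N) (w ∘ sFun i))  ≈⟨ ∂-cong i (IH (≡.trans (≡.cong w (sFun-other
                                        (ℕₚ.>⇒≢ (ℕₚ.<-trans (ℕₚ.n<1+n i) (proj₁ asc))) (ℕₚ.>⇒≢ (proj₁ asc)))) wN≡N)) ⟩
      ∂ i (𝔖 N (w ∘ sFun i))        ≈⟨ climbTop-ascent N w i _ asc ⟨
      𝔖 N w                         ∎

  -- The left inverse of `emb 1` that sets the first variable to 0. By `ρ-𝔖` it removes one leading
  -- fixed point, which is how f_j turns into f_{j-1}.
  ρ : Poly → Poly
  ρ = sub λ { zero → 0# ; (suc k) → X k }

  module ρ where
    isHom : IsHom ρ
    isHom = sub-isHom _
    open IsHom isHom public

  ρ-X-suc : ∀ k → ρ (X (suc k)) ≈ X k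
  ρ-X-suc k = sub-X _ (suc k)

  ρ-X-zero : ρ (X 0) ≈ 0#
  ρ-X-zero = sub-X _ 0

  ρ-∂ : ∀ i p → ρ (∂ (suc i) p) ≈ ∂ i (ρ p)
  ρ-∂ i p = sym (∂-hom ρ.isHom (suc i) i ρ-s ρ-α p)
    where
    ρ-s : ∀ p → ρ (s (suc i) p) ≈ s i (ρ p)
    ρ-s = hom-unique (∘-isHom ρ.isHom (s-isHom (suc i))) (∘-isHom (s-isHom i) ρ.isHom) λ
      { zero → trans (ρ.cong (s-X-≡ (suc i) 0 {0} (sFun-other {suc i} {0} (λ ()) (λ ())))) (trans ρ-X-zero (sym (trans (s.cong ρ-X-zero) (s.0-homo {i}))))
      ; (suc k) → trans (ρ.cong (s-X-≡ (suc i) (suc k) (sFun-+ 1 i k))) (trans (ρ-X-suc _) (sym (trans (s.cong (ρ-X-suc k)) (s-X i k)))) }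
    ρ-α : ρ (α (suc i)) ≈ α i
    ρ-α = trans (ρ.sub-homo _ _) (+-cong (ρ-X-suc i) (-‿cong (ρ-X-suc (suc i))))

  ρ-emb : ∀ p → ρ (emb 1 p) ≈ p
  ρ-emb = hom-unique (∘-isHom ρ.isHom (emb-isHom 1)) id-isHom λ k → trans (ρ.cong (emb-X 1 k)) (ρ-X-suc k)

  split-X₀ : ∀ {V d p} → Hom V d p → ∃[ r ] (p ≈ emb 1 (ρ p) + X 0 * r)
  split-X₀ hom-0 = 0# , sym (trans (+-cong (trans (emb.cong ρ.0-homo) emb.0-homo) (zeroʳ (X 0))) (+-identityʳ 0#))
  split-X₀ (hom-+ {p = p} {p′} h h′) with split-X₀ h | split-X₀ h′
  ... | r , e | r′ , e′ = r + r′ , (begin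
    p + p′                                          ≈⟨ +-cong e e′ ⟩
    (emb 1 (ρ p) + X 0 * r) + (emb 1 (ρ p′) + X 0 * r′)  ≈⟨ solve 5 (λ a x r b r′ → (a :+ x :* r) :+ (b :+ x :* r′) := (a :+ b) :+ x :* (r :+ r′)) refl (emb 1 (ρ p)) (X 0) r (emb 1 (ρ p′)) r′ ⟩
    (emb 1 (ρ p) + emb 1 (ρ p′)) + X 0 * (r + r′)   ≈⟨ +-congʳ (trans (emb.cong (ρ.+-homo p p′)) (emb.+-homo _ _)) ⟨
    emb 1 (ρ (p + p′)) + X 0 * (r + r′)             ∎)
  split-X₀ (hom-C x) = 0# , sym (trans (+-cong (trans (emb.cong (ρ.C-homo x)) (emb.C-homo x)) (zeroʳ (X 0))) (+-identityʳ (C x)))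
  split-X₀ (hom-X {p = p} zero v h) = p , sym (trans (+-congʳ
    (trans (emb.cong (trans (ρ.*-homo _ _) (trans (*-congʳ ρ-X-zero) (zeroˡ _)))) emb.0-homo)) (+-identityˡ _))
  split-X₀ (hom-X {p = p} (suc k) v h) with split-X₀ h
  ... | r , e = X (suc k) * r , (begin
    X (suc k) * p                                    ≈⟨ *-congˡ e ⟩
    X (suc k) * (emb 1 (ρ p) + X 0 * r)              ≈⟨ solve 4 (λ y a x r → y :* (a :+ x :* r) := y :* a :+ x :* (y :* r)) refl (X (suc k)) (emb 1 (ρ p)) (X 0) r ⟩
    X (suc k) * emb 1 (ρ p) + X 0 * (X (suc k) * r)  ≈⟨ +-congʳ (trans (emb.cong (trans (ρ.*-homo _ _) (*-congʳ (ρ-X-suc k)))) (trans (emb.*-homo _ _) (*-congʳ (emb-X 1 k)))) ⟨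
    emb 1 (ρ (X (suc k) * p)) + X 0 * (X (suc k) * r) ∎)
  split-X₀ (hom-≈ e h) with split-X₀ h
  ... | r , e′ = r , trans (sym e) (trans e′ (+-congʳ (emb.cong (ρ.cong e))))

  -- The divided difference of the power is the complete symmetric polynomial of degree n in x_0 and
  -- x_1; only its term x_1^n survives x_0 = 0.
  ρ-∂-pow : ∀ n → ρ (∂ 0 (X^ 0 (suc n))) ≈ X^ 0 n
  ρ-∂-pow n = begin
    ρ (∂ 0 (X 0 * X^ 0 n))                               ≈⟨ ρ.cong (leibniz 0 (X 0) (X^ 0 n)) ⟩
    ρ (∂ 0 (X 0) * X^ 0 n + s 0 (X 0) * ∂ 0 (X^ 0 n))    ≈⟨ ρ.cong (+-cong (trans (*-congʳ (∂-X 0)) (*-identityˡ _)) (*-congʳ (s-X-≡ 0 0 (sFun-left 0)))) ⟩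
    ρ (X^ 0 n + X 1 * ∂ 0 (X^ 0 n))                      ≈⟨ trans (ρ.+-homo _ _) (+-cong (ρ.pow-homo (X 0) n) (trans (ρ.*-homo _ _) (*-congʳ (ρ-X-suc 0)))) ⟩
    Defs.pow PR (ρ (X 0)) n + X 0 * ρ (∂ 0 (X^ 0 n))     ≈⟨ last n ⟩
    X^ 0 n                                               ∎
    where
    last : ∀ n → Defs.pow PR (ρ (X 0)) n + X 0 * ρ (∂ 0 (X^ 0 n)) ≈ X^ 0 n
    last zero = trans (+-congˡ (trans (*-congˡ (trans (ρ.cong (∂-hom-0 {Any} 0 (hom-C 𝕂.1#))) ρ.0-homo)) (zeroʳ _))) (+-identityʳ _)
    last (suc n) = trans (+-cong (trans (*-congʳ ρ-X-zero) (zeroˡ _)) (*-congˡ (ρ-∂-pow n))) (+-identityˡ _)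

  hom-word-up : ∀ n → Hom Any (tri n) (word (up 0 n) (D (suc n)))
  hom-word-up n = hom-word (up 0 n) (hom-≡ (≡.cong (ℕ._+ tri n) (≡.sym (length-up 0 n))) (hom-any (hom-D (suc n))))

  ρ-word-up-D : ∀ n → ρ (word (up 0 n) (D (suc n))) ≈ D n
  ρ-word-up-D zero = trans (ρ.cong (trans (*-identityˡ _) (emb-1 1))) (ρ.C-homo _)
  ρ-word-up-D (suc n) with split-X₀ (hom-word-up n)
  ... | r , e = begin
    ρ (∂ 0 (word (up 1 n) (D (suc (suc n)))))
      ≡⟨ ≡.cong (λ w → ρ (∂ 0 (word w (D (suc (suc n)))))) (map-suc-up 0 n) ⟨
    ρ (∂ 0 (word (map suc (up 0 n)) (D (suc (suc n)))))
      ≈⟨ ρ.cong (∂-cong 0 (word-emb-1 (up 0 n) (suc n) (D (suc n)))) ⟩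
    ρ (∂ 0 (X^ 0 (suc n) * emb 1 z))
      ≈⟨ ρ.cong (∂-cong 0 (*-congˡ (trans (emb.cong e) (trans (emb.+-homo _ _) (+-cong
           (trans (emb.cong (emb.cong (ρ-word-up-D n))) (emb-emb 1 1 (D n))) (trans (emb.*-homo _ _) (*-congʳ (emb-X 1 0)))))))) ⟩
    -- The induction hypothesis holds only up to multiples of x_0, shifted here to x_1. Beside the
    -- power of x_0 this error contains x_0 x_1, which is symmetric, passes through `∂ 0` and
    -- vanishes under `ρ`.
    ρ (∂ 0 (X^ 0 (suc n) * (emb 2 (D n) + X 1 * r′)))
      ≈⟨ ρ.cong (trans (∂-cong 0 (solve 5 (λ x u a y r → (x :* u) :* (a :+ y :* r) := a :* (x :* u) :+ (x :* y) :* (u :* r)) refl (X 0) (X^ 0 n) (emb 2 (D n)) (X 1) r′)) (∂-+ 0 _ _)) ⟩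
    ρ (∂ 0 (emb 2 (D n) * X^ 0 (suc n)) + ∂ 0 ((X 0 * X 1) * (X^ 0 n * r′)))
      ≈⟨ ρ.cong (+-cong (∂-*-sym 0 _ (s-emb-below (s≤s (s≤s z≤n)) (D n))) (∂-*-sym 0 _ X₀X₁-sym)) ⟩
    ρ (emb 2 (D n) * ∂ 0 (X^ 0 (suc n)) + (X 0 * X 1) * ∂ 0 (X^ 0 n * r′))
      ≈⟨ trans (ρ.+-homo _ _) (+-cong (ρ.*-homo _ _) (trans (ρ.*-homo _ _) (*-congʳ (trans (ρ.*-homo _ _) (trans (*-congʳ ρ-X-zero) (zeroˡ _)))))) ⟩
    ρ (emb 2 (D n)) * ρ (∂ 0 (X^ 0 (suc n))) + 0# * ρ (∂ 0 (X^ 0 n * r′))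
      ≈⟨ trans (+-congˡ (zeroˡ _)) (+-identityʳ _) ⟩
    ρ (emb 2 (D n)) * ρ (∂ 0 (X^ 0 (suc n)))
      ≈⟨ *-cong (trans (ρ.cong (sym (emb-emb 1 1 (D n)))) (ρ-emb _)) (ρ-∂-pow n) ⟩
    emb 1 (D n) * X^ 0 n
      ≈⟨ *-comm _ _ ⟩
    X^ 0 n * emb 1 (D n) ∎
    where
    z r′ : Poly
    z = word (up 0 n) (D (suc n))
    r′ = emb 1 r
    X₀X₁-sym : s 0 (X 0 * X 1) ≈ X 0 * X 1
    X₀X₁-sym = trans (s.*-homo _ _) (trans (*-cong (s-X-≡ 0 0 (sFun-left 0)) (s-X-≡ 0 1 (sFun-right 0))) (*-comm _ _))

  -- The counterpart of `𝔖-down` with the smallest value: the witness is the decreasing sequence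
  -- with 0 moved to position k. For k = 0 it is 1 × w₀, the base case of `ρ-𝔖`.
  𝔖-up : ∀ N d k → N ≡ k ℕ.+ d → ∃[ w ] (w k ≡ 0 × (∀ m → m < k → w m ≡ N ∸ m) × (∀ m → k < m → w m ≡ suc N ∸ m) ×
    (∀ F → climbTop (suc N) w F ≈ word (up k d) F))
  𝔖-up N zero k N≡ rewrite ≡.trans N≡ (ℕₚ.+-identityʳ k) = longest (suc k) , ℕₚ.n∸n≡0 k , (λ _ _ → ≡.refl)
    , (λ m k<m → ≡.trans (ℕₚ.m≤n⇒m∸n≡0 (ℕₚ.<⇒≤ k<m)) (≡.sym (ℕₚ.m≤n⇒m∸n≡0 k<m)))
    , λ F → climbTop-decreasing (suc k) _ F (longest-decreasing (suc k))
  𝔖-up N (suc d) k N≡ with 𝔖-up N d (suc k) (≡.trans N≡ (ℕₚ.+-suc k d))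
  ... | w , here , below , above , path = w ∘ sFun k
    , ≡.trans (≡.cong w (sFun-left k)) here
    , (λ m m<k → ≡.trans (≡.cong w (sFun-other (ℕₚ.<⇒≢ m<k) (ℕₚ.<⇒≢ (ℕₚ.<-trans m<k (ℕₚ.n<1+n k))))) (below m (ℕₚ.<-trans m<k (ℕₚ.n<1+n k))))
    , above′
    , λ F → trans (climbTop-ascent (suc N) (w ∘ sFun k) k F (s≤s k<N , ≡.subst₂ _<_ (≡.sym (≡.trans (≡.cong w (sFun-left k)) here))
          (≡.sym (≡.trans (≡.cong w (sFun-right k)) (below k (ℕₚ.n<1+n k)))) (ℕₚ.m<n⇒0<n∸m k<N)))
        (∂-cong k (trans (climbTop-cong (suc N) F (λ m _ → ≡.cong w (sFun-involutive k m))) (path F)))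
    where
    k<N : k < N
    k<N = ≡.subst (k <_) (≡.sym N≡) (ℕₚ.m<m+n k (s≤s z≤n))
    above′ : ∀ m → k < m → w (sFun k m) ≡ suc N ∸ m
    above′ m k<m with ℕₚ.m≤n⇒m<n∨m≡n k<m
    ... | inj₁ 1+k<m = ≡.trans (≡.cong w (sFun-other (ℕₚ.>⇒≢ k<m) (ℕₚ.>⇒≢ 1+k<m))) (above m 1+k<m)
    ... | inj₂ ≡.refl = ≡.trans (≡.cong w (sFun-right k)) (below k (ℕₚ.n<1+n k))

  -- Since `ρ` carries `∂ (suc i)` to `∂ i`, and ascents of `1× w` come from those of w, only the
  -- longest permutation needs a computation.
  ρ-𝔖 : ∀ N w → Perm N w → ρ (𝔖 (suc N) (1× w)) ≈ 𝔖 N w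
  ρ-𝔖 N = ascent-induction (λ w → ρ (𝔖 (suc N) (1× w)) ≈ 𝔖 N w) N top step
    where
    top : ∀ w → Perm N w → Decreasing N w → ρ (𝔖 (suc N) (1× w)) ≈ 𝔖 N w
    top w π dec with 𝔖-up N N 0 ≡.refl
    ... | u , here , _ , above , path = begin
      ρ (climbTop (suc N) (1× w) (D (suc N)))     ≈⟨ ρ.cong (climbTop-cong (suc N) (D (suc N)) agree) ⟩
      ρ (climbTop (suc N) u (D (suc N)))          ≈⟨ ρ.cong (path (D (suc N))) ⟩
      ρ (word (up 0 N) (D (suc N)))               ≈⟨ ρ-word-up-D N ⟩
      D N                                         ≈⟨ climbTop-decreasing N w (D N) dec ⟨
      climbTop N w (D N)                          ∎
      where
      agree : ∀ k → k < suc N → 1× w k ≡ u k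
      agree zero _ = ≡.sym here
      agree (suc k) (s≤s k<N) = ≡.trans (≡.cong suc (decreasing-longest π dec k k<N))
        (≡.trans (≡.sym (ℕₚ.+-∸-assoc 1 k<N)) (≡.sym (above (suc k) (s≤s z≤n))))
    step : ∀ w i → Perm N w → Ascent N w i → ρ (𝔖 (suc N) (1× (w ∘ sFun i))) ≈ 𝔖 N (w ∘ sFun i) → ρ (𝔖 (suc N) (1× w)) ≈ 𝔖 N w
    step w i π (1+i<N , asc) IH = begin
      ρ (𝔖 (suc N) (1× w))                            ≈⟨ ρ.cong (climbTop-ascent (suc N) (1× w) (suc i) _ (s≤s 1+i<N , s≤s asc)) ⟩
      ρ (∂ (suc i) (𝔖 (suc N) (1× w ∘ sFun (suc i))))  ≈⟨ ρ-∂ i _ ⟩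
      ∂ i (ρ (𝔖 (suc N) (1× w ∘ sFun (suc i))))        ≈⟨ ∂-cong i (ρ.cong (climbTop-cong (suc N) (D (suc N)) agree)) ⟩
      ∂ i (ρ (𝔖 (suc N) (1× (w ∘ sFun i))))            ≈⟨ ∂-cong i IH ⟩
      ∂ i (𝔖 N (w ∘ sFun i))                           ≈⟨ climbTop-ascent N w i _ (1+i<N , asc) ⟨
      𝔖 N w                                            ∎
      where
      agree : ∀ k → k < suc N → 1× w (sFun (suc i) k) ≡ 1× (w ∘ sFun i) k
      agree zero _ = ≡.cong (1× w) (sFun-other {suc i} {0} (λ ()) (λ ()))
      agree (suc k) _ = ≡.cong (1× w) (sFun-+ 1 i k)

-- Finite products

module Products {c ℓ} (S : CommutativeRing c ℓ) where
  open CommutativeRing S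
  open SetoidReasoning setoid
  open IntegerSolver S
  open Sums S public

  ∏ : ℕ → (ℕ → Carrier) → Carrier
  ∏ zero h = 1#
  ∏ (suc n) h = h 0 * ∏ n (h ∘ suc)

  ∏-cong : ∀ n {h h′} → (∀ k → k < n → h k ≈ h′ k) → ∏ n h ≈ ∏ n h′
  ∏-cong zero eq = refl
  ∏-cong (suc n) eq = *-cong (eq 0 (s≤s z≤n)) (∏-cong n (λ k k<n → eq (suc k) (s≤s k<n)))

  ∏-last : ∀ n (h : ℕ → Carrier) → ∏ (suc n) h ≈ ∏ n h * h n
  ∏-last zero h = *-comm _ _
  ∏-last (suc n) h = trans (*-congˡ (∏-last n (h ∘ suc))) (sym (*-assoc _ _ _))

  ∏-+ : ∀ m n (h : ℕ → Carrier) → ∏ (m ℕ.+ n) h ≈ ∏ m h * ∏ n (λ k → h (m ℕ.+ k))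
  ∏-+ zero n h = sym (*-identityˡ _)
  ∏-+ (suc m) n h = trans (*-congˡ (∏-+ m n (h ∘ suc))) (sym (*-assoc _ _ _))

  ∏-* : ∀ n h h′ → ∏ n (λ k → h k * h′ k) ≈ ∏ n h * ∏ n h′
  ∏-* zero h h′ = sym (*-identityˡ _)
  ∏-* (suc n) h h′ = trans (*-congˡ (∏-* n (h ∘ suc) (h′ ∘ suc)))
    (solve 4 (λ a b c d → (a :* b) :* (c :* d) := (a :* c) :* (b :* d)) refl (h 0) (h′ 0) _ _)

  ∏-1 : ∀ n {h} → (∀ k → k < n → h k ≈ 1#) → ∏ n h ≈ 1#
  ∏-1 zero eq = refl
  ∏-1 (suc n) eq = trans (*-cong (eq 0 (s≤s z≤n)) (∏-1 n (λ k k<n → eq (suc k) (s≤s k<n)))) (*-identityˡ _)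

  ∏-swap : ∀ n i (h : ℕ → Carrier) → suc i < n → ∏ n (h ∘ sFun i) ≈ ∏ n h
  ∏-swap (suc zero) zero h (s≤s ())
  ∏-swap (suc (suc n)) zero h _ rewrite sFun-left 0 | sFun-right 0 =
    trans (*-congˡ (*-congˡ (∏-cong n (λ k _ → reflexive (≡.cong h (sFun-zero-2+ k))))))
      (solve 3 (λ a b t → a :* (b :* t) := b :* (a :* t)) refl (h 1) (h 0) _)
  ∏-swap (suc n) (suc i) h (s≤s 1+i<n) rewrite sFun-other {suc i} {0} (λ ()) (λ ()) =
    *-congˡ (trans (∏-cong n (λ k _ → reflexive (≡.cong h (sFun-+ 1 i k)))) (∏-swap n i (h ∘ suc) 1+i<n))

  ∑-swap : ∀ n i (h : ℕ → Carrier) → suc i < n → ∑ n (h ∘ sFun i) ≈ ∑ n h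
  ∑-swap (suc zero) zero h (s≤s ())
  ∑-swap (suc (suc n)) zero h _ rewrite sFun-left 0 | sFun-right 0 =
    trans (+-congˡ (+-congˡ (∑-cong n (λ k _ → reflexive (≡.cong h (sFun-zero-2+ k))))))
      (solve 3 (λ a b t → a :+ (b :+ t) := b :+ (a :+ t)) refl (h 1) (h 0) _)
  ∑-swap (suc n) (suc i) h (s≤s 1+i<n) rewrite sFun-other {suc i} {0} (λ ()) (λ ()) =
    +-congˡ (trans (∑-cong n (λ k _ → reflexive (≡.cong h (sFun-+ 1 i k)))) (∑-swap n i (h ∘ suc) 1+i<n))

-- The functional λ and its factorisation over two blocks of variables

module Functional {c ℓ} (K : CommutativeRing c ℓ) (nontrivial : ¬ (CommutativeRing._≈_ K (CommutativeRing.1# K) (CommutativeRing.0# K)))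
  (q : CommutativeRing.Carrier K) where
  open Schubert K public
  open CommutativeRing PR
  open SetoidReasoning setoid
  open IntegerSolver PR
  open Products PR

  hom-∏ : ∀ {Φ} → IsHom Φ → ∀ n h → Φ (∏ n h) ≈ ∏ n (Φ ∘ h)
  hom-∏ Φh zero h = IsHom.C-homo Φh _
  hom-∏ Φh (suc n) h = trans (IsHom.*-homo Φh _ _) (*-congˡ (hom-∏ Φh n (h ∘ suc)))

  hom-∑ : ∀ {Φ} → IsHom Φ → ∀ n h → Φ (∑ n h) ≈ ∑ n (Φ ∘ h)
  hom-∑ Φh zero h = IsHom.0-homo Φh
  hom-∑ Φh (suc n) h = trans (IsHom.+-homo Φh _ _) (+-congˡ (hom-∑ Φh n (h ∘ suc)))

  L : ℕ → ℕ → Poly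
  L a b = C q * X a - X b

  hom-L : ∀ {Φ} → IsHom Φ → ∀ {a b a′ b′} → Φ (X a) ≈ X a′ → Φ (X b) ≈ X b′ → Φ (L a b) ≈ L a′ b′
  hom-L Φh ea eb = trans (IsHom.sub-homo Φh _ _)
    (+-cong (trans (IsHom.*-homo Φh _ _) (*-cong (IsHom.C-homo Φh q) ea)) (-‿cong eb))

  L-hom : ∀ a b → Hom Any 1 (L a b)
  L-hom a b = hom-minus (hom-C* q (hom-var a tt)) (hom-var b tt)

  opaque
    -- The value 1 off the range turns Π into a product over a full square, which splits into blocks
    -- without any care for the index bounds.
    factor : ℕ → ℕ → Poly
    factor i j = if suc i <ᵇ j then L i j else 1#

    factor-L : ∀ {i j} → suc i < j → factor i j ≈ L i j
    factor-L {i} {j} lt rewrite <⇒<ᵇ-true lt = refl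

    factor-1 : ∀ {i j} → j ≤ suc i → factor i j ≈ 1#
    factor-1 {i} {j} le rewrite ≥⇒<ᵇ-false le = refl

  emb-factor : ∀ l i j → emb l (factor i j) ≈ factor (l ℕ.+ i) (l ℕ.+ j)
  emb-factor l i j with suc i ℕ.<? j
  ... | yes lt = trans (emb.cong (factor-L lt)) (trans (hom-L (emb-isHom l) (emb-X l i) (emb-X l j))
          (sym (factor-L (≡.subst (_< l ℕ.+ j) (ℕₚ.+-suc l i) (ℕₚ.+-monoʳ-< l lt)))))
  ... | no ge = trans (emb.cong (factor-1 (ℕₚ.≮⇒≥ ge))) (trans (emb-1 l)
          (sym (factor-1 (≡.subst (l ℕ.+ j ≤_) (ℕₚ.+-suc l i) (ℕₚ.+-monoʳ-≤ l (ℕₚ.≮⇒≥ ge))))))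

  Π : ℕ → Poly
  Π n = ∏ n (λ i → ∏ n (λ j → factor i j))

  Π-suc : ∀ n → Π (suc n) ≈ Π n * ∏ n (λ i → factor i n)
  Π-suc n = begin
    ∏ (suc n) (λ i → ∏ (suc n) (factor i))
      ≈⟨ ∏-last n _ ⟩
    ∏ n (λ i → ∏ (suc n) (factor i)) * ∏ (suc n) (factor n)
      ≈⟨ *-cong (∏-cong n (λ i _ → ∏-last n (factor i))) (∏-1 (suc n) (λ j j≤n → factor-1 (ℕₚ.<⇒≤ j≤n))) ⟩
    ∏ n (λ i → ∏ n (factor i) * factor i n) * 1#
      ≈⟨ trans (*-identityʳ _) (∏-* n _ _) ⟩
    Π n * ∏ n (λ i → factor i n) ∎

  degΠ : ℕ → ℕ
  degΠ zero = 0
  degΠ (suc n) = degΠ n ℕ.+ (n ∸ 1)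

  -- The reason for degree N-1: a form of that degree times `Π N` has as its degree the number of
  -- letters in the longest word, so its image is a constant.
  degΠ-tri : ∀ n → degΠ (suc n) ℕ.+ n ≡ tri (suc n)
  degΠ-tri zero = ≡.refl
  degΠ-tri (suc n) = ≡.trans (ℕₚ.+-comm _ (suc n)) (≡.cong (suc n ℕ.+_) (degΠ-tri n))

  ∏-Hom : ∀ {V} n {h} → (∀ k → k < n → Hom V 1 (h k)) → Hom V n (∏ n h)
  ∏-Hom zero hh = hom-C _
  ∏-Hom (suc n) hh = hom-* (hh 0 (s≤s z≤n)) (∏-Hom n (λ k k<n → hh (suc k) (s≤s k<n)))

  hom-Π : ∀ n → Hom Any (degΠ n) (Π n)
  hom-Π zero = hom-C _
  hom-Π (suc n) = hom-≈ (sym (Π-suc n)) (hom-* (hom-Π n) (column n))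
    where
    column : ∀ n → Hom Any (n ∸ 1) (∏ n (λ i → factor i n))
    column zero = hom-C _
    column (suc n) = hom-≈ (sym (trans (∏-last n _) (trans (*-congˡ (factor-1 ℕₚ.≤-refl)) (*-identityʳ _))))
      (∏-Hom n (λ k k<n → hom-≈ (sym (factor-L (s≤s k<n))) (L-hom k (suc n))))

  -- y l is the factor that Π lacks to contain the full product over pairs of variables from the
  -- blocks {x₀,…,x_l} and {x_{l+1},…}.
  y : ℕ → Poly
  y l = L l (suc l)

  cross : ℕ → ℕ → Poly
  cross l r = ∏ l (λ i → ∏ r (λ j → L i (l ℕ.+ j)))

  Π-split : ∀ l r → y l * Π (suc l ℕ.+ suc r) ≈ cross (suc l) (suc r) * (Π (suc l) * emb (suc l) (Π (suc r)))
  Π-split l′ r′ = begin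
    y l′ * Π (l ℕ.+ r)
      ≈⟨ *-congˡ (∏-+ l r (λ i → ∏ (l ℕ.+ r) (factor i))) ⟩
    y l′ * (∏ l (λ i → ∏ (l ℕ.+ r) (factor i)) * ∏ r (λ i → ∏ (l ℕ.+ r) (factor (l ℕ.+ i))))
      ≈⟨ *-congˡ (*-cong (trans (∏-cong l (λ i _ → ∏-+ l r (factor i))) (∏-* l (λ i → ∏ l (factor i)) (λ i → ∏ r (λ j → factor i (l ℕ.+ j)))))
           (trans (∏-cong r (λ i _ → trans (∏-+ l r (factor (l ℕ.+ i))) (trans (*-congʳ (below i)) (*-identityˡ _)))) embedded)) ⟩
    y l′ * ((Π l * ∏ l (λ i → ∏ r (λ j → factor i (l ℕ.+ j)))) * emb l (Π r))
      ≈⟨ solve 4 (λ y p c e → y :* ((p :* c) :* e) := (c :* y) :* (p :* e)) refl (y l′) (Π l) _ (emb l (Π r)) ⟩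
    (∏ l (λ i → ∏ r (λ j → factor i (l ℕ.+ j))) * y l′) * (Π l * emb l (Π r))
      ≈⟨ *-congʳ crossing ⟩
    cross l r * (Π l * emb l (Π r)) ∎
    where
    l r : ℕ
    l = suc l′
    r = suc r′
    below : ∀ i → ∏ l (factor (l ℕ.+ i)) ≈ 1#
    below i = ∏-1 l (λ j j<l → factor-1 (ℕₚ.≤-trans (ℕₚ.<⇒≤ j<l) (ℕₚ.≤-trans (ℕₚ.m≤m+n l i) (ℕₚ.n≤1+n _))))
    embedded : ∏ r (λ i → ∏ r (λ j → factor (l ℕ.+ i) (l ℕ.+ j))) ≈ emb l (Π r)
    embedded = sym (trans (hom-∏ (emb-isHom l) r (λ i → ∏ r (factor i))) (∏-cong r (λ i _ → trans (hom-∏ (emb-isHom l) r (factor i)) (∏-cong r (λ j _ → emb-factor l i j)))))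
    row : ∀ i → i < l′ → ∏ r (λ j → factor i (l ℕ.+ j)) ≈ ∏ r (λ j → L i (l ℕ.+ j))
    row i i<l′ = ∏-cong r (λ j _ → factor-L (ℕₚ.<-≤-trans (s≤s i<l′) (ℕₚ.m≤m+n l j)))
    lastRow : ∏ r (λ j → factor l′ (l ℕ.+ j)) * y l′ ≈ ∏ r (λ j → L l′ (l ℕ.+ j))
    lastRow = begin
      (factor l′ (l ℕ.+ 0) * ∏ r′ (λ j → factor l′ (l ℕ.+ suc j))) * y l′
        ≈⟨ *-congʳ (*-cong (factor-1 (ℕₚ.≤-reflexive (ℕₚ.+-identityʳ l)))
             (∏-cong r′ (λ j _ → factor-L (≡.subst (l <_) (≡.sym (ℕₚ.+-suc l j)) (s≤s (ℕₚ.m≤m+n l j)))))) ⟩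
      (1# * ∏ r′ (λ j → L l′ (l ℕ.+ suc j))) * y l′
        ≈⟨ trans (*-congʳ (*-identityˡ _)) (*-comm _ _) ⟩
      y l′ * ∏ r′ (λ j → L l′ (l ℕ.+ suc j))
        ≡⟨ ≡.cong (λ m → L l′ m * ∏ r′ (λ j → L l′ (l ℕ.+ suc j))) (≡.sym (ℕₚ.+-identityʳ l)) ⟩
      L l′ (l ℕ.+ 0) * ∏ r′ (λ j → L l′ (l ℕ.+ suc j)) ∎
    crossing : ∏ l (λ i → ∏ r (λ j → factor i (l ℕ.+ j))) * y l′ ≈ cross l r
    crossing = begin
      ∏ l (λ i → ∏ r (λ j → factor i (l ℕ.+ j))) * y l′
        ≈⟨ *-congʳ (∏-last l′ _) ⟩
      (∏ l′ (λ i → ∏ r (λ j → factor i (l ℕ.+ j))) * ∏ r (λ j → factor l′ (l ℕ.+ j))) * y l′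
        ≈⟨ trans (*-assoc _ _ _) (*-cong (∏-cong l′ row) lastRow) ⟩
      ∏ l′ (λ i → ∏ r (λ j → L i (l ℕ.+ j))) * ∏ r (λ j → L l′ (l ℕ.+ j))
        ≈⟨ ∏-last l′ _ ⟨
      cross l r ∎

  -- The generators of S_l × S_r inside S_{l+r}. Only the letter l-1, which exchanges variables
  -- across the cut, is missing.
  data InBlocks (l r : ℕ) : ℕ → Set where
    inA : ∀ {k} → suc k < l → InBlocks l r k
    inB : ∀ {k} → suc k < r → InBlocks l r (l ℕ.+ k)

  cross-sym : ∀ {l r k} → InBlocks l r k → s k (cross l r) ≈ cross l r
  cross-sym {l} {r} (inA {k} 1+k<l) = trans (hom-∏ (s-isHom k) l _) (trans
    (∏-cong l (λ i _ → trans (hom-∏ (s-isHom k) r _) (∏-cong r (λ j _ → hom-L (s-isHom k) (s-X k i) (s-X-≡ k (l ℕ.+ j) (sFun-other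
        (ℕₚ.>⇒≢ (ℕₚ.<-≤-trans (ℕₚ.<-trans (ℕₚ.n<1+n k) 1+k<l) (ℕₚ.m≤m+n l j)))
        (ℕₚ.>⇒≢ (ℕₚ.<-≤-trans 1+k<l (ℕₚ.m≤m+n l j)))))))))
    (∏-swap l k (λ i → ∏ r (λ j → L i (l ℕ.+ j))) 1+k<l))
  cross-sym {l} {r} (inB {k} 1+k<r) = trans (hom-∏ (s-isHom (l ℕ.+ k)) l _) (∏-cong l λ i i<l → trans
    (trans (hom-∏ (s-isHom (l ℕ.+ k)) r _) (∏-cong r (λ j _ → hom-L (s-isHom (l ℕ.+ k))
      (s-X-≡ (l ℕ.+ k) i (sFun-other (ℕₚ.<⇒≢ (ℕₚ.<-≤-trans i<l (ℕₚ.m≤m+n l k)))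
        (ℕₚ.<⇒≢ (ℕₚ.<-≤-trans i<l (ℕₚ.≤-trans (ℕₚ.m≤m+n l k) (ℕₚ.n≤1+n _))))))
      (s-X-≡ (l ℕ.+ k) (l ℕ.+ j) (sFun-+ l k j)))))
    (∏-swap r k (λ j → L i (l ℕ.+ j)) 1+k<r))

  wordA : ℕ → List ℕ
  wordA l = longestWord l

  wordB : ℕ → ℕ → List ℕ
  wordB l r = map (l ℕ.+_) (longestWord r)

  wordA-blocks : ∀ l r → All (InBlocks l r) (wordA l)
  wordA-blocks l r = All.map inA (longestWord-letters l)

  wordB-blocks : ∀ l r → All (InBlocks l r) (wordB l r)
  wordB-blocks l r = Allₚ.map⁺ (All.map inB (longestWord-letters r))

  block-letter : ∀ {l r k} → InBlocks l r k → suc k < l ℕ.+ r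
  block-letter {l} {r} (inA 1+k<l) = ℕₚ.<-≤-trans 1+k<l (ℕₚ.m≤m+n l r)
  block-letter {l} {r} (inB {k} 1+k<r) = ≡.subst (_< l ℕ.+ r) (ℕₚ.+-suc l k) (ℕₚ.+-monoʳ-< l 1+k<r)

  wordB-emb : ∀ l r {u} p → Symmetric (wordB l r) u → word (wordB l r) (u * emb l p) ≈ u * emb l (word (longestWord r) p)
  wordB-emb l r {u} p su = trans (word-*-sym (wordB l r) (emb l p) su) (*-congˡ (word-emb l (longestWord r) p))

  emb-symA : ∀ l p → Symmetric (wordA l) (emb l p)
  emb-symA l p = All.map (λ lt → s-emb-below lt p) (longestWord-letters l)

  below-symB : ∀ l r {d p} → Hom (_< l) d p → Symmetric (wordB l r) p
  below-symB l r h = Allₚ.map⁺ (All.universal (λ i → s-fixes (l ℕ.+ i) (λ k k<l → sFun-other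
    (ℕₚ.<⇒≢ (ℕₚ.<-≤-trans k<l (ℕₚ.m≤m+n l i))) (ℕₚ.<⇒≢ (ℕₚ.<-≤-trans k<l (ℕₚ.≤-trans (ℕₚ.m≤m+n l i) (ℕₚ.n≤1+n _))))) h) (longestWord r))

  blocks : ℕ → ℕ → List ℕ
  blocks l r = wordA l ++ wordB l r

  length-wordB : ∀ l r → length (wordB l r) ≡ tri r
  length-wordB l r = ≡.trans (Listₚ.length-map _ (longestWord r)) (length-longestWord r)

  length-blocks : ∀ l r → length (blocks l r) ≡ tri l ℕ.+ tri r
  length-blocks l r = ≡.trans (Listₚ.length-++ (wordA l)) (≡.cong₂ ℕ._+_ (length-longestWord l) (length-wordB l r))

  blocks-letters : ∀ l r → Letters (l ℕ.+ r) (blocks l r)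
  blocks-letters l r = All.map block-letter (Allₚ.++⁺ (wordA-blocks l r) (wordB-blocks l r))

  word-blocks : ∀ l r {d g} h → Hom (_< l) d g → word (blocks l r) (g * emb l h) ≈ word (longestWord l) g * emb l (word (longestWord r) h)
  word-blocks l r {d} {g} h gh = begin
    word (blocks l r) (g * emb l h)                          ≡⟨ word-++ (wordA l) (wordB l r) _ ⟩
    word (wordA l) (word (wordB l r) (g * emb l h))          ≈⟨ word-cong (wordA l) (trans (wordB-emb l r h (below-symB l r gh)) (*-comm _ _)) ⟩
    word (wordA l) (emb l (word (longestWord r) h) * g)      ≈⟨ word-*-sym (wordA l) g (emb-symA l _) ⟩
    emb l (word (longestWord r) h) * word (wordA l) g        ≈⟨ *-comm _ _ ⟩
    word (longestWord l) g * emb l (word (longestWord r) h)  ∎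

  longestWord-climb : ∀ N F → word (longestWord N) F ≈ climbTop N id F
  longestWord-climb N = word-longest N (longestWord N) (longestWord-letters N) (length-longestWord N) (D N)
    (1≉0 nontrivial ∘ trans (sym (word-longestWord-D N)))

  extend : ∀ N a → Letters N a → ∀ F₀ → word a F₀ ≈ 1# → ∃[ g ] (∀ F → word (longestWord N) F ≈ word g (word a F))
  extend N a as F₀ one with word-extend N a as F₀ (1≉0 nontrivial ∘ trans (sym one))
  ... | g , eq = g , λ F → trans (longestWord-climb N F) (eq F)

  -- The product of the two staircases is sent to 1 by the block word, which certifies that the word
  -- is reduced.
  extend-blocks : ∀ l r → ∃[ g ] (∀ F → word (longestWord (l ℕ.+ r)) F ≈ word g (word (blocks l r) F))
  extend-blocks l r = extend (l ℕ.+ r) (blocks l r) (blocks-letters l r) (D l * emb l (D r))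
    (trans (word-blocks l r (D r) (hom-D l)) (trans (*-cong (word-longestWord-D l) (trans (emb.cong (word-longestWord-D r)) (emb-1 l))) (*-identityˡ _)))

  extend-A : ∀ l r → ∃[ g ] (∀ F → word (longestWord (l ℕ.+ r)) F ≈ word g (word (wordA l) F))
  extend-A l r = extend (l ℕ.+ r) (wordA l) (All.map block-letter (wordA-blocks l r)) (D l) (word-longestWord-D l)

  extend-B : ∀ l r → ∃[ g ] (∀ F → word (longestWord (l ℕ.+ r)) F ≈ word g (word (wordB l r) F))
  extend-B l r = extend (l ℕ.+ r) (wordB l r) (All.map block-letter (wordB-blocks l r)) (emb l (D r))
    (trans (word-emb l (longestWord r) (D r)) (trans (emb.cong (word-longestWord-D r)) (emb-1 l)))

  lam : ℕ → Poly → 𝕂.Carrier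
  lam n F = ε (word (longestWord n) (F * Π n))

  ε-cong : ∀ {p r} → p ≈ r → ε p 𝕂.≈ ε r
  ε-cong = ev-cong _

  ε-0 : ∀ {p} → p ≈ 0# → ε p 𝕂.≈ 𝕂.0#
  ε-0 p≈0 = ε-cong p≈0

  lam-cong : ∀ n {F F′} → F ≈ F′ → lam n F 𝕂.≈ lam n F′
  lam-cong n e = ε-cong (word-cong (longestWord n) (*-congʳ e))

  lam-+ : ∀ n F F′ → lam n (F + F′) 𝕂.≈ lam n F 𝕂.+ lam n F′
  lam-+ n F F′ = 𝕂.trans (ε-cong (trans (word-cong (longestWord n) (distribʳ (Π n) F F′)) (word-+ (longestWord n) _ _))) (ev-+ _ _ _)

  lam-0 : ∀ n {F} → F ≈ 0# → lam n F 𝕂.≈ 𝕂.0#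
  lam-0 n e = ε-0 (trans (word-cong (longestWord n) (trans (*-congʳ e) (zeroˡ _))) (word-0 (longestWord n)))

  lam-C* : ∀ n x F → lam n (C x * F) 𝕂.≈ x 𝕂.* lam n F
  lam-C* n x F = 𝕂.trans (ε-cong (trans (word-cong (longestWord n) (*-assoc (C x) F (Π n))) (word-C (longestWord n) x _)))
    (𝕂.trans (ev-* _ (C x) _) (𝕂.*-congʳ (ev-C (const 𝕂.0#) x)))

  lam-const : ∀ n {e} F → Hom Any e F → e ℕ.+ degΠ n ≡ tri n → word (longestWord n) (F * Π n) ≈ C (lam n F)
  lam-const n F h eq = hom-const (hom-word (longestWord n) (hom-≡ (≡.trans eq
    (≡.sym (≡.trans (ℕₚ.+-identityʳ _) (length-longestWord n)))) (hom-* h (hom-Π n))))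

  blocks-deg : ∀ l r → (l ℕ.+ r) ℕ.+ (degΠ (suc l) ℕ.+ degΠ (suc r)) ≡ tri (suc l) ℕ.+ tri (suc r)
  blocks-deg l r = ≡.trans (interchange l r (degΠ (suc l)) (degΠ (suc r)))
    (≡.cong₂ ℕ._+_ (≡.trans (ℕₚ.+-comm l _) (degΠ-tri l)) (≡.trans (ℕₚ.+-comm r _) (degΠ-tri r)))

  -- κ l r is the q-binomial coefficient [l+r choose l], see κ-β.
  opaque
    κ : ℕ → ℕ → 𝕂.Carrier
    κ l r = ε (word (proj₁ (extend-blocks l r)) (cross l r))

    -- With y the product over pairs across the cut is complete, hence symmetric in each block, and
    -- it moves out of the block operators. These leave a constant by degree, so the completing word
    -- acts on `cross` alone and its value does not depend on F.
    split : ∀ l r F → Hom Any (l ℕ.+ r) F →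
      lam (suc l ℕ.+ suc r) (y l * F) 𝕂.≈ κ (suc l) (suc r) 𝕂.* ε (word (blocks (suc l) (suc r)) (F * (Π (suc l) * emb (suc l) (Π (suc r)))))
    split l′ r′ F h = 𝕂.begin
      ε (word (longestWord (l ℕ.+ r)) (y l′ * F * Π (l ℕ.+ r)))
        𝕂.≈⟨ ε-cong (begin
          word (longestWord (l ℕ.+ r)) (y l′ * F * Π (l ℕ.+ r))
            ≈⟨ proj₂ (extend-blocks l r) _ ⟩
          word g (word (blocks l r) (y l′ * F * Π (l ℕ.+ r)))
            ≈⟨ word-cong g (word-cong (blocks l r) (begin
                y l′ * F * Π (l ℕ.+ r)       ≈⟨ solve 3 (λ a b c → a :* b :* c := b :* (a :* c)) refl (y l′) F _ ⟩
                F * (y l′ * Π (l ℕ.+ r))     ≈⟨ *-congˡ (Π-split l′ r′) ⟩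
                F * (cross l r * rest)       ≈⟨ solve 3 (λ a b c → a :* (b :* c) := b :* (a :* c)) refl F (cross l r) rest ⟩
                cross l r * (F * rest)       ∎)) ⟩
          word g (word (blocks l r) (cross l r * (F * rest)))
            ≈⟨ word-cong g (word-*-sym (blocks l r) _ (All.map cross-sym (Allₚ.++⁺ (wordA-blocks l r) (wordB-blocks l r)))) ⟩
          word g (cross l r * word (blocks l r) (F * rest))
            ≈⟨ word-cong g (trans (*-congˡ (hom-const constant)) (*-comm _ _)) ⟩
          word g (C x * cross l r)
            ≈⟨ word-C g x _ ⟩
          C x * word g (cross l r) ∎) ⟩
      ε (C x * word g (cross l r))
        𝕂.≈⟨ 𝕂.trans (ev-* _ (C x) _) (𝕂.trans (𝕂.*-congʳ (ev-C (const 𝕂.0#) x)) (𝕂.*-comm _ _)) ⟩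
      κ l r 𝕂.* x 𝕂.∎
      where
      l r : ℕ
      l = suc l′
      r = suc r′
      g : List ℕ
      g = proj₁ (extend-blocks l r)
      rest : Poly
      rest = Π l * emb l (Π r)
      x : 𝕂.Carrier
      x = ε (word (blocks l r) (F * rest))
      constant : Hom Any 0 (word (blocks l r) (F * rest))
      constant = hom-word (blocks l r) (hom-≡
        (≡.trans (blocks-deg l′ r′) (≡.sym (≡.trans (ℕₚ.+-identityʳ _) (length-blocks l r))))
        (hom-* h (hom-* (hom-Π l) (hom-emb {W = Any} l (λ _ _ → tt) (hom-Π r)))))

  hom-Π-below : ∀ n → ∃[ d ] Hom (_< n) d (Π n)
  hom-Π-below n = go n (λ i → ∏ n (factor i)) (λ i i<n → go n (factor i) (λ j j<n → factor-Hom i j i<n j<n))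
    where
    go : ∀ m h → (∀ i → i < m → ∃[ d ] Hom (_< n) d (h i)) → ∃[ d ] Hom (_< n) d (∏ m h)
    go zero h hh = 0 , hom-C _
    go (suc m) h hh with hh 0 (s≤s z≤n) | go m (h ∘ suc) (λ i i<m → hh (suc i) (s≤s i<m))
    ... | d , h₀ | e , h₁ = d ℕ.+ e , hom-* h₀ h₁
    factor-Hom : ∀ i j → i < n → j < n → ∃[ d ] Hom (_< n) d (factor i j)
    factor-Hom i j i<n j<n with suc i ℕ.<? j
    ... | yes lt = 1 , hom-≈ (sym (factor-L lt)) (hom-minus (hom-C* q (hom-var i i<n)) (hom-var j j<n))
    ... | no ge = 0 , hom-≈ (sym (factor-1 (ℕₚ.≮⇒≥ ge))) (hom-C _)

  split-product : ∀ l r {g h} → Hom (_< suc l) l g → Hom Any r h →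
    lam (suc l ℕ.+ suc r) (y l * (g * emb (suc l) h)) 𝕂.≈ κ (suc l) (suc r) 𝕂.* (lam (suc l) g 𝕂.* lam (suc r) h)
  split-product l′ r′ {g} {h} gh hh = 𝕂.trans (split l′ r′ _ (hom-* (hom-any gh) (hom-emb {W = Any} l (λ _ _ → tt) hh))) (𝕂.*-congˡ (𝕂.begin
    ε (word (blocks l r) ((g * emb l h) * (Π l * emb l (Π r))))
      𝕂.≈⟨ ε-cong (trans (word-cong (blocks l r) (trans (solve 4 (λ a b c d → (a :* b) :* (c :* d) := (a :* c) :* (b :* d)) refl g (emb l h) (Π l) (emb l (Π r)))
             (*-congˡ (sym (emb.*-homo h (Π r)))))) (word-blocks l r (h * Π r) (hom-* gh (proj₂ (hom-Π-below l))))) ⟩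
    ε (word (longestWord l) (g * Π l) * emb l (word (longestWord r) (h * Π r)))
      𝕂.≈⟨ ev-* _ (word (longestWord l) (g * Π l)) _ ⟩
    lam l g 𝕂.* ε (emb l (word (longestWord r) (h * Π r)))
      𝕂.≈⟨ 𝕂.*-congˡ (𝕂.trans (ε-cong (trans (emb.cong (lam-const r h hh (≡.trans (ℕₚ.+-comm r′ _) (degΠ-tri r′)))) (emb.C-homo _))) (ev-C (const 𝕂.0#) _)) ⟩
    lam l g 𝕂.* lam r h 𝕂.∎))
    where
    l r : ℕ
    l = suc l′
    r = suc r′

  -- Apart from F and the `Π` of the left block every factor is symmetric in the left variables, and
  -- these two together have too small a degree for the left word. `vanish-B` is the same argument
  -- for the right block.
  vanish-A : ∀ l r {u e F} → Symmetric (wordA (suc l)) u → Hom Any e F → e < l → lam (suc l ℕ.+ suc r) (y l * (u * F)) 𝕂.≈ 𝕂.0#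
  vanish-A l′ r′ {u} {e} {F} su h e<l = ε-0 (begin
    word (longestWord (l ℕ.+ r)) (y l′ * (u * F) * Π (l ℕ.+ r))
      ≈⟨ proj₂ (extend-A l r) _ ⟩
    word g (word (wordA l) (y l′ * (u * F) * Π (l ℕ.+ r)))
      ≈⟨ word-cong g (word-cong (wordA l) (begin
          y l′ * (u * F) * Π (l ℕ.+ r)                      ≈⟨ solve 4 (λ y u f p → y :* (u :* f) :* p := u :* f :* (y :* p)) refl (y l′) u F _ ⟩
          u * F * (y l′ * Π (l ℕ.+ r))                      ≈⟨ *-congˡ (Π-split l′ r′) ⟩
          u * F * (cross l r * (Π l * emb l (Π r)))         ≈⟨ solve 5 (λ u f c p e → u :* f :* (c :* (p :* e)) := u :* (c :* (e :* (f :* p)))) refl u F (cross l r) (Π l) (emb l (Π r)) ⟩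
          u * (cross l r * (emb l (Π r) * (F * Π l)))       ∎)) ⟩
    word g (word (wordA l) (u * (cross l r * (emb l (Π r) * (F * Π l)))))
      ≈⟨ word-cong g (trans (word-*-sym (wordA l) _ su) (*-congˡ (trans (word-*-sym (wordA l) _ (All.map cross-sym (wordA-blocks l r)))
           (*-congˡ (word-*-sym (wordA l) _ (emb-symA l (Π r))))))) ⟩
    word g (u * (cross l r * (emb l (Π r) * word (wordA l) (F * Π l))))
      ≈⟨ word-cong g (trans (*-congˡ (trans (*-congˡ (trans (*-congˡ low) (zeroʳ _))) (zeroʳ _))) (zeroʳ _)) ⟩
    word g 0#
      ≈⟨ word-0 g ⟩
    0# ∎)
    where
    l r : ℕ
    l = suc l′
    r = suc r′
    g : List ℕ
    g = proj₁ (extend-A l r)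
    low : word (wordA l) (F * Π l) ≈ 0#
    low = word-low (wordA l) (≡.subst (e ℕ.+ degΠ l <_) (≡.trans (≡.trans (ℕₚ.+-comm l′ _) (degΠ-tri l′)) (≡.sym (length-longestWord l)))
      (ℕₚ.+-monoˡ-< (degΠ l) e<l)) (hom-* h (hom-Π l))

  vanish-B : ∀ l r {u e F} → Symmetric (wordB (suc l) (suc r)) u → Hom Any e F → e < r → lam (suc l ℕ.+ suc r) (y l * (u * F)) 𝕂.≈ 𝕂.0#
  vanish-B l′ r′ {u} {e} {F} su h e<r = ε-0 (begin
    word (longestWord (l ℕ.+ r)) (y l′ * (u * F) * Π (l ℕ.+ r))
      ≈⟨ proj₂ (extend-B l r) _ ⟩
    word g (word (wordB l r) (y l′ * (u * F) * Π (l ℕ.+ r)))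
      ≈⟨ word-cong g (word-cong (wordB l r) (begin
          y l′ * (u * F) * Π (l ℕ.+ r)                      ≈⟨ solve 4 (λ y u f p → y :* (u :* f) :* p := u :* f :* (y :* p)) refl (y l′) u F _ ⟩
          u * F * (y l′ * Π (l ℕ.+ r))                      ≈⟨ *-congˡ (Π-split l′ r′) ⟩
          u * F * (cross l r * (Π l * emb l (Π r)))         ≈⟨ solve 5 (λ u f c p e → u :* f :* (c :* (p :* e)) := u :* (c :* (p :* (f :* e)))) refl u F (cross l r) (Π l) (emb l (Π r)) ⟩
          u * (cross l r * (Π l * (F * emb l (Π r))))       ∎)) ⟩
    word g (word (wordB l r) (u * (cross l r * (Π l * (F * emb l (Π r))))))
      ≈⟨ word-cong g (trans (word-*-sym (wordB l r) _ su) (*-congˡ (trans (word-*-sym (wordB l r) _ (All.map cross-sym (wordB-blocks l r)))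
           (*-congˡ (word-*-sym (wordB l r) _ (below-symB l r (proj₂ (hom-Π-below l)))))))) ⟩
    word g (u * (cross l r * (Π l * word (wordB l r) (F * emb l (Π r)))))
      ≈⟨ word-cong g (trans (*-congˡ (trans (*-congˡ (trans (*-congˡ low) (zeroʳ _))) (zeroʳ _))) (zeroʳ _)) ⟩
    word g 0#
      ≈⟨ word-0 g ⟩
    0# ∎)
    where
    l r : ℕ
    l = suc l′
    r = suc r′
    g : List ℕ
    g = proj₁ (extend-B l r)
    low : word (wordB l r) (F * emb l (Π r)) ≈ 0#
    low = word-low (wordB l r) (≡.subst (e ℕ.+ degΠ r <_) (≡.trans (≡.trans (ℕₚ.+-comm r′ _) (degΠ-tri r′)) (≡.sym (length-wordB l r)))
      (ℕₚ.+-monoˡ-< (degΠ r) e<r)) (hom-* h (hom-emb {W = Any} l (λ _ _ → tt) (hom-Π r)))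

  -- By the Leibniz rule, packed into `killed-*`, multiplication by h and by the two `Π` cannot
  -- create a constant term when f has none under any word in the letters of the two blocks.
  vanish-killed : ∀ l r {e h f} → Hom Any e h → Hom Any (l ℕ.+ r) (h * f) → (∀ d → Killed (InBlocks (suc l) (suc r)) d f) →
    lam (suc l ℕ.+ suc r) (y l * (h * f)) 𝕂.≈ 𝕂.0#
  vanish-killed l′ r′ {h = h} {f} hh hf killed = 𝕂.trans (split l′ r′ (h * f) hf) (𝕂.trans (𝕂.*-congˡ
    (killed-word {InBlocks l r} 0 (blocks l r) (Allₚ.++⁺ (wordA-blocks l r) (wordB-blocks l r))
      (killed-≈ {InBlocks l r} (length (blocks l r) ℕ.+ 0) (solve 3 (λ h p f → (h :* p) :* f := h :* f :* p) refl h rest f) (killed-* {InBlocks l r} {Any} (length (blocks l r) ℕ.+ 0) (hom-* hh (hom-* (hom-Π l) (hom-emb {W = Any} l (λ _ _ → tt) (hom-Π r)))) killed))))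
    (𝕂.zeroʳ _))
    where
    l r : ℕ
    l = suc l′
    r = suc r′
    rest : Poly
    rest = Π l * emb l (Π r)

  vanish-symmetric : ∀ n {u e F} → Symmetric (longestWord (suc n)) u → Hom Any e F → e < n → lam (suc n) (u * F) 𝕂.≈ 𝕂.0#
  vanish-symmetric n {u} {e} {F} su h e<n = ε-0 (begin
    word w (u * F * Π (suc n))      ≈⟨ word-cong w (*-assoc u F _) ⟩
    word w (u * (F * Π (suc n)))    ≈⟨ word-*-sym w _ su ⟩
    u * word w (F * Π (suc n))      ≈⟨ trans (*-congˡ (word-low w (≡.subst (e ℕ.+ degΠ (suc n) <_)
                                         (≡.trans (≡.trans (ℕₚ.+-comm n _) (degΠ-tri n)) (≡.sym (length-longestWord (suc n)))) (ℕₚ.+-monoˡ-< (degΠ (suc n)) e<n))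
                                         (hom-* h (hom-Π (suc n))))) (zeroʳ u) ⟩
    0#                              ∎)
    where
    w : List ℕ
    w = longestWord (suc n)

-- q-integers and q-binomial coefficients

module Gaussian {c ℓ} (K : CommutativeRing c ℓ) (q : CommutativeRing.Carrier K) where
  open CommutativeRing K
  open SetoidReasoning setoid
  open IntegerSolver K

  num : ℕ → Carrier
  num zero = 0#
  num (suc n) = 1# + q * num n

  num-1 : num 1 ≈ 1#
  num-1 = trans (+-congˡ (zeroʳ q)) (+-identityʳ 1#)

  num-+ : ∀ m n → num (m ℕ.+ n) ≈ num m + Defs.pow K q m * num n
  num-+ zero n = solve 1 (λ x → x := con (+ 0) :+ con (+ 1) :* x) refl (num n)
  num-+ (suc m) n = trans (+-congˡ (*-congˡ (num-+ m n)))
    (solve 4 (λ q a p b → con (+ 1) :+ q :* (a :+ p :* b) := (con (+ 1) :+ q :* a) :+ (q :* p) :* b) refl q (num m) (Defs.pow K q m) (num n))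

  -- β n i is the q-binomial coefficient [n+i−1 choose i].
  β : ℕ → ℕ → Carrier
  β zero zero = 1#
  β zero (suc i) = 0#
  β (suc n) zero = 1#
  β (suc n) (suc i) = β (suc n) i + Defs.pow K q (suc i) * β n (suc i)

  β-zero : ∀ n → β n 0 ≈ 1#
  β-zero zero = refl
  β-zero (suc n) = refl

  β-one : ∀ i → β 1 i ≈ 1#
  β-one zero = refl
  β-one (suc i) = trans (+-cong (β-one i) (zeroʳ _)) (+-identityʳ 1#)

  num-+-comm : ∀ m n → num m + Defs.pow K q m * num n ≈ num (n ℕ.+ m)
  num-+-comm m n = trans (sym (num-+ m n)) (reflexive (≡.cong num (ℕₚ.+-comm m n)))

  mutual
    -- The two quotient rules for q-binomial coefficients, cross-multiplied because q-integers are
    -- not assumed cancellable here. Either rule follows from the Pascal recursion in the definition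
    -- of β once both are known for the smaller index.
    β-suc-n : ∀ n i → num n * β (suc n) i ≈ num (n ℕ.+ i) * β n i
    β-suc-n n zero = *-cong (reflexive (≡.cong num (≡.sym (ℕₚ.+-identityʳ n)))) (sym (β-zero n))
    β-suc-n n (suc i) = begin
      num n * (β (suc n) i + p * b)                ≈⟨ solve 4 (λ a x p b → a :* (x :+ p :* b) := a :* x :+ (p :* a) :* b) refl (num n) (β (suc n) i) p b ⟩
      num n * β (suc n) i + (p * num n) * b        ≈⟨ +-congʳ (trans (β-suc-n n i) (sym (β-suc-i n i))) ⟩
      num (suc i) * b + (p * num n) * b            ≈⟨ distribʳ b _ _ ⟨
      (num (suc i) + p * num n) * b                ≈⟨ *-congʳ (num-+-comm (suc i) n) ⟩
      num (n ℕ.+ suc i) * b                        ∎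
      where
      p b : Carrier
      p = Defs.pow K q (suc i)
      b = β n (suc i)

    β-suc-i : ∀ n i → num (suc i) * β n (suc i) ≈ num (n ℕ.+ i) * β n i
    β-suc-i zero zero = trans (zeroʳ _) (sym (zeroˡ _))
    β-suc-i zero (suc i) = trans (zeroʳ _) (sym (zeroʳ _))
    β-suc-i (suc n) i = begin
      num (suc i) * (b + p * β n (suc i))                ≈⟨ solve 4 (λ a b p x → a :* (b :+ p :* x) := a :* b :+ p :* (a :* x)) refl (num (suc i)) b p (β n (suc i)) ⟩
      num (suc i) * b + p * (num (suc i) * β n (suc i))  ≈⟨ +-congˡ (*-congˡ (trans (β-suc-i n i) (sym (β-suc-n n i)))) ⟩
      num (suc i) * b + p * (num n * b)                  ≈⟨ solve 4 (λ a b p x → a :* b :+ p :* (x :* b) := (a :+ p :* x) :* b) refl (num (suc i)) b p (num n) ⟩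
      (num (suc i) + p * num n) * b                      ≈⟨ *-congʳ (num-+-comm (suc i) n) ⟩
      num (n ℕ.+ suc i) * b                              ≡⟨ ≡.cong (λ m → num m * b) (ℕₚ.+-suc n i) ⟩
      num (suc n ℕ.+ i) * b                              ∎
      where
      p b : Carrier
      p = Defs.pow K q (suc i)
      b = β (suc n) i

-- Normalisation of λ and the constants κ

module Constants {c ℓ} (K : CommutativeRing c ℓ) (nontrivial : ¬ (CommutativeRing._≈_ K (CommutativeRing.1# K) (CommutativeRing.0# K)))
  (q : CommutativeRing.Carrier K)
  (cancel : ∀ n {x y} → CommutativeRing._≈_ K (CommutativeRing._*_ K (Gaussian.num K q (suc n)) x) (CommutativeRing._*_ K (Gaussian.num K q (suc n)) y) → CommutativeRing._≈_ K x y) where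
  open Functional K nontrivial q public
  open Gaussian K q public
  open CommutativeRing PR
  open SetoidReasoning setoid
  open IntegerSolver PR
  open Products PR

  -- The step replaces q x_k by y_k + x_{k+1}; the identity that starts at x_{k+1} then takes over,
  -- and for this the starting index has to vary.
  num-X : ∀ M k → C (num (suc M)) * X k ≈ ∑ M (λ l → C (num (M ∸ l)) * y (k ℕ.+ l)) + ∑ (suc M) (λ m → X (k ℕ.+ m))
  num-X zero k = begin
    C (num 1) * X k          ≈⟨ trans (*-congʳ (C-cong num-1)) (*-identityˡ _) ⟩
    X k                      ≡⟨ ≡.cong X (≡.sym (ℕₚ.+-identityʳ k)) ⟩
    X (k ℕ.+ 0)              ≈⟨ solve 1 (λ x → x := con (+ 0) :+ (x :+ con (+ 0))) refl _ ⟩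
    0# + (X (k ℕ.+ 0) + 0#)  ∎
  num-X (suc M) k = begin
    C (𝕂.1# 𝕂.+ q 𝕂.* num (suc M)) * X k
      ≈⟨ *-congʳ (trans (C-+ _ _) (+-congˡ (C-* q _))) ⟩
    (1# + C q * c′) * X k
      ≈⟨ solve 4 (λ q c x x′ → (con (+ 1) :+ q :* c) :* x := c :* (q :* x :- x′) :+ (c :* x′ :+ x)) refl (C q) c′ (X k) (X (suc k)) ⟩
    c′ * y k + (c′ * X (suc k) + X k)
      ≈⟨ +-congˡ (+-congʳ (num-X M (suc k))) ⟩
    c′ * y k + ((∑ M (λ l → C (num (M ∸ l)) * y (suc k ℕ.+ l)) + ∑ (suc M) (λ m → X (suc k ℕ.+ m))) + X k)
      ≈⟨ solve 4 (λ a s t x → a :+ ((s :+ t) :+ x) := (a :+ s) :+ (x :+ t)) refl (c′ * y k) _ _ (X k) ⟩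
    (c′ * y k + ∑ M (λ l → C (num (M ∸ l)) * y (suc k ℕ.+ l))) + (X k + ∑ (suc M) (λ m → X (suc k ℕ.+ m)))
      ≈⟨ +-cong (+-cong (reflexive (≡.cong (λ m → c′ * y m) (≡.sym (ℕₚ.+-identityʳ k))))
                  (∑-cong M (λ l _ → reflexive (≡.cong (λ m → C (num (M ∸ l)) * y m) (≡.sym (ℕₚ.+-suc k l))))))
                (+-cong (reflexive (≡.cong X (≡.sym (ℕₚ.+-identityʳ k)))) (∑-cong (suc M) (λ m _ → reflexive (≡.cong X (≡.sym (ℕₚ.+-suc k m)))))) ⟩
    ∑ (suc M) (λ l → C (num (suc M ∸ l)) * y (k ℕ.+ l)) + ∑ (suc (suc M)) (λ m → X (k ℕ.+ m)) ∎
    where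
    c′ : Poly
    c′ = C (num (suc M))

  lam-∑ : ∀ N n h → lam N (∑ n h) 𝕂.≈ 𝕂.∑ n (lam N ∘ h)
  lam-∑ N zero h = lam-0 N refl
  lam-∑ N (suc n) h = 𝕂.trans (lam-+ N _ _) (𝕂.+-congˡ (lam-∑ N n (h ∘ suc)))

  ∑-*ʳ : ∀ n h g → ∑ n h * g ≈ ∑ n (λ k → h k * g)
  ∑-*ʳ n h g = trans (*-comm _ g) (trans (sym (∑-* n g h)) (∑-cong n (λ k _ → *-comm g (h k))))

  lam-num : ∀ n {g} → Hom Any n g →
    num (suc (suc n)) 𝕂.* lam (suc (suc n)) (X 0 * g) 𝕂.≈ 𝕂.∑ (suc n) (λ l → num (suc n ∸ l) 𝕂.* lam (suc (suc n)) (y l * g))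
  lam-num n {g} hg = 𝕂.begin
    num N 𝕂.* lam N (X 0 * g)
      𝕂.≈⟨ lam-C* N _ _ ⟨
    lam N (C (num N) * (X 0 * g))
      𝕂.≈⟨ lam-cong N (trans (sym (*-assoc _ _ g)) (trans (*-congʳ (num-X (suc n) 0)) (trans (distribʳ g _ _) (+-congʳ (∑-*ʳ (suc n) (λ l → C (num (suc n ∸ l)) * y l) g))))) ⟩
    lam N (∑ (suc n) (λ l → C (num (suc n ∸ l)) * y l * g) + ∑ N X * g)
      𝕂.≈⟨ 𝕂.trans (lam-+ N _ _) (𝕂.trans (𝕂.+-congˡ (vanish-symmetric (suc n) total-symmetric hg (ℕₚ.n<1+n n))) (𝕂.+-identityʳ _)) ⟩
    lam N (∑ (suc n) (λ l → C (num (suc n ∸ l)) * y l * g))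
      𝕂.≈⟨ lam-∑ N (suc n) (λ l → C (num (suc n ∸ l)) * y l * g) ⟩
    𝕂.∑ (suc n) (λ l → lam N (C (num (suc n ∸ l)) * y l * g))
      𝕂.≈⟨ 𝕂.∑-cong (suc n) (λ l _ → 𝕂.trans (lam-cong N (*-assoc (C (num (suc n ∸ l))) (y l) g)) (lam-C* N (num (suc n ∸ l)) (y l * g))) ⟩
    𝕂.∑ (suc n) (λ l → num (suc n ∸ l) 𝕂.* lam N (y l * g)) 𝕂.∎
    where
    N : ℕ
    N = suc (suc n)
    total-symmetric : Symmetric (longestWord N) (∑ N X)
    total-symmetric = All.map (λ {i} lt → trans (hom-∑ (s-isHom i) N X) (trans (∑-cong N (λ k _ → s-X i k)) (∑-swap N i X lt))) (longestWord-letters N)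

  up-++ : ∀ k a b → up k (a ℕ.+ b) ≡ up k a ++ up (k ℕ.+ a) b
  up-++ k zero b = ≡.cong (λ m → up m b) (≡.sym (ℕₚ.+-identityʳ k))
  up-++ k (suc a) b = ≡.cong (k ∷_) (≡.trans (up-++ (suc k) a b) (≡.cong (λ m → up (suc k) a ++ up m b) (≡.sym (ℕₚ.+-suc k a))))

  up-∷ʳ : ∀ n → up 0 (suc n) ≡ up 0 n ++ (n ∷ [])
  up-∷ʳ n = ≡.trans (≡.cong (up 0) (ℕₚ.+-comm 1 n)) (up-++ 0 n 1)

  up-bounds : ∀ k d → All (λ i → k ≤ i × i < k ℕ.+ d) (up k d)
  up-bounds k zero = []
  up-bounds k (suc d) = (ℕₚ.≤-refl , ℕₚ.m<m+n k (s≤s z≤n)) ∷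
    All.map (λ { {i} (lo , hi) → ℕₚ.<⇒≤ lo , ≡.subst (i <_) (≡.sym (ℕₚ.+-suc k d)) hi }) (up-bounds (suc k) d)

  up-fixes : ∀ {M} k → M < k → Symmetric (up 0 M) (X k)
  up-fixes {M} k M<k = All.map (λ { {i} (_ , i<M) → s-X-≡ i k (sFun-other (ℕₚ.>⇒≢ (ℕₚ.<-trans i<M M<k)) (ℕₚ.>⇒≢ (ℕₚ.≤-<-trans i<M M<k))) }) (up-bounds 0 M)

  up-low : ∀ M {d p} → d < M → Hom Any d p → word (up 0 M) p ≈ 0#
  up-low M {d} d<M h = word-low (up 0 M) (≡.subst (d <_) (≡.sym (length-up 0 M)) d<M) h

  sign : ℕ → 𝕂.Carrier
  sign zero = 𝕂.1#
  sign (suc n) = 𝕂.- sign n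

  pow-symmetric : ∀ {w p} n → Symmetric w p → Symmetric w (Defs.pow PR p n)
  pow-symmetric {p = p} n = All.map (λ {i} sp → trans (s.pow-homo p n) (PE.pow-cong n sp))

  -- Up to sign the divided difference is the sum of all monomials of degree e in x_M and x_{M+1}. A
  -- power of x_{M+1} is invariant under the letters below M, and the power of x_M beside it is then
  -- too low for the word; only x_M^e is left.
  ∂-pow-descend : ∀ M e j → e ℕ.+ j ≡ M → word (up 0 M) (∂ M (X^ (suc M) (suc e)) * X^ M j) ≈ - word (up 0 M) (X^ M M)
  ∂-pow-descend M zero .M ≡.refl = begin
    word (up 0 M) (∂ M (X (suc M) * 1#) * X^ M M)    ≈⟨ word-cong (up 0 M) (*-congʳ (trans (∂-cong M (*-identityʳ _)) (trans (∂-X-suc M) (sym (C-neg 𝕂.1#))))) ⟩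
    word (up 0 M) (C (𝕂.- 𝕂.1#) * X^ M M)            ≈⟨ word-C (up 0 M) _ _ ⟩
    C (𝕂.- 𝕂.1#) * word (up 0 M) (X^ M M)            ≈⟨ trans (*-congʳ (C-neg 𝕂.1#)) (solve 1 (λ x → (:- con (+ 1)) :* x := :- x) refl _) ⟩
    - word (up 0 M) (X^ M M)                         ∎
  ∂-pow-descend M (suc e) j eq = begin
    word (up 0 M) (∂ M (X (suc M) * P) * X^ M j)
      ≈⟨ word-cong (up 0 M) (*-congʳ (trans (leibniz M (X (suc M)) P) (+-cong (*-congʳ (trans (∂-X-suc M) (sym (C-neg 𝕂.1#)))) (*-congʳ (s-X-≡ M (suc M) (sFun-right M)))))) ⟩
    word (up 0 M) ((C (𝕂.- 𝕂.1#) * P + X M * ∂ M P) * X^ M j)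
      ≈⟨ trans (word-cong (up 0 M) (solve 5 (λ c p x d u → (c :* p :+ x :* d) :* u := p :* (c :* u) :+ d :* (x :* u)) refl (C (𝕂.- 𝕂.1#)) P (X M) (∂ M P) (X^ M j))) (word-+ (up 0 M) _ _) ⟩
    word (up 0 M) (P * (C (𝕂.- 𝕂.1#) * X^ M j)) + word (up 0 M) (∂ M P * X^ M (suc j))
      ≈⟨ +-cong (trans (word-*-sym (up 0 M) _ (pow-symmetric (suc e) (up-fixes (suc M) (ℕₚ.n<1+n M))))
                  (trans (*-congˡ (up-low M (≡.subst (j <_) eq (s≤s (ℕₚ.m≤n+m j e))) (hom-C* _ (hom-pow-X j M tt)))) (zeroʳ P)))
                (∂-pow-descend M e (suc j) (≡.trans (ℕₚ.+-suc e j) eq)) ⟩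
    0# + - word (up 0 M) (X^ M M)
      ≈⟨ +-identityˡ _ ⟩
    - word (up 0 M) (X^ M M) ∎
    where
    P : Poly
    P = X^ (suc M) (suc e)

  word-up-pow : ∀ M → word (up 0 M) (X^ M M) ≈ C (sign M)
  word-up-pow zero = refl
  word-up-pow (suc M) = begin
    word (up 0 (suc M)) (X^ (suc M) (suc M))                   ≡⟨ ≡.trans (≡.cong (λ w → word w (X^ (suc M) (suc M))) (up-∷ʳ M)) (word-++ (up 0 M) (M ∷ []) _) ⟩
    word (up 0 M) (∂ M (X^ (suc M) (suc M)))                   ≈⟨ word-cong (up 0 M) (*-identityʳ _) ⟨
    word (up 0 M) (∂ M (X^ (suc M) (suc M)) * 1#)              ≈⟨ ∂-pow-descend M M 0 (ℕₚ.+-identityʳ M) ⟩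
    - word (up 0 M) (X^ M M)                                   ≈⟨ -‿cong (word-up-pow M) ⟩
    - C (sign M)                                               ≈⟨ C-neg _ ⟨
    C (sign (suc M))                                           ∎

  hom-word-closed : ∀ {V d p} w → All (Closed V) w → Hom V (length w ℕ.+ d) p → Hom V d (word w p)
  hom-word-closed [] [] h = h
  hom-word-closed {d = d} (i ∷ w) (cl ∷ cls) h = hom-∂ i cl (hom-word-closed w cls (hom-≡ (≡.sym (ℕₚ.+-suc (length w) d)) h))

  -- Up to sign, a stage in expanding the product of the q x_a - x_M: in the first e factors -x_M
  -- has been chosen, and the following m factors are still unexpanded.
  partial : ℕ → ℕ → ℕ → Poly
  partial e m M = X^ M e * ∏ m (λ a → L (e ℕ.+ a) M)

  -- The letters above e do not move x_e. The letter e either removes x_e, leaving a polynomial that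
  -- the e smaller letters cannot change and therefore send to zero, or turns it into x_{e+1} beside
  -- a form of degree e-1, too low for those e letters. Both arguments require e ≥ 1.
  word-up-X : ∀ e′ m M {h} (let e = suc e′) → M ≡ e ℕ.+ suc m → Hom (e <_) (e ℕ.+ m) h → word (up 0 M) (X e * h) ≈ 0#
  word-up-X e′ m M {h} M≡ hh = begin
    word (up 0 M) (X e * h)
      ≡⟨ ≡.trans (≡.cong (λ w → word w (X e * h)) (≡.trans (≡.cong (up 0) M≡) (up-++ 0 e (suc m)))) (word-++ (up 0 e) (e ∷ up (suc e) m) _) ⟩
    word (up 0 e) (∂ e (word (up (suc e) m) (X e * h)))
      ≈⟨ word-cong (up 0 e) (∂-cong e (word-*-sym (up (suc e) m) h (All.map (λ { {i} (lo , _) → s-X-≡ i e (sFun-other (ℕₚ.<⇒≢ lo) (ℕₚ.<⇒≢ (ℕₚ.<-trans lo (ℕₚ.n<1+n i)))) }) (up-bounds (suc e) m)))) ⟩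
    word (up 0 e) (∂ e (X e * z))
      ≈⟨ word-cong (up 0 e) (trans (leibniz e (X e) z) (+-cong (trans (*-congʳ (∂-X e)) (*-comm 1# z)) (*-congʳ (s-X-≡ e e (sFun-left e))))) ⟩
    word (up 0 e) (z * 1# + X (suc e) * ∂ e z)
      ≈⟨ trans (word-+ (up 0 e) _ _) (+-cong
           (trans (word-*-sym (up 0 e) 1# z-symmetric) (trans (*-congˡ (up-low e (s≤s z≤n) (hom-C 𝕂.1#))) (zeroʳ z)))
           (trans (word-*-sym (up 0 e) _ (up-fixes (suc e) (ℕₚ.n<1+n e))) (trans (*-congˡ (up-low e (ℕₚ.n<1+n e′) (hom-∂ e (λ _ _ → tt) (hom-any z-hom)))) (zeroʳ _)))) ⟩
    0# + 0#
      ≈⟨ +-identityˡ 0# ⟩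
    0# ∎
    where
    e : ℕ
    e = suc e′
    z : Poly
    z = word (up (suc e) m) h
    closed : ∀ {i} → suc e ≤ i → Closed (e <_) i
    closed {i} lo k e<k with sView i k
    ... | left rewrite sFun-left i = ℕₚ.<-trans lo (ℕₚ.n<1+n i)
    ... | right rewrite sFun-right i = lo
    ... | other a b rewrite sFun-other a b = e<k
    z-hom : Hom (e <_) e z
    z-hom = hom-word-closed (up (suc e) m) (All.map (λ b → closed (proj₁ b)) (up-bounds (suc e) m))
      (hom-≡ (≡.trans (ℕₚ.+-comm e m) (≡.cong (ℕ._+ e) (≡.sym (length-up (suc e) m)))) hh)
    z-symmetric : Symmetric (up 0 e) z
    z-symmetric = All.map (λ { {i} (_ , i<e) → s-fixes i (λ k e<k → sFun-other (ℕₚ.>⇒≢ (ℕₚ.<-trans i<e e<k)) (ℕₚ.>⇒≢ (ℕₚ.≤-<-trans i<e e<k))) z-hom }) (up-bounds 0 e)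

  partial-suc : ∀ e m M → partial e (suc m) M ≈ C q * (X e * (X^ M e * ∏ m (λ a → L (suc e ℕ.+ a) M))) - partial (suc e) m M
  partial-suc e m M = begin
    X^ M e * (L (e ℕ.+ 0) M * ∏ m (λ a → L (e ℕ.+ suc a) M))
      ≈⟨ *-congˡ (*-cong (reflexive (≡.cong (λ k → L k M) (ℕₚ.+-identityʳ e))) (∏-cong m (λ a _ → reflexive (≡.cong (λ k → L k M) (ℕₚ.+-suc e a))))) ⟩
    X^ M e * (L e M * P)
      ≈⟨ solve 5 (λ u q x z p → u :* ((q :* x :- z) :* p) := q :* (x :* (u :* p)) :- (z :* u) :* p) refl (X^ M e) (C q) (X e) (X M) P ⟩
    C q * (X e * (X^ M e * P)) - partial (suc e) m M ∎
    where
    P : Poly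
    P = ∏ m (λ a → L (suc e ℕ.+ a) M)

  word-up-partial : ∀ m e M → M ≡ suc e ℕ.+ m → word (up 0 M) (partial (suc e) m M) ≈ C (sign (suc e))
  word-up-partial zero e M M≡ rewrite ≡.trans M≡ (ℕₚ.+-identityʳ (suc e)) =
    trans (word-cong (up 0 (suc e)) (*-identityʳ _)) (word-up-pow (suc e))
  word-up-partial (suc m) e M M≡ = begin
    word (up 0 M) (partial (suc e) (suc m) M)
      ≈⟨ trans (word-cong (up 0 M) (partial-suc (suc e) m M)) (word-+ (up 0 M) _ _) ⟩
    word (up 0 M) (C q * (X (suc e) * h)) + word (up 0 M) (- partial (suc (suc e)) m M)
      ≈⟨ +-cong (trans (word-C (up 0 M) q _) (trans (*-congˡ (word-up-X e m M M≡ h-hom)) (zeroʳ _))) (word-neg (up 0 M) _) ⟩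
    0# + - word (up 0 M) (partial (suc (suc e)) m M)
      ≈⟨ trans (+-identityˡ _) (-‿cong (trans (word-up-partial m (suc e) M (≡.trans M≡ (ℕₚ.+-suc (suc e) m))) (C-neg _))) ⟩
    - - C (sign (suc e))
      ≈⟨ solve 1 (λ x → :- :- x := x) refl _ ⟩
    C (sign (suc e)) ∎
    where
    h : Poly
    h = X^ M (suc e) * ∏ m (λ a → L (suc (suc e) ℕ.+ a) M)
    word-neg : ∀ w p → word w (- p) ≈ - word w p
    word-neg [] p = refl
    word-neg (i ∷ w) p = trans (∂-cong i (word-neg w p)) (∂-neg i _)
    e<M : suc e < M
    e<M = ≡.subst (suc e <_) (≡.sym M≡) (ℕₚ.m<m+n (suc e) (s≤s z≤n))
    h-hom : Hom (suc e <_) (suc e ℕ.+ m) h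
    h-hom = hom-* (hom-pow-X (suc e) M e<M) (∏-Hom m (λ a _ → hom-minus (hom-C* q (hom-var _ (s≤s (s≤s (ℕₚ.m≤m+n e a))))) (hom-var M e<M)))

  -- This is the source of the q-integer. Expanding the factor with a = 0, the part with q x_0
  -- yields q[M+1] by induction in the shifted variables, and the other part yields the summand 1 by
  -- `word-up-partial`.
  word-up-cross : ∀ M → word (up 0 M) (∏ M (λ a → L a M)) ≈ C (num (suc M))
  word-up-cross zero = C-cong (𝕂.sym num-1)
  word-up-cross (suc M) = begin
    word (up 0 (suc M)) (∏ (suc M) (λ a → L a (suc M)))
      ≈⟨ word-cong (up 0 (suc M)) (trans (sym (*-identityˡ _)) (partial-suc 0 M (suc M))) ⟩
    word (up 0 (suc M)) (C q * (X 0 * (1# * h)) - partial 1 M (suc M))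
      ≈⟨ word-cong (up 0 (suc M)) (+-cong (*-congˡ (*-congˡ (*-identityˡ h))) (trans (solve 1 (λ x → :- x := (:- con (+ 1)) :* x) refl _) (*-congʳ (sym (C-neg 𝕂.1#))))) ⟩
    word (up 0 (suc M)) (C q * (X 0 * h) + C (𝕂.- 𝕂.1#) * partial 1 M (suc M))
      ≈⟨ trans (word-+ (up 0 (suc M)) _ _) (+-cong (word-C (up 0 (suc M)) q _) (word-C (up 0 (suc M)) _ _)) ⟩
    C q * word (up 0 (suc M)) (X 0 * h) + C (𝕂.- 𝕂.1#) * word (up 0 (suc M)) (partial 1 M (suc M))
      ≈⟨ +-cong (*-congˡ first) (*-congˡ (word-up-partial M 0 (suc M) ≡.refl)) ⟩
    C q * C (num (suc M)) + C (𝕂.- 𝕂.1#) * C (𝕂.- 𝕂.1#)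
      ≈⟨ +-cong (C-* q _) (C-* _ _) ⟨
    C (q 𝕂.* num (suc M)) + C (𝕂.- 𝕂.1# 𝕂.* 𝕂.- 𝕂.1#)
      ≈⟨ C-+ _ _ ⟨
    C (q 𝕂.* num (suc M) 𝕂.+ 𝕂.- 𝕂.1# 𝕂.* 𝕂.- 𝕂.1#)
      ≈⟨ C-cong (𝕂.solve 2 (λ q x → q 𝕂.:* x 𝕂.:+ (𝕂.:- 𝕂.con (+ 1)) 𝕂.:* (𝕂.:- 𝕂.con (+ 1)) 𝕂.:= 𝕂.con (+ 1) 𝕂.:+ q 𝕂.:* x) 𝕂.refl q (num (suc M))) ⟩
    C (num (suc (suc M))) ∎
    where
    h : Poly
    h = ∏ M (λ a → L (suc a) (suc M))
    first : word (up 0 (suc M)) (X 0 * h) ≈ C (num (suc M))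
    first = begin
      ∂ 0 (word (up 1 M) (X 0 * h))
        ≡⟨ ≡.cong (λ w → ∂ 0 (word w (X 0 * h))) (map-suc-up 0 M) ⟨
      ∂ 0 (word (map suc (up 0 M)) (X 0 * h))
        ≈⟨ ∂-cong 0 (word-cong (map suc (up 0 M)) (*-cong (sym (*-identityʳ (X 0)))
             (sym (trans (hom-∏ (emb-isHom 1) M _) (∏-cong M (λ a _ → hom-L (emb-isHom 1) {a} {M} {suc a} {suc M} (emb-X 1 a) (emb-X 1 M))))))) ⟩
      ∂ 0 (word (map suc (up 0 M)) (X^ 0 1 * emb 1 (∏ M (λ a → L a M))))
        ≈⟨ ∂-cong 0 (trans (word-emb-1 (up 0 M) 1 _) (trans (*-congˡ (trans (emb.cong (word-up-cross M)) (emb.C-homo _))) (*-comm _ _))) ⟩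
      ∂ 0 (C (num (suc M)) * X^ 0 1)
        ≈⟨ ∂-C 0 _ _ ⟩
      C (num (suc M)) * ∂ 0 (X 0 * 1#)
        ≈⟨ trans (*-congˡ (trans (∂-cong 0 (*-identityʳ (X 0))) (∂-X 0))) (*-identityʳ _) ⟩
      C (num (suc M)) ∎

  sign-nonzero : ∀ n → ¬ (sign n 𝕂.≈ 𝕂.0#)
  sign-nonzero zero = nontrivial
  sign-nonzero (suc n) e = sign-nonzero n (𝕂.trans (𝕂.sym (𝕂.-‿involutive _)) (𝕂.trans (𝕂.-‿cong e) 𝕂.-0#≈0#))

  Π-1 : Π 1 ≈ 1#
  Π-1 = trans (*-identityʳ _) (trans (*-identityʳ _) (factor-1 z≤n))

  -- When the second block has a single variable, the completing word is explicit, so its constant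
  -- can be computed. The polynomial x_l^l times the staircase is sent to a sign, which certifies
  -- this word of the right length as reduced.
  longestWord-up : ∀ l F → word (longestWord (l ℕ.+ 1)) F ≈ word (up 0 l) (word (longestWord l) F)
  longestWord-up l F = begin
    word (longestWord (l ℕ.+ 1)) F          ≈⟨ longestWord-climb (l ℕ.+ 1) F ⟩
    climbTop (l ℕ.+ 1) id F                 ≈⟨ word-longest (l ℕ.+ 1) w letters lengths (X^ l l * D l) nonzero F ⟨
    word w F                                ≡⟨ word-++ (up 0 l) (longestWord l) F ⟩
    word (up 0 l) (word (longestWord l) F)  ∎
    where
    w : List ℕ
    w = up 0 l ++ longestWord l
    letters : Letters (l ℕ.+ 1) w
    letters = Allₚ.++⁺ (All.map (λ { {i} (_ , i<l) → ≡.subst (suc i <_) (ℕₚ.+-comm 1 l) (s≤s i<l) }) (up-bounds 0 l))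
      (All.map (λ i<l → ℕₚ.<-≤-trans i<l (ℕₚ.m≤m+n l 1)) (longestWord-letters l))
    lengths : length w ≡ tri (l ℕ.+ 1)
    lengths = ≡.trans (Listₚ.length-++ (up 0 l)) (≡.trans (≡.cong₂ ℕ._+_ (length-up 0 l) (length-longestWord l)) (≡.cong tri (ℕₚ.+-comm 1 l)))
    X-symmetric : Symmetric (longestWord l) (X^ l l)
    X-symmetric = pow-symmetric l (All.map (λ {i} i<l → s-X-≡ i l (sFun-other (ℕₚ.>⇒≢ (ℕₚ.<-trans (ℕₚ.n<1+n i) i<l)) (ℕₚ.>⇒≢ i<l))) (longestWord-letters l))
    value : word w (X^ l l * D l) ≈ C (sign l)
    value = begin
      word w (X^ l l * D l)                               ≡⟨ word-++ (up 0 l) (longestWord l) _ ⟩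
      word (up 0 l) (word (longestWord l) (X^ l l * D l)) ≈⟨ word-cong (up 0 l) (trans (word-*-sym (longestWord l) (D l) X-symmetric) (trans (*-congˡ (word-longestWord-D l)) (*-identityʳ _))) ⟩
      word (up 0 l) (X^ l l)                              ≈⟨ word-up-pow l ⟩
      C (sign l)                                          ∎
    nonzero : ¬ (word w (X^ l l * D l) ≈ 0#)
    nonzero e = sign-nonzero l (𝕂.trans (𝕂.sym (ev-C (const 𝕂.0#) _)) (ε-0 (trans (sym value) e)))

  lam-y-last : ∀ l {g} → Hom Any l g → lam (suc l ℕ.+ 1) (y l * g) 𝕂.≈ num (suc (suc l)) 𝕂.* lam (suc l) g
  lam-y-last l′ {g} hg = 𝕂.trans (ε-cong (begin
    word (longestWord (l ℕ.+ 1)) (y l′ * g * Π (l ℕ.+ 1))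
      ≈⟨ longestWord-up l _ ⟩
    word (up 0 l) (word (longestWord l) (y l′ * g * Π (l ℕ.+ 1)))
      ≈⟨ word-cong (up 0 l) (word-cong (longestWord l) (begin
          y l′ * g * Π (l ℕ.+ 1)                   ≈⟨ solve 3 (λ a b c → a :* b :* c := b :* (a :* c)) refl (y l′) g _ ⟩
          g * (y l′ * Π (l ℕ.+ 1))                 ≈⟨ *-congˡ (Π-split l′ 0) ⟩
          g * (cross l 1 * (Π l * emb l (Π 1)))    ≈⟨ *-congˡ (*-congˡ (trans (*-congˡ (trans (emb.cong Π-1) (emb-1 l))) (*-identityʳ (Π l)))) ⟩
          g * (cross l 1 * Π l)                    ≈⟨ solve 3 (λ a b c → a :* (b :* c) := b :* (a :* c)) refl g (cross l 1) (Π l) ⟩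
          cross l 1 * (g * Π l)                    ∎)) ⟩
    word (up 0 l) (word (longestWord l) (cross l 1 * (g * Π l)))
      ≈⟨ word-cong (up 0 l) (trans (word-*-sym (longestWord l) _ (All.map cross-sym (wordA-blocks l 1)))
           (trans (*-congˡ (lam-const l g hg (≡.trans (ℕₚ.+-comm l′ _) (degΠ-tri l′)))) (*-comm _ _))) ⟩
    word (up 0 l) (C (lam l g) * cross l 1)
      ≈⟨ trans (word-C (up 0 l) _ _) (*-congˡ (trans (word-cong (up 0 l) (∏-cong l (λ a _ → trans (*-identityʳ _) (reflexive (≡.cong (L a) (ℕₚ.+-identityʳ l)))))) (word-up-cross l))) ⟩
    C (lam l g) * C (num (suc l))
      ≈⟨ trans (*-comm _ _) (sym (C-* _ _)) ⟩
    C (num (suc l) 𝕂.* lam l g) ∎)) (ev-C (const 𝕂.0#) _)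
    where
    l : ℕ
    l = suc l′

  lam-≡ : ∀ {m n F} → m ≡ n → lam m F 𝕂.≈ lam n F
  lam-≡ ≡.refl = 𝕂.refl

  lam-y-last′ : ∀ l {g} → Hom Any l g → lam (suc (suc l)) (y l * g) 𝕂.≈ num (suc (suc l)) 𝕂.* lam (suc l) g
  lam-y-last′ l hg = 𝕂.trans (lam-≡ (ℕₚ.+-comm 1 (suc l))) (lam-y-last l hg)

  X₀-symB : ∀ l r n → Symmetric (wordB (suc l) r) (X^ 0 n)
  X₀-symB l r n = below-symB (suc l) r (hom-pow-X n 0 (s≤s z≤n))

  X^-+ : ∀ k m n → X^ k (m ℕ.+ n) ≈ X^ k m * X^ k n
  X^-+ k m n = PE.pow-+ (X k) m n

  -- The factor x_0^(l+1) is invisible to the right block, and what remains has too small a degree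
  -- for the right word.
  lam-y-X₀ : ∀ l r {e F} → Hom Any e F → e < r → ∀ n → n ≡ l ℕ.+ r → lam (suc (suc n)) (y l * (X^ 0 (suc l) * F)) 𝕂.≈ 𝕂.0#
  lam-y-X₀ l r hF e<r n ≡.refl = 𝕂.trans (lam-≡ (≡.cong suc (≡.sym (ℕₚ.+-suc l r))))
    (vanish-B l r (X₀-symB l (suc r) (suc l)) hF e<r)

  -- The recursion with 1 in place of the Schubert polynomial: every cut but the last leaves a power
  -- of x_0 that is too high, and [N] cancels.
  lam-X₀ : ∀ n → lam (suc n) (X^ 0 n) 𝕂.≈ 𝕂.1#
  lam-X₀ zero = 𝕂.trans (ε-cong (trans (*-identityˡ _) Π-1)) (ev-C (const 𝕂.0#) _)
  lam-X₀ (suc n) = cancel (suc n) (𝕂.begin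
    num N 𝕂.* lam N (X 0 * X^ 0 n)
      𝕂.≈⟨ lam-num n (hom-pow-X n 0 tt) ⟩
    𝕂.∑ (suc n) (λ l → num (suc n ∸ l) 𝕂.* lam N (y l * X^ 0 n))
      𝕂.≈⟨ 𝕂.∑-last n _ ⟩
    𝕂.∑ n (λ l → num (suc n ∸ l) 𝕂.* lam N (y l * X^ 0 n)) 𝕂.+ num (suc n ∸ n) 𝕂.* lam N (y n * X^ 0 n)
      𝕂.≈⟨ 𝕂.+-cong (𝕂.∑-0 n (λ l l<n → 𝕂.trans (𝕂.*-congˡ (vanish l l<n)) (𝕂.zeroʳ _)))
            (𝕂.*-cong (𝕂.trans (𝕂.reflexive (≡.cong num (ℕₚ.m+n∸n≡m 1 n))) num-1) (𝕂.trans (lam-y-last′ n (hom-pow-X n 0 tt)) (𝕂.*-congˡ (lam-X₀ n)))) ⟩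
    𝕂.0# 𝕂.+ 𝕂.1# 𝕂.* (num N 𝕂.* 𝕂.1#)
      𝕂.≈⟨ 𝕂.trans (𝕂.+-identityˡ _) (𝕂.*-identityˡ _) ⟩
    num N 𝕂.* 𝕂.1# 𝕂.∎)
    where
    N : ℕ
    N = suc (suc n)
    vanish : ∀ l → l < n → lam N (y l * X^ 0 n) 𝕂.≈ 𝕂.0#
    vanish l l<n = 𝕂.trans (lam-cong N (*-congˡ (trans (reflexive (≡.cong (X^ 0) (≡.sym (ℕₚ.m+[n∸m]≡n l<n)))) (X^-+ 0 (suc l) (n ∸ suc l)))))
      (lam-y-X₀ l (n ∸ l) (hom-pow-X (n ∸ suc l) 0 tt) (ℕₚ.∸-monoʳ-< (ℕₚ.n<1+n l) l<n) n (≡.sym (ℕₚ.m+[n∸m]≡n (ℕₚ.<⇒≤ l<n))))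

  lam-X₀-below : ∀ n → Hom (_< suc n) n (X^ 0 n)
  lam-X₀-below n = hom-pow-X n 0 (s≤s z≤n)

  κ-one : ∀ l → κ (suc l) 1 𝕂.≈ num (suc (suc l))
  κ-one l = 𝕂.begin
    κ (suc l) 1
      𝕂.≈⟨ 𝕂.trans (𝕂.*-congˡ (𝕂.trans (𝕂.*-cong (lam-X₀ l) (lam-X₀ 0)) (𝕂.*-identityˡ _))) (𝕂.*-identityʳ _) ⟨
    κ (suc l) 1 𝕂.* (lam (suc l) (X^ 0 l) 𝕂.* lam 1 1#)
      𝕂.≈⟨ split-product l 0 (lam-X₀-below l) (hom-C 𝕂.1#) ⟨
    lam (suc l ℕ.+ 1) (y l * (X^ 0 l * emb (suc l) 1#))
      𝕂.≈⟨ lam-cong (suc l ℕ.+ 1) (*-congˡ (trans (*-congˡ (emb-1 (suc l))) (*-identityʳ _))) ⟩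
    lam (suc l ℕ.+ 1) (y l * X^ 0 l)
      𝕂.≈⟨ 𝕂.trans (lam-y-last l (hom-pow-X l 0 tt)) (𝕂.trans (𝕂.*-congˡ (lam-X₀ l)) (𝕂.*-identityʳ _)) ⟩
    num (suc (suc l)) 𝕂.∎

  -- One product containing two of the y is evaluated in two ways: cut at l first and then split the
  -- last variable off the right block, or split off the last variable first and then cut at l.
  κ-suc : ∀ l r → κ (suc l) (suc (suc r)) 𝕂.* num (suc (suc r)) 𝕂.≈ num (suc l ℕ.+ suc (suc r)) 𝕂.* κ (suc l) (suc r)
  κ-suc l′ r = 𝕂.begin
    κ l (suc (suc r)) 𝕂.* num (suc (suc r))
      𝕂.≈⟨ 𝕂.*-congˡ (𝕂.trans (𝕂.*-cong (lam-X₀ l′) (𝕂.trans (lam-y-last′ r (hom-pow-X {Any} r 0 tt)) (𝕂.trans (𝕂.*-congˡ (lam-X₀ r)) (𝕂.*-identityʳ _)))) (𝕂.*-identityˡ _)) ⟨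
    κ l (suc (suc r)) 𝕂.* (lam l (X^ 0 l′) 𝕂.* lam (suc (suc r)) (y r * X^ 0 r))
      𝕂.≈⟨ split-product l′ (suc r) (lam-X₀-below l′) (hom-* (L-hom r (suc r)) (hom-pow-X {Any} r 0 tt)) ⟨
    lam N (y l′ * (X^ 0 l′ * emb l (y r * X^ 0 r)))
      𝕂.≈⟨ lam-cong N (trans (*-congˡ (*-congˡ (trans (emb.*-homo _ _) (*-congʳ (hom-L (emb-isHom l) {r} {suc r} {l ℕ.+ r} {suc (l ℕ.+ r)} (emb-X l r) (trans (emb-X l (suc r)) (reflexive (≡.cong X (ℕₚ.+-suc l r)))))))))
             (solve 4 (λ a b c d → a :* (b :* (c :* d)) := c :* (a :* (b :* d))) refl (y l′) (X^ 0 l′) (y (l ℕ.+ r)) (emb l (X^ 0 r)))) ⟩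
    lam N (y (l ℕ.+ r) * (y l′ * (X^ 0 l′ * emb l (X^ 0 r))))
      𝕂.≈⟨ lam-≡ N≡ ⟩
    lam (suc (suc (l ℕ.+ r))) (y (l ℕ.+ r) * (y l′ * (X^ 0 l′ * emb l (X^ 0 r))))
      𝕂.≈⟨ lam-y-last′ (l ℕ.+ r) (hom-* (L-hom l′ l) (hom-* (hom-pow-X l′ 0 tt) (hom-emb {W = Any} l (λ _ _ → tt) (hom-pow-X {Any} r 0 tt)))) ⟩
    num (suc (suc (l ℕ.+ r))) 𝕂.* lam (suc (l ℕ.+ r)) (y l′ * (X^ 0 l′ * emb l (X^ 0 r)))
      𝕂.≈⟨ 𝕂.*-cong (𝕂.reflexive (≡.cong num (≡.sym N≡))) (𝕂.trans (lam-≡ (≡.sym (ℕₚ.+-suc l r)))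
            (𝕂.trans (split-product l′ r (lam-X₀-below l′) (hom-pow-X {Any} r 0 tt))
              (𝕂.trans (𝕂.*-congˡ (𝕂.trans (𝕂.*-cong (lam-X₀ l′) (lam-X₀ r)) (𝕂.*-identityˡ _))) (𝕂.*-identityʳ _)))) ⟩
    num (l ℕ.+ suc (suc r)) 𝕂.* κ l (suc r) 𝕂.∎
    where
    l N : ℕ
    l = suc l′
    N = l ℕ.+ suc (suc r)
    N≡ : N ≡ suc (suc (l ℕ.+ r))
    N≡ = ≡.trans (ℕₚ.+-suc l (suc r)) (≡.cong suc (ℕₚ.+-suc l r))

  -- In q-binomials: [r+1] times [l+r+2 choose l+1] equals [l+r+2] times [l+r+1 choose l+1]. This
  -- form is what `step-ρ` needs, where κ occurs with the coefficient of its y.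
  κ-β : ∀ l r → num (suc r) 𝕂.* κ (suc l) (suc r) 𝕂.≈ num (suc l ℕ.+ suc r) 𝕂.* β (suc r) (suc l)
  κ-β l zero = 𝕂.begin
    num 1 𝕂.* κ (suc l) 1               𝕂.≈⟨ 𝕂.trans (𝕂.*-cong num-1 (κ-one l)) (𝕂.*-identityˡ _) ⟩
    num (suc (suc l))                   𝕂.≈⟨ 𝕂.trans (𝕂.*-cong (𝕂.reflexive (≡.cong num (ℕₚ.+-comm (suc l) 1))) (β-one (suc l))) (𝕂.*-identityʳ _) ⟨
    num (suc l ℕ.+ 1) 𝕂.* β 1 (suc l)   𝕂.∎
  κ-β l (suc r) = 𝕂.trans (𝕂.*-comm _ _) (𝕂.trans (κ-suc l r) (𝕂.*-congˡ (cancel r (𝕂.begin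
    num (suc r) 𝕂.* κ (suc l) (suc r)                     𝕂.≈⟨ κ-β l r ⟩
    num (suc l ℕ.+ suc r) 𝕂.* β (suc r) (suc l)           𝕂.≈⟨ 𝕂.*-congʳ (𝕂.reflexive (≡.cong num (ℕₚ.+-comm (suc l) (suc r)))) ⟩
    num (suc r ℕ.+ suc l) 𝕂.* β (suc r) (suc l)           𝕂.≈⟨ β-suc-n (suc r) (suc l) ⟨
    num (suc r) 𝕂.* β (suc (suc r)) (suc l)               𝕂.∎))))

-- The recursion for B and the principal specialisation

module Recursion {c ℓ} (K : CommutativeRing c ℓ) (nontrivial : ¬ (CommutativeRing._≈_ K (CommutativeRing.1# K) (CommutativeRing.0# K)))
  (q : CommutativeRing.Carrier K)
  (cancel : ∀ n {x y} → CommutativeRing._≈_ K (CommutativeRing._*_ K (Gaussian.num K q (suc n)) x) (CommutativeRing._*_ K (Gaussian.num K q (suc n)) y) → CommutativeRing._≈_ K x y) where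
  open Constants K nontrivial q cancel public
  open CommutativeRing PR
  open SetoidReasoning setoid
  open IntegerSolver PR

  ρ^ : ℕ → Poly → Poly
  ρ^ zero p = p
  ρ^ (suc i) p = ρ^ i (ρ p)

  ρ^-isHom : ∀ i → IsHom (ρ^ i)
  ρ^-isHom zero = id-isHom
  ρ^-isHom (suc i) = ∘-isHom (ρ^-isHom i) ρ.isHom

  ρ^-X-< : ∀ {i k} → k < i → ρ^ i (X k) ≈ 0#
  ρ^-X-< {suc i} {zero} _ = trans (IsHom.cong (ρ^-isHom i) ρ-X-zero) (IsHom.0-homo (ρ^-isHom i))
  ρ^-X-< {suc i} {suc k} (s≤s k<i) = trans (IsHom.cong (ρ^-isHom i) (ρ-X-suc k)) (ρ^-X-< k<i)

  ρ^-X-+ : ∀ i k → ρ^ i (X (i ℕ.+ k)) ≈ X k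
  ρ^-X-+ zero k = refl
  ρ^-X-+ (suc i) k = trans (IsHom.cong (ρ^-isHom i) (ρ-X-suc (i ℕ.+ k))) (ρ^-X-+ i k)

  θ : ℕ → Poly → Poly
  θ i = emb i ∘ ρ^ i

  θ-isHom : ∀ i → IsHom (θ i)
  θ-isHom i = ∘-isHom (emb-isHom i) (ρ^-isHom i)

  θ-X : ∀ i k → (k < i × θ i (X k) ≈ 0#) ⊎ (θ i (X k) ≈ X k)
  θ-X i k with k ℕ.<? i
  ... | yes k<i = inj₁ (k<i , trans (emb.cong (ρ^-X-< k<i)) emb.0-homo)
  ... | no k≮i = inj₂ (≡.subst (λ k → θ i (X k) ≈ X k) (ℕₚ.m+[n∸m]≡n (ℕₚ.≮⇒≥ k≮i))
          (trans (emb.cong (ρ^-X-+ i (k ∸ i))) (emb-X i (k ∸ i))))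

  hom-ρ : ∀ {d p} → Hom Any d p → Hom Any d (ρ p)
  hom-ρ = hom-map ρ.isHom λ { zero _ → hom-≈ (sym ρ-X-zero) hom-0 ; (suc k) _ → hom-≈ (sym (ρ-X-suc k)) (hom-var k tt) }

  hom-ρ^ : ∀ i {d p} → Hom Any d p → Hom Any d (ρ^ i p)
  hom-ρ^ zero h = h
  hom-ρ^ (suc i) h = hom-ρ^ i (hom-ρ h)

  Below : ℕ → Poly → Set (c ⊔ ℓ)
  Below i g = ∃[ k ] (k < i × g ≈ X k)

  reduce-θ : ∀ i {d p} → Hom Any d p → Ideal (Below i) d (p - θ i p)
  reduce-θ i = reduce {Any} {Below i} (θ-isHom i) (λ k _ → θ-hom k (θ-X i k)) (λ k _ → difference k (θ-X i k))
    where
    θ-hom : ∀ k → (k < i × θ i (X k) ≈ 0#) ⊎ (θ i (X k) ≈ X k) → Hom Any 1 (θ i (X k))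
    θ-hom k (inj₁ (_ , e)) = hom-≈ (sym e) hom-0
    θ-hom k (inj₂ e) = hom-≈ (sym e) (hom-var k tt)
    difference : ∀ k → (k < i × θ i (X k) ≈ 0#) ⊎ (θ i (X k) ≈ X k) → Ideal (Below i) 1 (X k - θ i (X k))
    difference k (inj₁ (k<i , e)) = ideal-gen (k , k<i , trans (+-congˡ (-‿cong e)) (solve 1 (λ x → x :- con (+ 0) := x) refl (X k)))
    difference k (inj₂ e) = ideal-≈ (sym (trans (+-congˡ (-‿cong e)) (-‿inverseʳ (X k)))) ideal-0

  ideal-elim : ∀ {G d p} (Φ : Poly → 𝕂.Carrier) → (∀ {p r} → p ≈ r → Φ p 𝕂.≈ Φ r) → Φ 0# 𝕂.≈ 𝕂.0# → (∀ p r → Φ (p + r) 𝕂.≈ Φ p 𝕂.+ Φ r) →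
    (∀ {e g h} → d ≡ suc e → G g → Hom Any e h → Φ (g * h) 𝕂.≈ 𝕂.0#) → Ideal G d p → Φ p 𝕂.≈ 𝕂.0#
  ideal-elim Φ Φ-cong Φ-0 Φ-+ Φ-* ideal-0 = Φ-0
  ideal-elim Φ Φ-cong Φ-0 Φ-+ Φ-* (ideal-+ I I′) = 𝕂.trans (Φ-+ _ _)
    (𝕂.trans (𝕂.+-cong (ideal-elim Φ Φ-cong Φ-0 Φ-+ Φ-* I) (ideal-elim Φ Φ-cong Φ-0 Φ-+ Φ-* I′)) (𝕂.+-identityˡ _))
  ideal-elim Φ Φ-cong Φ-0 Φ-+ Φ-* (ideal-* γ h) = Φ-* ≡.refl γ h
  ideal-elim Φ Φ-cong Φ-0 Φ-+ Φ-* (ideal-≈ e I) = 𝕂.trans (Φ-cong (sym e)) (ideal-elim Φ Φ-cong Φ-0 Φ-+ Φ-* I)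

  lam-ideal : ∀ {G d r} N u → (∀ {e g h} → d ≡ suc e → G g → Hom Any e h → lam N (u * (g * h)) 𝕂.≈ 𝕂.0#) →
    Ideal G d r → lam N (u * r) 𝕂.≈ 𝕂.0#
  lam-ideal N u = ideal-elim (λ r → lam N (u * r)) (λ e → lam-cong N (*-congˡ e)) (lam-0 N (zeroʳ u))
    (λ p r → 𝕂.trans (lam-cong N (distribˡ u p r)) (lam-+ N _ _))

  lam-split : ∀ N u p r → lam N (u * p) 𝕂.≈ lam N (u * r) 𝕂.+ lam N (u * (p - r))
  lam-split N u p r = 𝕂.trans (lam-cong N (solve 3 (λ u p r → u :* p := u :* r :+ u :* (p :- r)) refl u p r)) (lam-+ N _ _)

  -- The factor x_0^i already has the full degree allotted to the left block. One more variable from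
  -- that block leaves the right block with too small a degree, so f may be replaced by its value
  -- where the first i+1 variables are 0.
  lam-y-ρ^ : ∀ i n {f} → Hom Any n f → lam (suc i ℕ.+ suc n) (y i * (X^ 0 i * f)) 𝕂.≈ κ (suc i) (suc n) 𝕂.* lam (suc n) (ρ^ (suc i) f)
  lam-y-ρ^ i n {f} hf = 𝕂.begin
    lam N (y i * (X^ 0 i * f))
      𝕂.≈⟨ lam-cong N (sym (*-assoc _ _ f)) ⟩
    lam N (u * f)
      𝕂.≈⟨ lam-split N u f (θ (suc i) f) ⟩
    lam N (u * θ (suc i) f) 𝕂.+ lam N (u * (f - θ (suc i) f))
      𝕂.≈⟨ 𝕂.+-cong (lam-cong N (*-assoc _ _ _)) (lam-ideal N u kill (reduce-θ (suc i) hf)) ⟩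
    lam N (y i * (X^ 0 i * θ (suc i) f)) 𝕂.+ 𝕂.0#
      𝕂.≈⟨ 𝕂.+-identityʳ _ ⟩
    lam N (y i * (X^ 0 i * emb (suc i) (ρ^ (suc i) f)))
      𝕂.≈⟨ split-product i n (lam-X₀-below i) (hom-ρ^ (suc i) hf) ⟩
    κ (suc i) (suc n) 𝕂.* (lam (suc i) (X^ 0 i) 𝕂.* lam (suc n) (ρ^ (suc i) f))
      𝕂.≈⟨ 𝕂.*-congˡ (𝕂.trans (𝕂.*-congʳ (lam-X₀ i)) (𝕂.*-identityˡ _)) ⟩
    κ (suc i) (suc n) 𝕂.* lam (suc n) (ρ^ (suc i) f) 𝕂.∎
    where
    N : ℕ
    N = suc i ℕ.+ suc n
    u : Poly
    u = y i * X^ 0 i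
    kill : ∀ {e g h} → n ≡ suc e → Below (suc i) g → Hom Any e h → lam N (u * (g * h)) 𝕂.≈ 𝕂.0#
    kill {e} {g} {h} ≡.refl (k , k<1+i , g≈X) hh = 𝕂.trans
      (lam-cong N (trans (*-congˡ (*-congʳ g≈X)) (solve 4 (λ y x k h → y :* x :* (k :* h) := y :* ((x :* k) :* h)) refl (y i) (X^ 0 i) (X k) h)))
      (vanish-B i n (below-symB (suc i) (suc n) (hom-* (lam-X₀-below i) (hom-var k k<1+i))) hh (ℕₚ.n<1+n e))

  ∑-single : ∀ n a (h : ℕ → 𝕂.Carrier) → a < n → (∀ k → k < n → k ≢ a → h k 𝕂.≈ 𝕂.0#) → 𝕂.∑ n h 𝕂.≈ h a
  ∑-single (suc n) zero h _ zeros = 𝕂.trans (𝕂.+-congˡ (𝕂.∑-0 n (λ k k<n → zeros (suc k) (s≤s k<n) (λ ())))) (𝕂.+-identityʳ _)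
  ∑-single (suc n) (suc a) h (s≤s a<n) zeros = 𝕂.trans
    (𝕂.+-cong (zeros 0 (s≤s z≤n) (λ ())) (∑-single n a (h ∘ suc) a<n (λ k k<n k≢a → zeros (suc k) (s≤s k<n) (k≢a ∘ ℕₚ.suc-injective))))
    (𝕂.+-identityˡ _)

  -- f stands for the Schubert polynomial of 1ʲ × v with v ∈ S_{p+1} indecomposable of length n; note
  -- that the n of the theorem is suc n here.
  module Main (j p n : ℕ) (1≤n : 1 ≤ n) (f : Poly)
    (f-hom : Hom (_< suc (j ℕ.+ p)) n f)
    (f-symmetric : ∀ k → k < j → s k f ≈ f)
    (f-killed : ∀ l → j ≤ l → l < j ℕ.+ p → ∀ r d → Killed (InBlocks (suc l) r) d f) where

    f-symA : ∀ l → suc l ≤ j → Symmetric (wordA (suc l)) f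
    f-symA l l<j = All.map (λ {k} k<l → f-symmetric k (ℕₚ.≤-trans (ℕₚ.<⇒≤ k<l) l<j)) (longestWord-letters (suc l))

    B : ℕ → 𝕂.Carrier
    B i = lam (suc n ℕ.+ i) (X^ 0 i * f)

    module Step (i : ℕ) where
      N : ℕ
      N = suc (suc (n ℕ.+ i))

      g : Poly
      g = X^ 0 i * f

      g-hom : Hom Any (n ℕ.+ i) g
      g-hom = hom-≡ (ℕₚ.+-comm i n) (hom-* (hom-pow-X i 0 tt) (hom-any f-hom))

      N-split : ∀ l → l < n ℕ.+ i → suc l ℕ.+ suc (n ℕ.+ i ∸ l) ≡ N
      N-split l l<n+i = ≡.trans (ℕₚ.+-suc (suc l) _) (≡.cong (λ m → suc (suc m)) (ℕₚ.m+[n∸m]≡n (ℕₚ.<⇒≤ l<n+i)))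

      vanish-small : ∀ l → l < i → lam N (y l * g) 𝕂.≈ 𝕂.0#
      vanish-small l l<i = 𝕂.trans
        (lam-cong N (*-congˡ (trans (*-congʳ (trans (reflexive (≡.cong (X^ 0) (≡.sym (ℕₚ.m+[n∸m]≡n l<i)))) (X^-+ 0 (suc l) (i ∸ suc l)))) (*-assoc _ _ f))))
        (lam-y-X₀ l (n ℕ.+ i ∸ l) (hom-* (hom-pow-X (i ∸ suc l) 0 tt) (hom-any f-hom))
          (≡.subst₂ _<_ (ℕₚ.+-comm n _) (≡.sym (ℕₚ.+-∸-assoc n (ℕₚ.<⇒≤ l<i))) (ℕₚ.+-monoʳ-< n (ℕₚ.∸-monoʳ-< (ℕₚ.n<1+n l) l<i)))
          (n ℕ.+ i) (≡.sym (ℕₚ.m+[n∸m]≡n (ℕₚ.≤-trans (ℕₚ.<⇒≤ l<i) (ℕₚ.m≤n+m i n)))))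

      vanish-middle : ∀ l → l < n ℕ.+ i → j ≤ l → l < j ℕ.+ p → lam N (y l * g) 𝕂.≈ 𝕂.0#
      vanish-middle l l<n+i j≤l l<j+p = 𝕂.trans (lam-≡ (≡.sym (N-split l l<n+i)))
        (vanish-killed l (n ℕ.+ i ∸ l) (hom-pow-X {Any} i 0 tt)
          (hom-≡ (≡.sym (ℕₚ.m+[n∸m]≡n (ℕₚ.<⇒≤ l<n+i))) g-hom) (f-killed l j≤l l<j+p _))

      vanish-sym : ∀ l → i < l → l < n ℕ.+ i → l < j → lam N (y l * g) 𝕂.≈ 𝕂.0#
      vanish-sym l i<l l<n+i l<j = 𝕂.trans (lam-≡ (≡.sym (N-split l l<n+i))) (𝕂.trans
        (lam-cong (suc l ℕ.+ suc (n ℕ.+ i ∸ l)) (*-congˡ (*-comm (X^ 0 i) f)))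
        (vanish-A l (n ℕ.+ i ∸ l) (f-symA l l<j) (hom-pow-X i 0 tt) i<l))

      vanish-large : ∀ l → l < n ℕ.+ i → j ℕ.+ p ≤ l → lam N (y l * g) 𝕂.≈ 𝕂.0#
      vanish-large l l<n+i j+p≤l = 𝕂.trans (lam-≡ (≡.sym (N-split l l<n+i))) (𝕂.trans
        (lam-cong (suc l ℕ.+ suc (n ℕ.+ i ∸ l)) (*-congˡ (sym (*-identityʳ g))))
        (vanish-B l (n ℕ.+ i ∸ l) (below-symB (suc l) (suc (n ℕ.+ i ∸ l)) (hom-* (hom-pow-X i 0 (s≤s z≤n)) (hom-mono (λ k k< → ℕₚ.<-≤-trans k< (s≤s j+p≤l)) f-hom)))
          (hom-C 𝕂.1#) (ℕₚ.m<n⇒0<n∸m l<n+i)))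

      vanish-other : ∀ l → l < n ℕ.+ i → l ≢ i → lam N (y l * g) 𝕂.≈ 𝕂.0#
      vanish-other l l<n+i l≢i with l ℕ.<? i | l ℕ.<? j | l ℕ.<? (j ℕ.+ p)
      ... | yes l<i | _ | _ = vanish-small l l<i
      ... | no l≮i | yes l<j | _ = vanish-sym l (ℕₚ.≤∧≢⇒< (ℕₚ.≮⇒≥ l≮i) (l≢i ∘ ≡.sym)) l<n+i l<j
      ... | no _ | no l≮j | yes l<j+p = vanish-middle l l<n+i (ℕₚ.≮⇒≥ l≮j) l<j+p
      ... | no _ | no _ | no l≮j+p = vanish-large l l<n+i (ℕₚ.≮⇒≥ l≮j+p)

      i<n+i : i < n ℕ.+ i
      i<n+i = ℕₚ.m<n+m i 1≤n

      recursion : num N 𝕂.* B (suc i) 𝕂.≈ num (suc n) 𝕂.* lam N (y i * g) 𝕂.+ num N 𝕂.* B i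
      recursion = 𝕂.begin
        num N 𝕂.* lam (suc n ℕ.+ suc i) (X 0 * X^ 0 i * f)
          𝕂.≈⟨ 𝕂.*-congˡ (𝕂.trans (lam-≡ (≡.cong suc (ℕₚ.+-suc n i))) (lam-cong N (*-assoc (X 0) (X^ 0 i) f))) ⟩
        num N 𝕂.* lam N (X 0 * g)
          𝕂.≈⟨ lam-num (n ℕ.+ i) g-hom ⟩
        𝕂.∑ (suc (n ℕ.+ i)) (λ l → num (suc (n ℕ.+ i) ∸ l) 𝕂.* lam N (y l * g))
          𝕂.≈⟨ 𝕂.∑-last (n ℕ.+ i) _ ⟩
        𝕂.∑ (n ℕ.+ i) (λ l → num (suc (n ℕ.+ i) ∸ l) 𝕂.* lam N (y l * g)) 𝕂.+ num (suc (n ℕ.+ i) ∸ (n ℕ.+ i)) 𝕂.* lam N (y (n ℕ.+ i) * g)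
          𝕂.≈⟨ 𝕂.+-cong
                (𝕂.trans (∑-single (n ℕ.+ i) i _ i<n+i (λ l l<n+i l≢i → 𝕂.trans (𝕂.*-congˡ (vanish-other l l<n+i l≢i)) (𝕂.zeroʳ _)))
                  (𝕂.*-congʳ (𝕂.reflexive (≡.cong num (ℕₚ.m+n∸n≡m (suc n) i)))))
                (𝕂.trans (𝕂.*-cong (𝕂.trans (𝕂.reflexive (≡.cong num (ℕₚ.m+n∸n≡m 1 (n ℕ.+ i)))) num-1) (lam-y-last′ (n ℕ.+ i) g-hom)) (𝕂.*-identityˡ _)) ⟩
        num (suc n) 𝕂.* lam N (y i * g) 𝕂.+ num N 𝕂.* B i 𝕂.∎

      -- From i = j on, the cut at l = i separates positions that v mixes, so even the term that
      -- `step-ρ` evaluates is zero.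
      step-middle : j ≤ i → i < j ℕ.+ p → B (suc i) 𝕂.≈ B i
      step-middle j≤i i<j+p = cancel (suc (n ℕ.+ i)) (𝕂.trans recursion (𝕂.trans
        (𝕂.+-congʳ (𝕂.trans (𝕂.*-congˡ (vanish-middle i i<n+i j≤i i<j+p)) (𝕂.zeroʳ _))) (𝕂.+-identityˡ _)))

      step-ρ : B (suc i) 𝕂.≈ B i 𝕂.+ β (suc n) (suc i) 𝕂.* lam (suc n) (ρ^ (suc i) f)
      step-ρ = cancel (suc (n ℕ.+ i)) (𝕂.begin
        num N 𝕂.* B (suc i)
          𝕂.≈⟨ recursion ⟩
        num (suc n) 𝕂.* lam N (y i * g) 𝕂.+ num N 𝕂.* B i
          𝕂.≈⟨ 𝕂.+-congʳ (𝕂.*-congˡ (𝕂.trans (lam-≡ (≡.sym N≡)) (lam-y-ρ^ i n (hom-any f-hom)))) ⟩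
        num (suc n) 𝕂.* (κ (suc i) (suc n) 𝕂.* m) 𝕂.+ num N 𝕂.* B i
          𝕂.≈⟨ 𝕂.+-congʳ (𝕂.trans (𝕂.sym (𝕂.*-assoc _ _ m)) (𝕂.*-congʳ (𝕂.trans (κ-β i n) (𝕂.*-congʳ (𝕂.reflexive (≡.cong num N≡)))))) ⟩
        num N 𝕂.* β (suc n) (suc i) 𝕂.* m 𝕂.+ num N 𝕂.* B i
          𝕂.≈⟨ 𝕂.solve 4 (λ N β m B → N 𝕂.:* β 𝕂.:* m 𝕂.:+ N 𝕂.:* B 𝕂.:= N 𝕂.:* (B 𝕂.:+ β 𝕂.:* m)) 𝕂.refl (num N) (β (suc n) (suc i)) m (B i) ⟩
        num N 𝕂.* (B i 𝕂.+ β (suc n) (suc i) 𝕂.* m) 𝕂.∎)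
        where
        m : 𝕂.Carrier
        m = lam (suc n) (ρ^ (suc i) f)
        N≡ : suc i ℕ.+ suc n ≡ N
        N≡ = ≡.trans (ℕₚ.+-suc (suc i) n) (≡.cong (λ k → suc (suc k)) (ℕₚ.+-comm i n))

    B-∑ : ∀ i → B i 𝕂.≈ 𝕂.∑ (suc i) (λ m → β (suc n) m 𝕂.* lam (suc n) (ρ^ m f))
    B-∑ zero = 𝕂.trans (𝕂.trans (lam-≡ (ℕₚ.+-identityʳ (suc n))) (lam-cong (suc n) (*-identityˡ f)))
      (𝕂.sym (𝕂.trans (𝕂.+-identityʳ _) (𝕂.*-identityˡ _)))
    B-∑ (suc i) = 𝕂.trans (Step.step-ρ i) (𝕂.trans (𝕂.+-congʳ (B-∑ i)) (𝕂.sym (𝕂.∑-last (suc i) (λ m → β (suc n) m 𝕂.* lam (suc n) (ρ^ m f)))))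

    B-stationary : ∀ d → d ≤ p → B (j ℕ.+ d) 𝕂.≈ B j
    B-stationary zero _ = 𝕂.reflexive (≡.cong B (ℕₚ.+-identityʳ j))
    B-stationary (suc d) d<p = 𝕂.trans (𝕂.reflexive (≡.cong B (ℕₚ.+-suc j d)))
      (𝕂.trans (Step.step-middle (j ℕ.+ d) (ℕₚ.m≤m+n j d) (ℕₚ.+-monoʳ-< j d<p)) (B-stationary d (ℕₚ.<⇒≤ d<p)))

    -- The largest index of a variable that can occur in f. The power x_0^I is high enough to
    -- specialise all of them.
    I : ℕ
    I = j ℕ.+ p

    q^ : ℕ → 𝕂.Carrier
    q^ = Defs.pow K q

    -- The principal specialisation kept homogeneous by a factor x_0, so that the result still lies
    -- in the degree that λ detects.
    σ : Poly → Poly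
    σ = sub (λ k → C (q^ k) * X 0)

    σ-hom : ∀ {V d r} → Hom V d r → σ r ≈ C (ev q^ r) * X^ 0 d
    σ-hom hom-0 = trans (IsHom.0-homo (sub-isHom _)) (sym (trans (*-congʳ C-0) (zeroˡ _)))
    σ-hom (hom-+ {p = p} {r} h h′) = trans (IsHom.+-homo (sub-isHom _) p r) (trans (+-cong (σ-hom h) (σ-hom h′))
      (trans (sym (distribʳ _ _ _)) (*-congʳ (trans (sym (C-+ _ _)) (C-cong (𝕂.sym (ev-+ q^ p r)))))))
    σ-hom (hom-C x) = trans (IsHom.C-homo (sub-isHom _) x) (trans (C-cong (𝕂.sym (ev-C q^ x))) (sym (*-identityʳ _)))
    σ-hom (hom-X {d} {r} k v h) = trans (IsHom.*-homo (sub-isHom _) (X k) r) (trans (*-cong (sub-X _ k) (σ-hom h))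
      (trans (solve 4 (λ a x b u → (a :* x) :* (b :* u) := (a :* b) :* (x :* u)) refl (C (q^ k)) (X 0) (C (ev q^ r)) (X^ 0 d))
        (*-congʳ (trans (sym (C-* _ _)) (C-cong (𝕂.sym (𝕂.trans (ev-* q^ (X k) r) (𝕂.*-congʳ (ev-X q^ k)))))))))
    σ-hom (hom-≈ e h) = trans (IsHom.cong (sub-isHom _) (sym e)) (trans (σ-hom h) (*-congʳ (C-cong (ev-cong q^ e))))

    Specialised : Poly → Set (c ⊔ ℓ)
    Specialised g = ∃[ k ] (k ≤ I × g ≈ X k - C (q^ k) * X 0)

    NI : ℕ
    NI = suc n ℕ.+ I

    -- Induction along x_{k+1} - q^(k+1) x_0 = q (x_k - q^k x_0) - y_k. The term with y_k vanishes
    -- because k < I leaves more than k factors x_0.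
    lam-specialised : ∀ k {e h} → k ≤ I → n ≡ suc e → Hom Any e h → lam NI (X^ 0 I * ((X k - C (q^ k) * X 0) * h)) 𝕂.≈ 𝕂.0#
    lam-specialised zero {h = h} _ _ _ = lam-0 NI (solve 3 (λ u x h → u :* ((x :- con (+ 1) :* x) :* h) := con (+ 0)) refl (X^ 0 I) (X 0) h)
    lam-specialised (suc k) {e} {h} k<I n≡ hh = 𝕂.begin
      lam NI (X^ 0 I * ((X (suc k) - C (q 𝕂.* q^ k) * X 0) * h))
        𝕂.≈⟨ lam-cong NI (trans (*-congˡ (*-congʳ (+-congˡ (-‿cong (*-congʳ (C-* q (q^ k)))))))
              (solve 7 (λ u x′ q qk x₀ xk h → u :* ((x′ :- (q :* qk) :* x₀) :* h) := q :* (u :* ((xk :- qk :* x₀) :* h)) :+ (:- con (+ 1)) :* ((q :* xk :- x′) :* (u :* h))) refl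
                (X^ 0 I) (X (suc k)) (C q) (C (q^ k)) (X 0) (X k) h)) ⟩
      lam NI (C q * (X^ 0 I * ((X k - C (q^ k) * X 0) * h)) + - 1# * (y k * (X^ 0 I * h)))
        𝕂.≈⟨ 𝕂.trans (lam-+ NI _ _) (𝕂.+-cong
              (𝕂.trans (lam-C* NI q _) (𝕂.trans (𝕂.*-congˡ (lam-specialised k (ℕₚ.<⇒≤ k<I) n≡ hh)) (𝕂.zeroʳ q)))
              (𝕂.trans (lam-cong NI (*-congʳ (sym (C-neg 𝕂.1#)))) (𝕂.trans (lam-C* NI _ _) (𝕂.trans (𝕂.*-congˡ vanish) (𝕂.zeroʳ _))))) ⟩
      𝕂.0# 𝕂.+ 𝕂.0#
        𝕂.≈⟨ 𝕂.+-identityˡ _ ⟩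
      𝕂.0# 𝕂.∎
      where
      vanish : lam NI (y k * (X^ 0 I * h)) 𝕂.≈ 𝕂.0#
      vanish = 𝕂.trans (lam-cong NI (*-congˡ (trans (*-congʳ (trans (reflexive (≡.cong (X^ 0) (≡.sym (ℕₚ.m+[n∸m]≡n k<I)))) (X^-+ 0 (suc k) (I ∸ suc k)))) (*-assoc _ _ h))))
        (𝕂.trans (lam-≡ (≡.cong (λ m → suc (m ℕ.+ I)) n≡))
          (lam-y-X₀ k (e ℕ.+ I ∸ k) (hom-* (hom-pow-X (I ∸ suc k) 0 tt) hh)
            (≡.subst₂ _<_ (ℕₚ.+-comm e _) (≡.sym (ℕₚ.+-∸-assoc e (ℕₚ.<⇒≤ k<I))) (ℕₚ.+-monoʳ-< e (ℕₚ.∸-monoʳ-< (ℕₚ.n<1+n k) k<I)))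
            (e ℕ.+ I) (≡.sym (ℕₚ.m+[n∸m]≡n (ℕₚ.≤-trans (ℕₚ.<⇒≤ k<I) (ℕₚ.m≤n+m I e))))))

    B-ev : B I 𝕂.≈ ev q^ f
    B-ev = 𝕂.begin
      lam NI (X^ 0 I * f)
        𝕂.≈⟨ lam-split NI (X^ 0 I) f (σ f) ⟩
      lam NI (X^ 0 I * σ f) 𝕂.+ lam NI (X^ 0 I * (f - σ f))
        𝕂.≈⟨ 𝕂.+-congˡ (lam-ideal NI (X^ 0 I) (λ { n≡ (k , k≤I , e) hh → 𝕂.trans (lam-cong NI (*-congˡ (*-congʳ e))) (lam-specialised k k≤I n≡ hh) })
              (reduce {_< suc I} {Specialised} (sub-isHom _) (λ k _ → hom-≈ (sym (sub-X _ k)) (hom-C* _ (hom-var 0 tt)))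
                (λ { k (s≤s k≤I) → ideal-gen (k , k≤I , +-congˡ (-‿cong (sub-X _ k))) }) f-hom)) ⟩
      lam NI (X^ 0 I * σ f) 𝕂.+ 𝕂.0#
        𝕂.≈⟨ 𝕂.trans (𝕂.+-identityʳ _) (lam-cong NI (trans (*-congˡ (σ-hom f-hom)) (solve 3 (λ u c v → u :* (c :* v) := c :* (v :* u)) refl (X^ 0 I) (C (ev q^ f)) (X^ 0 n)))) ⟩
      lam NI (C (ev q^ f) * (X^ 0 n * X^ 0 I))
        𝕂.≈⟨ lam-C* NI (ev q^ f) (X^ 0 n * X^ 0 I) ⟩
      ev q^ f 𝕂.* lam NI (X^ 0 n * X^ 0 I)
        𝕂.≈⟨ 𝕂.*-congˡ (𝕂.trans (lam-cong NI (sym (X^-+ 0 n I))) (lam-X₀ (n ℕ.+ I))) ⟩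
      ev q^ f 𝕂.* 𝕂.1#
        𝕂.≈⟨ 𝕂.*-identityʳ _ ⟩
      ev q^ f 𝕂.∎

    ev-expansion : ev q^ f 𝕂.≈ 𝕂.∑ (suc j) (λ m → β (suc n) m 𝕂.* lam (suc n) (ρ^ m f))
    ev-expansion = 𝕂.trans (𝕂.sym B-ev) (𝕂.trans (B-stationary p ℕₚ.≤-refl) (B-∑ j))

    -- With one more variable, `y n * f` is [n+2] times the wanted value by `lam-y-last`. The same
    -- expression is zero: for n < j by symmetry of f and its positive degree, for n ≥ j because the
    -- cut lies inside the indecomposable part.
    lam-vanishes : suc n ≤ j ℕ.+ p → lam (suc n) f 𝕂.≈ 𝕂.0#
    lam-vanishes n<j+p = cancel (suc n) (𝕂.trans (𝕂.sym (lam-y-last n (hom-any f-hom))) (𝕂.trans vanish (𝕂.sym (𝕂.zeroʳ _))))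
      where
      vanish : lam (suc n ℕ.+ 1) (y n * f) 𝕂.≈ 𝕂.0#
      vanish with n ℕ.<? j
      ... | yes n<j = 𝕂.trans (lam-cong (suc n ℕ.+ 1) (*-congˡ (sym (*-identityʳ f)))) (vanish-A n 0 (f-symA n n<j) (hom-C 𝕂.1#) 1≤n)
      ... | no n≮j = 𝕂.trans (lam-cong (suc n ℕ.+ 1) (*-congˡ (sym (*-identityˡ f))))
              (vanish-killed n 0 {0} {1#} (hom-C 𝕂.1#) (hom-≈ (sym (*-identityˡ f)) (hom-≡ (≡.sym (ℕₚ.+-identityʳ n)) (hom-any f-hom)))
                (f-killed n (ℕₚ.≮⇒≥ n≮j) n<j+p 1))

-- Indecomposability, length and shifted permutations as functions

toFun-< : ∀ {N} (π : Permutation′ N) {k} (k<N : k < N) → toFun π k ≡ toℕ (π ⟨$⟩ʳ fromℕ< k<N)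
toFun-< {N} π {k} k<N with k ℕ.<? N
... | yes _ = ≡.refl
... | no k≮N = ⊥-elim (k≮N k<N)

toFun-≥ : ∀ {N} (π : Permutation′ N) {k} → N ≤ k → toFun π k ≡ k
toFun-≥ {N} π {k} N≤k with k ℕ.<? N
... | yes k<N = ⊥-elim (ℕₚ.<⇒≱ k<N N≤k)
... | no _ = ≡.refl

Perm-toFun : ∀ {N} (π : Permutation′ N) → Perm N (toFun π)
Perm-toFun {N} π = record
  { injective = λ {a} {b} a<N b<N eq → Finₚ.fromℕ<-injective a b a<N b<N
      (≡.trans (≡.sym (inverseˡ π)) (≡.trans
        (≡.cong (π ⟨$⟩ˡ_) (Finₚ.toℕ-injective (≡.trans (≡.sym (toFun-< π a<N)) (≡.trans eq (toFun-< π b<N)))))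
        (inverseˡ π)))
  ; bounded = λ {a} a<N → ≡.subst (_< N) (≡.sym (toFun-< π a<N)) (Finₚ.toℕ<n _) }

-- The point y together with the N values gives N+1 points among N. A coincidence either exhibits a
-- preimage of y or contradicts injectivity.
Perm-surjective : ∀ {N w} → Perm N w → ∀ {y} → y < N → ∃[ x ] (x < N × w x ≡ y)
Perm-surjective {N} {w} π {y} y<N with ℕₚ.anyUpTo? (λ x → w x ℕ.≟ y) N
... | yes found = found
... | no none = ⊥-elim (collide (Finₚ.pigeonhole (ℕₚ.n<1+n N) f))
  where
  f : Fin (suc N) → Fin N
  f Fin.zero = fromℕ< y<N
  f (Fin.suc i) = fromℕ< (Perm.bounded π (Finₚ.toℕ<n i))
  collide : ¬ (∃[ i ] ∃[ j ] (i Fin.< j × f i ≡ f j))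
  collide (Fin.zero , Fin.suc j , _ , eq) =
    none (toℕ j , Finₚ.toℕ<n j , ≡.sym (Finₚ.fromℕ<-injective y _ y<N (Perm.bounded π (Finₚ.toℕ<n j)) eq))
  collide (Fin.suc i , Fin.suc j , s≤s i<j , eq) = ℕₚ.<⇒≢ i<j (Perm.injective π (Finₚ.toℕ<n i) (Finₚ.toℕ<n j)
    (Finₚ.fromℕ<-injective _ _ (Perm.bounded π (Finₚ.toℕ<n i)) (Perm.bounded π (Finₚ.toℕ<n j)) eq))

opaque
  fromPerm : ∀ {N w} → Perm N w → Permutation′ N
  fromPerm {N} {w} π = permutation to from
    (λ j → Finₚ.toℕ-injective (≡.trans (Finₚ.toℕ-fromℕ< _) (≡.trans (≡.cong w (Finₚ.toℕ-fromℕ< _)) (proj₂ (proj₂ (preimage j))))))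
    (λ i → Finₚ.toℕ-injective (≡.trans (Finₚ.toℕ-fromℕ< _) (Perm.injective π (proj₁ (proj₂ (preimage (to i)))) (Finₚ.toℕ<n i)
      (≡.trans (proj₂ (proj₂ (preimage (to i)))) (Finₚ.toℕ-fromℕ< _)))))
    where
    preimage : (j : Fin N) → ∃[ x ] (x < N × w x ≡ toℕ j)
    preimage j = Perm-surjective π (Finₚ.toℕ<n j)
    to from : Fin N → Fin N
    to i = fromℕ< (Perm.bounded π (Finₚ.toℕ<n i))
    from j = fromℕ< (proj₁ (proj₂ (preimage j)))

  toFun-fromPerm : ∀ {N w} (π : Perm N w) {k} → k < N → toFun (fromPerm π) k ≡ w k
  toFun-fromPerm {w = w} π k<N = ≡.trans (toFun-< (fromPerm π) k<N)
    (≡.trans (Finₚ.toℕ-fromℕ< _) (≡.cong w (Finₚ.toℕ-fromℕ< k<N)))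

prodFun-< : ∀ {a} u w {k} → k < a → prodFun a u w k ≡ u k
prodFun-< u w k<a rewrite <⇒<ᵇ-true k<a = ≡.refl

prodFun-≥ : ∀ {a} u w {k} → a ≤ k → prodFun a u w k ≡ a ℕ.+ w (k ∸ a)
prodFun-≥ u w a≤k rewrite ≥⇒<ᵇ-false a≤k = ≡.refl

-- Otherwise v maps the first l positions into themselves, hence onto themselves. The later
-- positions are then preserved as well, and the two restrictions decompose v.
indecomposable-crosses : ∀ {p} (v : Permutation′ (suc p)) → Indecomposable v → ∀ l → 1 ≤ l → l ≤ p →
  ∃[ a ] (a < l × l ≤ toFun v a)
indecomposable-crosses {p} v indec (suc a) _ 1+a≤p with ℕₚ.anyUpTo? (λ b → suc a ℕ.≤? toFun v b) (suc a)
... | yes found = found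
... | no none = ⊥-elim (indec (a , p ∸ suc a , sum , fromPerm πu , fromPerm πw , agree))
  where
  sum : suc a ℕ.+ suc (p ∸ suc a) ≡ suc p
  sum = ≡.trans (ℕₚ.+-suc (suc a) _) (≡.cong suc (ℕₚ.m+[n∸m]≡n 1+a≤p))
  π : Perm (suc p) (toFun v)
  π = Perm-toFun v
  below : ∀ {b} → b < suc a → toFun v b < suc a
  below {b} b<1+a = ℕₚ.≰⇒> (λ le → none (b , b<1+a , le))
  extend : ∀ {b} → b < suc a → b < suc p
  extend b<1+a = ℕₚ.<-≤-trans b<1+a (ℕₚ.m≤n⇒m≤1+n 1+a≤p)
  πu : Perm (suc a) (toFun v)
  πu = record { injective = λ a< b< → Perm.injective π (extend a<) (extend b<) ; bounded = below }
  shift : ∀ {k} → k < suc (p ∸ suc a) → suc a ℕ.+ k < suc p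
  shift {k} k< = ≡.subst (suc a ℕ.+ k <_) sum (ℕₚ.+-monoʳ-< (suc a) k<)
  -- A small value at a late position would already be taken by an early position, since the
  -- restriction to the first block is surjective.
  above : ∀ {k} → k < suc (p ∸ suc a) → suc a ≤ toFun v (suc a ℕ.+ k)
  above {k} k< with suc a ℕ.≤? toFun v (suc a ℕ.+ k)
  ... | yes le = le
  ... | no nle with Perm-surjective πu (ℕₚ.≰⇒> nle)
  ...   | x , x<1+a , eq = ⊥-elim (ℕₚ.<⇒≱ x<1+a (ℕₚ.≤-trans (ℕₚ.m≤m+n (suc a) k)
          (ℕₚ.≤-reflexive (≡.sym (Perm.injective π (extend x<1+a) (shift k<) eq)))))
  πw : Perm (suc (p ∸ suc a)) (λ k → toFun v (suc a ℕ.+ k) ∸ suc a)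
  πw = record
    { injective = λ {x} {y} x< y< eq → ℕₚ.+-cancelˡ-≡ (suc a) x y (Perm.injective π (shift x<) (shift y<)
        (ℕₚ.∸-cancelʳ-≡ (above x<) (above y<) eq))
    ; bounded = λ {x} x< → ℕₚ.+-cancelˡ-< (suc a) _ _ (≡.subst₂ _<_ (≡.sym (ℕₚ.m+[n∸m]≡n (above x<))) (≡.sym sum) (Perm.bounded π (shift x<))) }
  agree′ : ∀ k → k < suc p → Dec (k < suc a) → toFun v k ≡ prodFun (suc a) (toFun (fromPerm πu)) (toFun (fromPerm πw)) k
  agree′ k k<1+p (yes k<1+a) = ≡.sym (≡.trans (prodFun-< (toFun (fromPerm πu)) (toFun (fromPerm πw)) k<1+a) (toFun-fromPerm πu k<1+a))
  agree′ k k<1+p (no k≮1+a) = ≡.sym (≡.trans (prodFun-≥ (toFun (fromPerm πu)) (toFun (fromPerm πw)) 1+a≤k)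
    (≡.trans (≡.cong (suc a ℕ.+_) (toFun-fromPerm πw k∸<))
      (≡.trans (ℕₚ.m+[n∸m]≡n (above k∸<)) (≡.cong (toFun v) (ℕₚ.m+[n∸m]≡n 1+a≤k)))))
    where
    1+a≤k : suc a ≤ k
    1+a≤k = ℕₚ.≮⇒≥ k≮1+a
    k∸< : k ∸ suc a < suc (p ∸ suc a)
    k∸< = ℕₚ.+-cancelˡ-< (suc a) _ _ (≡.subst₂ _<_ (≡.sym (ℕₚ.m+[n∸m]≡n 1+a≤k)) (≡.sym sum) k<1+p)
  agree : ∀ k → k < suc p → toFun v k ≡ prodFun (suc a) (toFun (fromPerm πu)) (toFun (fromPerm πw)) k
  agree k k<1+p = agree′ k k<1+p (k ℕ.<? suc a)

sumℕ : ℕ → (ℕ → ℕ) → ℕ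
sumℕ zero h = 0
sumℕ (suc n) h = h 0 ℕ.+ sumℕ n (h ∘ suc)

length-concatMap : ∀ {A : Set} (f : ℕ → List A) g n → length (concatMap f (applyUpTo g n)) ≡ sumℕ n (length ∘ f ∘ g)
length-concatMap f g zero = ≡.refl
length-concatMap f g (suc n) = ≡.trans (Listₚ.length-++ (f (g 0))) (≡.cong (length (f (g 0)) ℕ.+_) (length-concatMap f (g ∘ suc) n))

length-filter : ∀ (w : ℕ → ℕ) t h m → length (filter (λ j → w j ℕ.<? t) (applyUpTo h m)) ≡ count m (λ k → w (h k) <ᵇ t)
length-filter w t h zero = ≡.refl
length-filter w t h (suc m) with w (h 0) <ᵇ t
... | true = ≡.cong suc (length-filter w t (h ∘ suc) m)
... | false = length-filter w t (h ∘ suc) m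

sumℕ-cong : ∀ n {h h′} → (∀ k → h k ≡ h′ k) → sumℕ n h ≡ sumℕ n h′
sumℕ-cong zero eq = ≡.refl
sumℕ-cong (suc n) eq = ≡.cong₂ ℕ._+_ (eq 0) (sumℕ-cong n (eq ∘ suc))

inv-rows : ∀ N w → inv N w ≡ sumℕ N (λ i → count (N ∸ suc i) (λ k → w (suc i ℕ.+ k) <ᵇ w i))
inv-rows zero w = ≡.refl
inv-rows (suc N) w = ≡.cong (count N (λ j → w (suc j) <ᵇ w 0) ℕ.+_) (inv-rows N (w ∘ suc))

len-inv : ∀ N w → Defs.len N w ≡ inv N w
len-inv N w = ≡.trans (length-concatMap _ id N) (≡.trans (sumℕ-cong N row) (≡.sym (inv-rows N w)))
  where
  row : ∀ i → length (filter (λ j → w j ℕ.<? w i) (map (λ d → suc i ℕ.+ d) (upTo (N ∸ suc i)))) ≡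
    count (N ∸ suc i) (λ k → w (suc i ℕ.+ k) <ᵇ w i)
  row i = ≡.trans (≡.cong (length ∘ filter (λ j → w j ℕ.<? w i)) (Listₚ.map-upTo (λ d → suc i ℕ.+ d) (N ∸ suc i)))
    (length-filter w (w i) (λ d → suc i ℕ.+ d) (N ∸ suc i))

prodFun-1× : ∀ j u k → prodFun (suc j) id u k ≡ 1× (prodFun j id u) k
prodFun-1× j u zero = ≡.refl
prodFun-1× j u (suc k) with k <ᵇ j
... | true = ≡.refl
... | false = ≡.refl

Perm-cong : ∀ {N w w′} → (∀ k → k < N → w k ≡ w′ k) → Perm N w → Perm N w′
Perm-cong eq π = record
  { injective = λ {a} {b} a<N b<N e → Perm.injective π a<N b<N (≡.trans (eq a a<N) (≡.trans e (≡.sym (eq b b<N))))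
  ; bounded = λ {a} a<N → ≡.subst (_< _) (eq a a<N) (Perm.bounded π a<N) }

Perm-1× : ∀ {N w} → Perm N w → Perm (suc N) (1× w)
Perm-1× {N} {w} π = record { injective = λ {a} {b} → inj a b ; bounded = λ {a} → bnd a }
  where
  inj : ∀ a b → a < suc N → b < suc N → 1× w a ≡ 1× w b → a ≡ b
  inj zero zero _ _ _ = ≡.refl
  inj (suc a) (suc b) (s≤s a<N) (s≤s b<N) eq = ≡.cong suc (Perm.injective π a<N b<N (ℕₚ.suc-injective eq))
  bnd : ∀ a → a < suc N → 1× w a < suc N
  bnd zero _ = s≤s z≤n
  bnd (suc a) (s≤s a<N) = s≤s (Perm.bounded π a<N)

count-none : ∀ N {P} → (∀ k → P k ≡ false) → count N P ≡ 0
count-none zero eq = ≡.refl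
count-none (suc N) eq rewrite eq 0 = count-none N (eq ∘ suc)

inv-suc∘ : ∀ N w → inv N (suc ∘ w) ≡ inv N w
inv-suc∘ zero w = ≡.refl
inv-suc∘ (suc N) w = ≡.cong (count N (λ j → w (suc j) <ᵇ w 0) ℕ.+_) (inv-suc∘ N (w ∘ suc))

inv-1× : ∀ N w → inv (suc N) (1× w) ≡ inv N w
inv-1× N w = ≡.trans (≡.cong (ℕ._+ inv N (suc ∘ w)) (count-none N (λ _ → ≡.refl))) (inv-suc∘ N w)

module Shifted {p} (v : Permutation′ (suc p)) where
  w : ℕ → ℕ → ℕ
  w j = prodFun j id (toFun v)

  Perm-w : ∀ j → Perm (j ℕ.+ suc p) (w j)
  Perm-w zero = Perm-toFun v
  Perm-w (suc j) = Perm-cong (λ k _ → ≡.sym (prodFun-1× j (toFun v) k)) (Perm-1× (Perm-w j))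

  inv-w : ∀ j → inv (j ℕ.+ suc p) (w j) ≡ inv (suc p) (toFun v)
  inv-w zero = ≡.refl
  inv-w (suc j) = ≡.trans (inv-cong (suc (j ℕ.+ suc p)) (λ k _ → prodFun-1× j (toFun v) k))
    (≡.trans (inv-1× (j ℕ.+ suc p) (w j)) (inv-w j))

  w-< : ∀ {j k} → k < j → w j k ≡ k
  w-< = prodFun-< id (toFun v)

  w-+ : ∀ j k → w j (j ℕ.+ k) ≡ j ℕ.+ toFun v k
  w-+ j k = ≡.trans (prodFun-≥ id (toFun v) (ℕₚ.m≤m+n j k)) (≡.cong (λ i → j ℕ.+ toFun v i) (ℕₚ.m+n∸m≡n j k))

  w-≥ : ∀ {j k} → j ℕ.+ suc p ≤ k → w j k ≡ k
  w-≥ {j} {k} le = ≡.subst (λ k → w j k ≡ k) (ℕₚ.m+[n∸m]≡n j≤k)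
    (≡.trans (w-+ j (k ∸ j)) (≡.cong (j ℕ.+_) (toFun-≥ v (ℕₚ.m+n≤o⇒m≤o∸n (suc p) (≡.subst (_≤ k) (ℕₚ.+-comm j (suc p)) le)))))
    where
    j≤k : j ≤ k
    j≤k = ℕₚ.≤-trans (ℕₚ.m≤m+n j (suc p)) le

  w-crosses : Indecomposable v → ∀ j l → j < l → l ≤ j ℕ.+ p → ∃[ a ] (a < l × l ≤ w j a)
  w-crosses indec j l j<l l≤j+p with indecomposable-crosses v indec (l ∸ j) (ℕₚ.m<n⇒0<n∸m j<l) (ℕₚ.m≤n+o⇒m∸n≤o l j l≤j+p)
  ... | a , a< , le = j ℕ.+ a , ≡.subst (j ℕ.+ a <_) l≡ (ℕₚ.+-monoʳ-< j a<)
    , ≡.subst₂ _≤_ l≡ (≡.sym (w-+ j a)) (ℕₚ.+-monoʳ-≤ j le)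
    where
    l≡ : j ℕ.+ (l ∸ j) ≡ l
    l≡ = ℕₚ.m+[n∸m]≡n (ℕₚ.<⇒≤ j<l)

  vShift-w : ∀ m k → prodFun (m ℕ.+ suc p) (w m) id k ≡ w m k
  vShift-w m k with k ℕ.<? (m ℕ.+ suc p)
  ... | yes k< = prodFun-< (w m) id k<
  ... | no k≮ = ≡.trans (prodFun-≥ (w m) id (ℕₚ.≮⇒≥ k≮)) (≡.trans (ℕₚ.m+[n∸m]≡n (ℕₚ.≮⇒≥ k≮)) (≡.sym (w-≥ {m} {k} (ℕₚ.≮⇒≥ k≮))))

-- The inverse q-Pochhammer series

module Series {c ℓ} (K : CommutativeRing c ℓ) (q : CommutativeRing.Carrier K) where
  open CommutativeRing K
  open SetoidReasoning setoid
  open IntegerSolver K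
  open Sums K
  open Gaussian K q
  open EvalHom K

  sumL-applyUpTo : ∀ (h : ℕ → Carrier) g n → Defs.sumL K (map h (applyUpTo g n)) ≈ ∑ n (h ∘ g)
  sumL-applyUpTo h g zero = refl
  sumL-applyUpTo h g (suc n) = +-congˡ (sumL-applyUpTo h (g ∘ suc) n)

  ⋆-∑ : ∀ f g j → Defs._⋆_ K f g j ≈ ∑ (suc j) (λ i → f i * g (j ∸ i))
  ⋆-∑ f g j = sumL-applyUpTo (λ i → f i * g (j ∸ i)) id (suc j)

  geom-⋆-suc : ∀ r h j → Defs._⋆_ K (Defs.geomS K r) h (suc j) ≈ h (suc j) + r * Defs._⋆_ K (Defs.geomS K r) h j
  geom-⋆-suc r h j = begin
    Defs._⋆_ K (Defs.geomS K r) h (suc j)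
      ≈⟨ ⋆-∑ (Defs.geomS K r) h (suc j) ⟩
    1# * h (suc j) + ∑ (suc j) (λ i → r * Defs.pow K r i * h (j ∸ i))
      ≈⟨ +-cong (*-identityˡ _) (∑-cong (suc j) (λ i _ → *-assoc r (Defs.pow K r i) (h (j ∸ i)))) ⟩
    h (suc j) + ∑ (suc j) (λ i → r * (Defs.pow K r i * h (j ∸ i)))
      ≈⟨ +-congˡ (trans (∑-* (suc j) r (λ i → Defs.pow K r i * h (j ∸ i))) (*-congˡ (sym (⋆-∑ (Defs.geomS K r) h j)))) ⟩
    h (suc j) + r * Defs._⋆_ K (Defs.geomS K r) h j ∎

  pow-* : ∀ x y n → Defs.pow K (x * y) n ≈ Defs.pow K x n * Defs.pow K y n
  pow-* x y zero = sym (*-identityˡ _)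
  pow-* x y (suc n) = trans (*-congˡ (pow-* x y n))
    (solve 4 (λ x y u v → (x :* y) :* (u :* v) := (x :* u) :* (y :* v)) refl x y _ _)

  -- The coefficients of the product of 1/(1 - q^i t) over k ≤ i < k+n. The offset k is free because
  -- the product is taken apart at its first factor; the factor (q^k)^j rescales t to q^k t.
  geometric-product : ∀ n k f → (∀ i → f i ≡ k ℕ.+ i) → ∀ j →
    foldr (Defs._⋆_ K) (Defs.oneS K) (map (λ i → Defs.geomS K (Defs.pow K q i)) (applyUpTo f n)) j
      ≈ Defs.pow K (Defs.pow K q k) j * β n j
  geometric-product zero k f f≡ zero = sym (*-identityˡ 1#)
  geometric-product zero k f f≡ (suc j) = sym (zeroʳ _)
  geometric-product (suc n) k f f≡ j rewrite ≡.trans (f≡ 0) (ℕₚ.+-identityʳ k) = go j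
    where
    r : Carrier
    r = Defs.pow K q k
    h : ℕ → Carrier
    h = foldr (Defs._⋆_ K) (Defs.oneS K) (map (λ i → Defs.geomS K (Defs.pow K q i)) (applyUpTo (f ∘ suc) n))
    h-β : ∀ j → h j ≈ Defs.pow K (q * r) j * β n j
    h-β = geometric-product n (suc k) (f ∘ suc) (λ i → ≡.trans (f≡ (suc i)) (ℕₚ.+-suc k i))
    go : ∀ j → Defs._⋆_ K (Defs.geomS K r) h j ≈ Defs.pow K r j * β (suc n) j
    go zero = begin
      1# * h 0 + 0#        ≈⟨ trans (+-identityʳ _) (*-congˡ (trans (h-β 0) (*-congˡ (β-zero n)))) ⟩
      1# * (1# * 1#)       ≈⟨ *-congˡ (*-identityˡ 1#) ⟩
      1# * 1#              ∎
    go (suc j) = begin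
      Defs._⋆_ K (Defs.geomS K r) h (suc j)
        ≈⟨ trans (geom-⋆-suc r h j) (+-cong (trans (h-β (suc j)) (*-congʳ (pow-* q r (suc j)))) (*-congˡ (go j))) ⟩
      (Defs.pow K q (suc j) * (r * Defs.pow K r j)) * β n (suc j) + r * (Defs.pow K r j * β (suc n) j)
        ≈⟨ solve 5 (λ a r p b b′ → (a :* (r :* p)) :* b :+ r :* (p :* b′) := (r :* p) :* (b′ :+ a :* b)) refl (Defs.pow K q (suc j)) r (Defs.pow K r j) (β n (suc j)) (β (suc n) j) ⟩
      Defs.pow K r (suc j) * β (suc n) (suc j) ∎

  invPoch-β : ∀ n j → Defs.invPoch K q n j ≈ β n j
  invPoch-β n j = trans (geometric-product n 0 id (λ _ → ≡.refl) j) (trans (*-congʳ (pow-1 j)) (*-identityˡ _))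
    where
    pow-1 : ∀ j → Defs.pow K 1# j ≈ 1#
    pow-1 zero = refl
    pow-1 (suc j) = trans (*-identityˡ _) (pow-1 j)

  ∑-reverse : ∀ j (h : ℕ → Carrier) → ∑ (suc j) (λ i → h (j ∸ i)) ≈ ∑ (suc j) h
  ∑-reverse zero h = refl
  ∑-reverse (suc j) h = trans (+-congˡ (∑-reverse j h)) (trans (+-comm _ _) (sym (∑-last (suc j) h)))

-- Identification with the given definitions and proof of the theorem

module Assembly {c ℓ} (K : CommutativeRing c ℓ) (nontrivial : ¬ (CommutativeRing._≈_ K (CommutativeRing.1# K) (CommutativeRing.0# K)))
  (q : CommutativeRing.Carrier K)
  (cancel : ∀ n {x y} → CommutativeRing._≈_ K (CommutativeRing._*_ K (Gaussian.num K q (suc n)) x) (CommutativeRing._*_ K (Gaussian.num K q (suc n)) y) → CommutativeRing._≈_ K x y) where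
  open Recursion K nontrivial q cancel
  open Series K q
  open CommutativeRing PR
  open SetoidReasoning setoid
  open IntegerSolver PR
  open Products PR

  linP-L : ∀ i j → Defs.linP K q i j ≈ L i j
  linP-L i j = trans (∷-+ q (unitE i) _) (+-cong
    (trans (unit-ext (𝕂.sym (𝕂.*-identityʳ q)) ≐-refl) (sym (unit-* q [] 𝕂.1# (unitE i))))
    (begin
      ((𝕂.- 𝕂.1# , unitE j) ∷ [])    ≈⟨ trans (unit-ext (𝕂.sym (𝕂.*-identityʳ (𝕂.- 𝕂.1#))) ≐-refl) (sym (unit-* (𝕂.- 𝕂.1#) [] 𝕂.1# (unitE j))) ⟩
      C (𝕂.- 𝕂.1#) * X j             ≈⟨ *-congʳ (C-neg 𝕂.1#) ⟩
      - 1# * X j                     ≈⟨ solve 1 (λ x → (:- con (+ 1)) :* x := :- x) refl (X j) ⟩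
      - X j                          ∎))

  prodP-∷ : ∀ x xs → Defs.prodP K (x ∷ xs) ≈ x * Defs.prodP K xs
  prodP-∷ x xs = sym (reflexive (*ₚ-mulP x (Defs.prodP K xs)))

  prodP-++ : ∀ xs ys → Defs.prodP K (xs ++ ys) ≈ Defs.prodP K xs * Defs.prodP K ys
  prodP-++ [] ys = sym (*-identityˡ _)
  prodP-++ (x ∷ xs) ys = begin
    Defs.prodP K (x ∷ (xs ++ ys))                   ≈⟨ prodP-∷ x (xs ++ ys) ⟩
    x * Defs.prodP K (xs ++ ys)                     ≈⟨ *-congˡ (prodP-++ xs ys) ⟩
    x * (Defs.prodP K xs * Defs.prodP K ys)         ≈⟨ *-assoc x _ _ ⟨
    (x * Defs.prodP K xs) * Defs.prodP K ys         ≈⟨ *-congʳ (prodP-∷ x xs) ⟨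
    Defs.prodP K (x ∷ xs) * Defs.prodP K ys         ∎

  prodP-map : ∀ (h : ℕ → Poly) g n → Defs.prodP K (map h (applyUpTo g n)) ≈ ∏ n (h ∘ g)
  prodP-map h g zero = refl
  prodP-map h g (suc n) = trans (prodP-∷ (h (g 0)) (map h (applyUpTo (g ∘ suc) n))) (*-congˡ (prodP-map h (g ∘ suc) n))

  prodP-concatMap : ∀ (f : ℕ → List Poly) g n → Defs.prodP K (concatMap f (applyUpTo g n)) ≈ ∏ n (λ i → Defs.prodP K (f (g i)))
  prodP-concatMap f g zero = refl
  prodP-concatMap f g (suc n) = trans (prodP-++ (f (g 0)) (concatMap f (applyUpTo (g ∘ suc) n))) (*-congˡ (prodP-concatMap f (g ∘ suc) n))

  row : ∀ n i → Defs.prodP K (map (λ k → Defs.linP K q i (i ℕ.+ 2 ℕ.+ k)) (upTo (n ∸ (i ℕ.+ 2)))) ≈ ∏ n (factor i)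
  row n i with (i ℕ.+ 2) ℕ.≤? n
  ... | yes le = begin
    Defs.prodP K (map (λ k → Defs.linP K q i (i ℕ.+ 2 ℕ.+ k)) (upTo m))   ≈⟨ prodP-map (λ k → Defs.linP K q i (i ℕ.+ 2 ℕ.+ k)) id m ⟩
    ∏ m (λ k → Defs.linP K q i (i ℕ.+ 2 ℕ.+ k))                           ≈⟨ ∏-cong m (λ k _ → trans (linP-L i _) (sym (factor-L (beyond k)))) ⟩
    ∏ m (λ k → factor i (i ℕ.+ 2 ℕ.+ k))                                  ≈⟨ trans (*-congʳ ones) (*-identityˡ _) ⟨
    ∏ (i ℕ.+ 2) (factor i) * ∏ m (λ k → factor i (i ℕ.+ 2 ℕ.+ k))         ≈⟨ ∏-+ (i ℕ.+ 2) m (factor i) ⟨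
    ∏ (i ℕ.+ 2 ℕ.+ m) (factor i)                                          ≡⟨ ≡.cong (λ n → ∏ n (factor i)) (ℕₚ.m+[n∸m]≡n le) ⟩
    ∏ n (factor i)                                                        ∎
    where
    m : ℕ
    m = n ∸ (i ℕ.+ 2)
    beyond : ∀ k → suc i < i ℕ.+ 2 ℕ.+ k
    beyond k = ℕₚ.<-≤-trans (≡.subst (suc i <_) (ℕₚ.+-comm 2 i) (ℕₚ.n<1+n (suc i))) (ℕₚ.m≤m+n (i ℕ.+ 2) k)
    ones : ∏ (i ℕ.+ 2) (factor i) ≈ 1#
    ones = ∏-1 (i ℕ.+ 2) (λ j j<i+2 → factor-1 (ℕₚ.≤-pred (≡.subst (j <_) (ℕₚ.+-comm i 2) j<i+2)))
  ... | no nle rewrite ℕₚ.m≤n⇒m∸n≡0 (ℕₚ.<⇒≤ (ℕₚ.≰⇒> nle)) =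
    sym (∏-1 n (λ j j<n → factor-1 (ℕₚ.≤-trans (ℕₚ.<⇒≤ j<n) (ℕₚ.≤-pred (≡.subst (n <_) (ℕₚ.+-comm i 2) (ℕₚ.≰⇒> nle))))))

  aCoeff-lam : ∀ n w → Defs.aCoeff K q n w 𝕂.≈ lam n (Defs.schub K n w)
  aCoeff-lam n w = ε-cong (begin
    Defs.∂w0 K n (Defs.mulP K S Q)            ≡⟨ ≡.trans (≡.cong (λ u → Defs.applyWord K u (Defs.mulP K S Q)) (longestWord-Defs n)) (≡.sym (word-Defs (longestWord n) _)) ⟩
    word (longestWord n) (Defs.mulP K S Q)    ≈⟨ word-cong (longestWord n) (trans (sym (reflexive (*ₚ-mulP S Q))) (*-congˡ Q-Π)) ⟩
    word (longestWord n) (S * Π n)            ∎)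
    where
    S Q : Poly
    S = Defs.schub K n w
    Q = Defs.prodP K (concatMap (λ i → map (λ k → Defs.linP K q i (i ℕ.+ 2 ℕ.+ k)) (upTo (n ∸ (i ℕ.+ 2)))) (upTo n))
    Q-Π : Q ≈ Π n
    Q-Π = trans (prodP-concatMap (λ i → map (λ k → Defs.linP K q i (i ℕ.+ 2 ℕ.+ k)) (upTo (n ∸ (i ℕ.+ 2)))) id n) (∏-cong n (λ i _ → row n i))

  Perm-suc : ∀ {N w} → w N ≡ N → Perm N w → Perm (suc N) w
  Perm-suc {N} {w} wN≡N π = record { injective = λ {a} {b} → inj a b ; bounded = λ {a} → bnd a }
    where
    case : ∀ {a} → a < suc N → a < N ⊎ a ≡ N
    case (s≤s a≤N) = ℕₚ.m≤n⇒m<n∨m≡n a≤N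
    apart : ∀ {a b} → a < N → b ≡ N → w a ≢ w b
    apart a<N ≡.refl eq = ℕₚ.<⇒≢ (Perm.bounded π a<N) (≡.trans eq wN≡N)
    inj : ∀ a b → a < suc N → b < suc N → w a ≡ w b → a ≡ b
    inj a b a< b< eq with case a< | case b<
    ... | inj₁ a<N | inj₁ b<N = Perm.injective π a<N b<N eq
    ... | inj₁ a<N | inj₂ b≡N = ⊥-elim (apart a<N b≡N eq)
    ... | inj₂ a≡N | inj₁ b<N = ⊥-elim (apart b<N a≡N (≡.sym eq))
    ... | inj₂ a≡N | inj₂ b≡N = ≡.trans a≡N (≡.sym b≡N)
    bnd : ∀ a → a < suc N → w a < suc N
    bnd a a< with case a<
    ... | inj₁ a<N = ℕₚ.<-trans (Perm.bounded π a<N) (ℕₚ.n<1+n N)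
    ... | inj₂ ≡.refl = ≡.subst (_< suc N) (≡.sym wN≡N) (ℕₚ.n<1+n N)

  𝔖-stable-+ : ∀ t {N w} → Perm N w → (∀ {k} → N ≤ k → w k ≡ k) → Perm (t ℕ.+ N) w × 𝔖 (t ℕ.+ N) w ≈ 𝔖 N w
  𝔖-stable-+ zero π fixed = π , refl
  𝔖-stable-+ (suc t) {N} {w} π fixed with 𝔖-stable-+ t π fixed
  ... | π′ , e = Perm-suc (fixed (ℕₚ.m≤n+m N t)) π′ , trans (𝔖-stable (t ℕ.+ N) w π′ (fixed (ℕₚ.m≤n+m N t))) e

  𝔖-stable-≤ : ∀ {N M w} → Perm N w → (∀ {k} → N ≤ k → w k ≡ k) → N ≤ M → Perm M w × 𝔖 M w ≈ 𝔖 N w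
  𝔖-stable-≤ {N} {M} {w} π fixed N≤M = ≡.subst (λ M → Perm M w × 𝔖 M w ≈ 𝔖 N w) (ℕₚ.m∸n+n≡m N≤M) (𝔖-stable-+ (M ∸ N) π fixed)

  -- Crossing the cut at l survives multiplication by letters of the two blocks, so no word in
  -- these letters reaches the identity.
  killed-𝔖 : ∀ M l r → l ℕ.+ r ≤ M → ∀ d w → Perm M w → ∃[ a ] (a < M × a < l × l ≤ w a) → Killed (InBlocks l r) d (𝔖 M w)
  killed-𝔖 M l r l+r≤M zero w π (a , a<M , a<l , l≤wa) with inv M w in eq
  ... | zero = ⊥-elim (ℕₚ.<⇒≱ a<l (≡.subst (l ≤_) (inv-zero-id π eq a a<M) l≤wa))
  ... | suc _ = ε-hom (hom-≡ eq (hom-𝔖 M w π))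
  killed-𝔖 M l r l+r≤M (suc d) w π (a , a<M , a<l , l≤wa) k k∈ with ℕₚ.<-cmp (w k) (w (suc k))
  ... | tri< asc _ _ = killed-≈ {InBlocks l r} d (sym (∂-climbTop-ascent M w k (D M) (ℕₚ.<-≤-trans (block-letter k∈) l+r≤M , asc))) (killed-0 d)
  ... | tri≈ _ e _ = ⊥-elim (Perm-≢ {M} {w} π (ℕₚ.<-≤-trans (block-letter k∈) l+r≤M) e)
  ... | tri> _ _ desc = killed-≈ {InBlocks l r} d (sym (∂-climbTop-descent M w k (D M) 1+k<M desc))
        (killed-𝔖 M l r l+r≤M d (w ∘ sFun k) (Perm-swap 1+k<M π)
          (sFun k a , sFun-< 1+k<M a<M , stays k∈ , ≡.subst (λ b → l ≤ w b) (≡.sym (sFun-involutive k a)) l≤wa))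
    where
    1+k<M : suc k < M
    1+k<M = ℕₚ.<-≤-trans (block-letter k∈) l+r≤M
    stays : ∀ {k} → InBlocks l r k → sFun k a < l
    stays (inA 1+k<l) = sFun-< 1+k<l a<l
    stays (inB {k} _) = ≡.subst (_< l) (≡.sym (sFun-other (ℕₚ.<⇒≢ (ℕₚ.<-≤-trans a<l (ℕₚ.m≤m+n l k)))
      (ℕₚ.<⇒≢ (ℕₚ.<-≤-trans a<l (ℕₚ.≤-trans (ℕₚ.m≤m+n l k) (ℕₚ.n≤1+n _)))))) a<l

  module _ {p} (v : Permutation′ (suc p)) (indec : Indecomposable v) where
    open Shifted v

    f : ℕ → Poly
    f j = 𝔖 (j ℕ.+ suc p) (w j)

    ν-f : ∀ j → Defs.ν K q p v j 𝕂.≈ ev (Defs.pow K q) (f j)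
    ν-f j = ev-cong (Defs.pow K q) (schub-𝔖 (j ℕ.+ suc p) (w j))

    ρ-f : ∀ j → ρ (f (suc j)) ≈ f j
    ρ-f j = trans (ρ.cong (climbTop-cong (suc (j ℕ.+ suc p)) (D (suc (j ℕ.+ suc p))) (λ k _ → prodFun-1× j (toFun v) k)))
      (ρ-𝔖 (j ℕ.+ suc p) (w j) (Perm-w j))

    ρ^-f : ∀ m j → m ≤ j → ρ^ m (f j) ≈ f (j ∸ m)
    ρ^-f zero j _ = refl
    ρ^-f (suc m) (suc j) (s≤s m≤j) = trans (IsHom.cong (ρ^-isHom m) (ρ-f j)) (ρ^-f m j m≤j)

    aCoeff-f : ∀ n m → m ℕ.+ suc p ≤ n → Defs.aCoeff K q n (Defs.vShift K p v m) 𝕂.≈ lam n (f m)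
    aCoeff-f n m le = 𝕂.trans (aCoeff-lam n _) (lam-cong n (begin
      Defs.schub K n (Defs.vShift K p v m)   ≈⟨ schub-𝔖 n _ ⟩
      𝔖 n (Defs.vShift K p v m)              ≈⟨ climbTop-cong n (D n) (λ k _ → vShift-w m k) ⟩
      𝔖 n (w m)                              ≈⟨ proj₂ (𝔖-stable-≤ (Perm-w m) w-≥ le) ⟩
      f m                                    ∎))

    f-symmetric : ∀ j k → k < j → s k (f j) ≈ f j
    f-symmetric j k k<j = sym-∂ k (∂-climbTop-ascent (j ℕ.+ suc p) (w j) k _ (1+k<N , asc))
      where
      1+k<N : suc k < j ℕ.+ suc p
      1+k<N = ℕₚ.≤-<-trans k<j (ℕₚ.m<m+n j (s≤s z≤n))
      asc : w j k < w j (suc k)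
      asc with ℕₚ.m≤n⇒m<n∨m≡n k<j
      ... | inj₁ 1+k<j = ≡.subst₂ _<_ (≡.sym (w-< k<j)) (≡.sym (w-< 1+k<j)) (ℕₚ.n<1+n k)
      ... | inj₂ ≡.refl = ≡.subst₂ _<_ (≡.sym (w-< k<j)) (≡.trans (≡.sym (w-+ j 0)) (≡.cong (w j) (ℕₚ.+-identityʳ j))) (s≤s (ℕₚ.m≤n⇒m≤n+o _ (ℕₚ.≤-pred k<j)))

    f-killed : ∀ j l → j ≤ l → l < j ℕ.+ p → ∀ r d → Killed (InBlocks (suc l) r) d (f j)
    f-killed j l j≤l l<j+p r d with w-crosses indec j (suc l) (s≤s j≤l) l<j+p
    ... | a , a≤l , l<wa = killed-≈ {InBlocks (suc l) r} d (proj₂ stable)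
          (killed-𝔖 M (suc l) r (ℕₚ.m≤n+m _ _) d (w j) (proj₁ stable)
            (a , ℕₚ.<-≤-trans a≤l (ℕₚ.≤-trans (ℕₚ.m≤m+n (suc l) r) (ℕₚ.m≤n+m _ (j ℕ.+ suc p))) , a≤l , l<wa))
      where
      -- Large enough for `w j` and for every letter of the two blocks, as r is arbitrary; stability
      -- allows passing from the original size to M.
      M : ℕ
      M = j ℕ.+ suc p ℕ.+ (suc l ℕ.+ r)
      stable : Perm M (w j) × 𝔖 M (w j) ≈ f j
      stable = 𝔖-stable-≤ (Perm-w j) w-≥ (ℕₚ.m≤m+n (j ℕ.+ suc p) _)

    module _ (n : ℕ) (len≡n : Defs.len (suc p) (toFun v) ≡ n) where
      inv≡n : inv (suc p) (toFun v) ≡ n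
      inv≡n = ≡.trans (≡.sym (len-inv (suc p) (toFun v))) len≡n

      f-hom : ∀ j → Hom (_< suc (j ℕ.+ p)) n (f j)
      f-hom j = ≡.subst (λ N → Hom (_< N) n (f j)) (ℕₚ.+-suc j p) (hom-≡ (≡.trans (inv-w j) inv≡n) (hom-𝔖 (j ℕ.+ suc p) (w j) (Perm-w j)))

      module At (1≤n : 1 ≤ n) (j : ℕ) =
        Main j p n 1≤n (f j) (f-hom j) (f-symmetric j) (f-killed j)

      -- The value 0 that `numer` takes beyond its range is the true value of λ there by
      -- `lam-vanishes`, so the convolution can run over all m ≤ j.
      numer-f : 1 ≤ n → ∀ m → Defs.numer K q (suc n) p v m 𝕂.≈ lam (suc n) (f m)
      numer-f 1≤n m with m <ᵇ (suc n ∸ p) in eq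
      ... | true = aCoeff-f (suc n) m (≡.subst (_≤ suc n) (≡.sym (ℕₚ.+-suc m p))
              (ℕₚ.m≤o∸n⇒m+n≤o (suc m) (ℕₚ.<⇒≤ (ℕₚ.m∸n≢0⇒n<m (ℕₚ.m<n⇒n≢0 (<ᵇ-true eq)))) (<ᵇ-true eq)))
      ... | false = 𝕂.sym (At.lam-vanishes 1≤n m (≡.subst (suc n ≤_) (ℕₚ.+-comm p m)
              (ℕₚ.≤-trans (ℕₚ.m≤n+m∸n (suc n) p) (ℕₚ.+-monoʳ-≤ p (<ᵇ-false eq)))))

      expansion : 1 ≤ n → ∀ j → ev (Defs.pow K q) (f j) 𝕂.≈ 𝕂.∑ (suc j) (λ m → Defs.numer K q (suc n) p v m 𝕂.* Defs.invPoch K q (suc n) (j ∸ m))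
      expansion 1≤n j = 𝕂.begin
        ev (Defs.pow K q) (f j)
          𝕂.≈⟨ At.ev-expansion 1≤n j ⟩
        𝕂.∑ (suc j) (λ m → β (suc n) m 𝕂.* lam (suc n) (ρ^ m (f j)))
          𝕂.≈⟨ ∑-reverse j (λ m → β (suc n) m 𝕂.* lam (suc n) (ρ^ m (f j))) ⟨
        𝕂.∑ (suc j) (λ m → β (suc n) (j ∸ m) 𝕂.* lam (suc n) (ρ^ (j ∸ m) (f j)))
          𝕂.≈⟨ 𝕂.∑-cong (suc j) (λ m m≤j → 𝕂.trans (𝕂.*-comm _ _) (𝕂.*-cong
                (𝕂.trans (lam-cong (suc n) (trans (ρ^-f (j ∸ m) j (ℕₚ.m∸n≤m j m)) (reflexive (≡.cong f (ℕₚ.m∸[m∸n]≡n (ℕₚ.≤-pred m≤j)))))) (𝕂.sym (numer-f 1≤n m)))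
                (𝕂.sym (invPoch-β (suc n) (j ∸ m))))) ⟩
        𝕂.∑ (suc j) (λ m → Defs.numer K q (suc n) p v m 𝕂.* Defs.invPoch K q (suc n) (j ∸ m)) 𝕂.∎

      theorem-positive : 1 ≤ n → ∀ j → Defs.ν K q p v j 𝕂.≈ Defs._⋆_ K (Defs.numer K q (suc n) p v) (Defs.invPoch K q (suc n)) j
      theorem-positive 1≤n j = 𝕂.trans (ν-f j) (𝕂.trans (expansion 1≤n j) (𝕂.sym (⋆-∑ (Defs.numer K q (suc n) p v) (Defs.invPoch K q (suc n)) j)))

    -- Length 0 needs its own argument: the recursion distinguishes the cuts l = i and l = n+i, with
    -- n the length of v, and these coincide for n = 0. Here v is the identity of S_1, and both
    -- sides are the geometric series.
    module _ (len≡0 : Defs.len (suc p) (toFun v) ≡ 0) where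
      p≡0 : p ≡ 0
      p≡0 with p ℕ.≟ 0
      ... | yes p≡0 = p≡0
      ... | no p≢0 with indecomposable-crosses v indec 1 ℕₚ.≤-refl (ℕₚ.n≢0⇒n>0 p≢0)
      ...   | zero , _ , 1≤v0 with () ← ≡.subst (1 ≤_) (inv-zero-id {suc p} {toFun v} (Perm-toFun v) (≡.trans (≡.sym (len-inv (suc p) (toFun v))) len≡0) 0 (s≤s z≤n)) 1≤v0
      ...   | suc _ , s≤s () , _

      f≈1 : ∀ j → f j ≈ 1#
      f≈1 j = begin
        climbTop N (w j) (D N)        ≈⟨ climbTop-cong N (D N) (inv-zero-id {N} {w j} (Perm-w j) (≡.trans (inv-w j) (≡.trans (≡.sym (len-inv (suc p) (toFun v))) len≡0))) ⟩
        climbTop N id (D N)           ≈⟨ longestWord-climb N (D N) ⟨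
        word (longestWord N) (D N)    ≈⟨ word-longestWord-D N ⟩
        1#                            ∎
        where
        N : ℕ
        N = j ℕ.+ suc p

      numer-zero : Defs.numer K q 1 p v 0 𝕂.≈ 𝕂.1#
      numer-zero with 0 <ᵇ (1 ∸ p) in eq
      ... | true = 𝕂.trans (aCoeff-f 1 0 (≡.subst (λ p → suc p ≤ 1) (≡.sym p≡0) ℕₚ.≤-refl)) (𝕂.trans (lam-cong 1 (f≈1 0)) (lam-X₀ 0))
      ... | false = ⊥-elim (ℕₚ.<⇒≱ (≡.subst (λ p → 0 < 1 ∸ p) (≡.sym p≡0) (s≤s z≤n)) (<ᵇ-false eq))

      numer-suc : ∀ m → Defs.numer K q 1 p v (suc m) 𝕂.≈ 𝕂.0#
      numer-suc m with suc m <ᵇ (1 ∸ p) in eq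
      ... | true = ⊥-elim (ℕₚ.<⇒≱ (<ᵇ-true eq) (ℕₚ.≤-trans (ℕₚ.m∸n≤m 1 p) (s≤s z≤n)))
      ... | false = 𝕂.refl

      theorem-zero : ∀ j → Defs.ν K q p v j 𝕂.≈ Defs._⋆_ K (Defs.numer K q 1 p v) (Defs.invPoch K q 1) j
      theorem-zero j = 𝕂.begin
        Defs.ν K q p v j
          𝕂.≈⟨ 𝕂.trans (ν-f j) (𝕂.trans (ev-cong _ (f≈1 j)) (ev-C (Defs.pow K q) 𝕂.1#)) ⟩
        𝕂.1#
          𝕂.≈⟨ 𝕂.trans (𝕂.+-cong (𝕂.trans (𝕂.*-cong numer-zero (𝕂.trans (invPoch-β 1 j) (β-one j))) (𝕂.*-identityˡ _))
                (𝕂.∑-0 j (λ m _ → 𝕂.trans (𝕂.*-congʳ (numer-suc m)) (𝕂.zeroˡ _)))) (𝕂.+-identityʳ _) ⟨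
        𝕂.∑ (suc j) (λ m → Defs.numer K q 1 p v m 𝕂.* Defs.invPoch K q 1 (j ∸ m))
          𝕂.≈⟨ ⋆-∑ (Defs.numer K q 1 p v) (Defs.invPoch K q 1) j ⟨
        Defs._⋆_ K (Defs.numer K q 1 p v) (Defs.invPoch K q 1) j 𝕂.∎

    theorem : ∀ n → suc (Defs.len (suc p) (toFun v)) ≡ n → ∀ j →
      Defs.ν K q p v j 𝕂.≈ Defs._⋆_ K (Defs.numer K q n p v) (Defs.invPoch K q n) j
    theorem _ ≡.refl with Defs.len (suc p) (toFun v) in eq
    ... | zero = theorem-zero eq
    ... | suc n = theorem-positive (suc n) eq (s≤s z≤n)

-- Cancelling q-integers

module Cancellation {c ℓ} (K : CommutativeRing c ℓ) (isField : Defs.IsField K) (char : Defs.CharZero K)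
  (q : CommutativeRing.Carrier K) (notRoot : Defs.NotNontrivialRootOfUnity K q) where
  open CommutativeRing K
  open SetoidReasoning setoid
  open IntegerSolver K
  open Gaussian K q

  pow-num : ∀ n → Defs.pow K q n ≈ 1# + (q - 1#) * num n
  pow-num zero = solve 1 (λ q → con (+ 1) := con (+ 1) :+ (q :- con (+ 1)) :* con (+ 0)) refl q
  pow-num (suc n) = trans (*-congˡ (pow-num n))
    (solve 2 (λ q x → q :* (con (+ 1) :+ (q :- con (+ 1)) :* x) := con (+ 1) :+ (q :- con (+ 1)) :* (con (+ 1) :+ q :* x)) refl q (num n))

  num-embedℕ : q ≈ 1# → ∀ n → num n ≈ Defs.embedℕ K n
  num-embedℕ q≈1 zero = refl
  num-embedℕ q≈1 (suc n) = +-congˡ (trans (*-congʳ q≈1) (trans (*-identityˡ _) (num-embedℕ q≈1 n)))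

  -- Since q^m = 1 + (q - 1)[m], a zero of [m] would make q a root of unity, hence q = 1. Then [m]
  -- is the integer m, which is nonzero in characteristic zero.
  num-nonzero : ∀ n → ¬ (num (suc n) ≈ 0#)
  num-nonzero n num≈0 = char n (trans (sym (num-embedℕ q≈1 (suc n))) num≈0)
    where
    q≈1 : q ≈ 1#
    q≈1 = notRoot n (trans (pow-num (suc n)) (trans (+-congˡ (trans (*-congˡ num≈0) (zeroʳ _))) (+-identityʳ 1#)))

  num-cancel : ∀ n {x y} → num (suc n) * x ≈ num (suc n) * y → x ≈ y
  num-cancel n {x} {y} eq with proj₂ isField (num (suc n)) (num-nonzero n)
  ... | u , nu≈1 = begin
    x                        ≈⟨ trans (*-congʳ nu≈1) (*-identityˡ x) ⟨
    num (suc n) * u * x      ≈⟨ solve 3 (λ a u x → a :* u :* x := u :* (a :* x)) refl _ u x ⟩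
    u * (num (suc n) * x)    ≈⟨ *-congˡ eq ⟩
    u * (num (suc n) * y)    ≈⟨ solve 3 (λ a u x → a :* u :* x := u :* (a :* x)) refl _ u y ⟨
    num (suc n) * u * y      ≈⟨ trans (*-congʳ nu≈1) (*-identityˡ y) ⟩
    y                        ∎

theorem7p9 : ∀ {c ℓ} (R : CommutativeRing c ℓ) → IsField R → CharZero R →
    (q : CommutativeRing.Carrier R) → NotNontrivialRootOfUnity R q →
    (p n : ℕ) (v : Permutation′ (suc p)) → Indecomposable v →
    suc (len (suc p) (toFun v)) ≡ n →
    ∀ j → CommutativeRing._≈_ R (ν R q p v j) (_⋆_ R (numer R q n p v) (invPoch R q n) j)
theorem7p9 R isField char q notRoot p n v indec len≡n =
  Assembly.theorem R (proj₁ isField) q (Cancellation.num-cancel R isField char q notRoot) v indec n len≡n
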